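{- The dual Littlewood--Richardson polynomials have the following symmetry property: for all partitions $\lambda,\mu,\nu$, $$\widehat c_{\lambda\mu}^{\,\nu}(a)=\widehat c_{\lambda'\mu'}^{\,\nu'}(a'),$$ where $\lambda',\mu',\nu'$ are the conjugate partitions and $a'$ is the sequence with $(a')_i=-a_{ -i+1}$ for $i\in\mathbb Z$.
   Context: Let $a=(a_i)_{i\in\mathbb Z}$ be a sequence of commuting indeterminates and $\mathbb Q[a]$ the polynomial ring in the $a_i$. The polynomial $\widehat c(a')$ is obtained from $\widehat c(a)$ by substituting $(a')_i=-a_{ -i+1}$ for $a_i$ for all $i$. The ring $\Lambda(x\|a)$: its elements are sequences $P=(P_0,P_1,P_2,\dots)$, where $P_n$ is a symmetric polynomial in $x_1,\dots,x_n$ with coefficients in $\mathbb Q[a]$, the total degrees of the $P_n$ in the $x_i$ are bounded, and $P_n(x_1,\dots,x_{n-1},a_n)=P_{n-1}(x_1,\dots,x_{n-1})$ for all $n\geqslant 1$; multiplication is componentwise. It is freely generated over $\mathbb Q[a]$ by the double power sums $p_k(x\|a)=\sum_{i\geqslant 1}(x_i^k-a_i^k)$, $k\geqslant 1$. Double Schur functions: for a partition $\lambda$ with $\ell(\lambda)\leqslant n$, $$s_\lambda(x_1,\dots,x_n\|a)=\frac{\det\big[(x_i\|a)^{\lambda_j+n-j}\big]_{i,j=1}^n}{\prod_{1\leqslant i<j\leqslant n}(x_i-x_j)},\qquad (x_i\|a)^r=(x_i-a_n)(x_i-a_{n-1})\cdots(x_i-a_{n-r+1}),\ (x_i\|a)^0=1,$$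 and $0$ if $\ell(\lambda)>n$. This sequence is $s_\lambda(x\|a)\in\Lambda(x\|a)$; the $s_\lambda(x\|a)$ form a $\mathbb Q[a]$-basis. Dual Littlewood--Richardson polynomials: let $\Delta:\Lambda(x\|a)\to\Lambda(x\|a)\otimes_{\mathbb Q[a]}\Lambda(x\|a)$ be the $\mathbb Q[a]$-linear ring homomorphism with $\Delta(p_k(x\|a))=p_k(x\|a)\otimes 1+1\otimes p_k(x\|a)$. The $\widehat c_{\lambda\mu}^{\,\nu}(a)\in\mathbb Q[a]$ are defined by $\Delta(s_\nu(x\|a))=\sum_{\lambda,\mu}\widehat c_{\lambda\mu}^{\,\nu}(a)\,s_\lambda(x\|a)\otimes s_\mu(x\|a)$. -}

module Defs where

open import Algebra.Bundles using (CommutativeRing; Semiring; AbelianGroup)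
open import Algebra.Morphism.Structures using (module RingMorphisms)
import Algebra.Definitions.RawSemiring as RawSemiringDefs
import Algebra.Properties.AbelianGroup as AbelianGroupProperties
import Algebra.Properties.CommutativeMonoid.Sum as SumProperties
import Algebra.Properties.CommutativeSemigroup as CommutativeSemigroupProperties
open import Data.Bool.Base using (if_then_else_)
open import Data.Fin.Base as Fin using (Fin; toℕ; fromℕ; inject₁; punchIn)
open import Data.Fin.Permutation using (Permutation′; _⟨$⟩ʳ_)
open import Data.Fin.Properties as Fin using (toℕ-inject₁; toℕ-fromℕ)
open import Data.Integer.Base as ℤ using (ℤ; +_; _⊖_)
open import Data.List.Base as List using (List; []; _∷_; length; filter; applyUpTo)
open import Data.List.Membership.Propositional using (_∈_)
open import Data.List.Properties using (filter-accept)
open import Data.List.Relation.Unary.All as All using (All; []; _∷_)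
import Data.List.Relation.Unary.All.Properties as All
open import Data.List.Relation.Unary.Linked using (Linked)
import Data.List.Relation.Unary.Linked.Properties as Linked
open import Data.List.Relation.Unary.Unique.Propositional using (Unique)
open import Data.Nat.Base as ℕ using (ℕ; zero; suc; _∸_; _≤_; _<_; _≥_; z≤n; s≤s)
import Data.Nat.Properties as ℕ
open import Data.Product.Base using (∃-syntax; _×_; _,_; proj₁; proj₂)
open import Data.Rational.Base using (0ℚ)
open import Data.Rational.Properties using () renaming (+-*-commutativeRing to ℚ-ring)
open import Data.Vec.Functional using (Vector; insertAt)
open import Data.Vec.Functional.Properties using (insertAt-lookup)
open import Function.Base using (_∘_)
open import Level using (Level; _⊔_; 0ℓ) renaming (suc to lsuc)
open import Relation.Binary.PropositionalEquality.Core as ≡ using (_≡_)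
open import Relation.Unary using (Decidable)
open import Relation.Nullary.Decidable.Core using (yes; no; does)
open import Relation.Nullary.Negation.Core using (¬_; contradiction)

private
  variable
    c ℓ x y a₁ ℓ₁ a₂ ℓ₂ : Level

------------------------------------------------------------------------

record Partition : Set where
  constructor partition
  field
    parts       : List ℕ
    .decreasing : Linked _≥_ parts
    .positive   : All (0 <_) parts

open Partition public using (parts)

ℓength : Partition → ℕ
ℓength κ = length (parts κ)

-- Indexing is from 0, so λᵢ is `part λ (i ∸ 1)`; parts beyond ℓ(λ) are 0.
part : Partition → ℕ → ℕ
part κ = go (parts κ)
  where
  go : List ℕ → ℕ → ℕ
  go []       _       = 0
  go (m ∷ _)  zero    = m
  go (_ ∷ ms) (suc i) = go ms i

count> : ℕ → List ℕ → ℕ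
count> j ms = length (filter (j ℕ.<?_) ms)

largest : List ℕ → ℕ
largest []      = 0
largest (m ∷ _) = m

private
  length-filter-⊆ : {P Q : ℕ → Set} (P? : Decidable P) (Q? : Decidable Q) →
    (∀ {m} → P m → Q m) → ∀ ms → length (filter P? ms) ≤ length (filter Q? ms)
  length-filter-⊆ P? Q? P⊆Q [] = z≤n
  length-filter-⊆ P? Q? P⊆Q (m ∷ ms) with P? m | Q? m
  ... | yes _ | yes _ = s≤s (length-filter-⊆ P? Q? P⊆Q ms)
  ... | no  _ | yes _ = ℕ.m≤n⇒m≤1+n (length-filter-⊆ P? Q? P⊆Q ms)
  ... | yes p | no ¬q = contradiction (P⊆Q p) ¬q
  ... | no  _ | no  _ = length-filter-⊆ P? Q? P⊆Q ms

  count>-anti : ∀ j ms → count> j ms ≥ count> (suc j) ms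
  count>-anti j = length-filter-⊆ (suc j ℕ.<?_) (j ℕ.<?_) (ℕ.<-trans (ℕ.n<1+n j))

  count>-pos : ∀ ms {j} → j < largest ms → 0 < count> j ms
  count>-pos (m ∷ ms) {j} j<m =
    ≡.subst (λ l → 0 < length l) (≡.sym (filter-accept (j ℕ.<?_) {xs = ms} j<m)) (s≤s z≤n)

-- λ′ⱼ = #{ i : λᵢ ≥ j } for 1 ≤ j ≤ λ₁ (with j shifted down by one below).
infix 30 _ᵗ
_ᵗ : Partition → Partition
κ ᵗ = partition
  (applyUpTo (λ j → count> j ms) (largest ms))
  (Linked.applyUpTo⁺₂ _ (largest ms) (λ j → count>-anti j ms))
  (All.applyUpTo⁺₁ _ (largest ms) (count>-pos ms))
  where ms = parts κ

------------------------------------------------------------------------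
-- The polynomial ring R[X] on an arbitrary set X of commuting
-- indeterminates: ring expressions, modulo the least congruence that
-- makes them a commutative ring and `con` a ring homomorphism.

infixl 6 _⊕_
infixl 7 _⊛_
infix  8 ⊝_

data Poly (R : CommutativeRing c ℓ) (X : Set x) : Set (c ⊔ x) where
  con     : CommutativeRing.Carrier R → Poly R X
  var     : X → Poly R X
  _⊕_ _⊛_ : Poly R X → Poly R X → Poly R X
  ⊝_      : Poly R X → Poly R X

module _ {R : CommutativeRing c ℓ} {X : Set x} where

  private module R = CommutativeRing R

  infix 4 _≋_

  data _≋_ : Poly R X → Poly R X → Set (c ⊔ ℓ ⊔ x) where
    ≋-refl      : ∀ {p} → p ≋ p
    ≋-sym       : ∀ {p q} → p ≋ q → q ≋ p
    ≋-trans     : ∀ {p q r} → p ≋ q → q ≋ r → p ≋ r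
    con-cong    : ∀ {r s} → r R.≈ s → con r ≋ con s
    ⊕-cong      : ∀ {p p′ q q′} → p ≋ p′ → q ≋ q′ → p ⊕ q ≋ p′ ⊕ q′
    ⊛-cong      : ∀ {p p′ q q′} → p ≋ p′ → q ≋ q′ → p ⊛ q ≋ p′ ⊛ q′
    ⊝-cong      : ∀ {p p′} → p ≋ p′ → ⊝ p ≋ ⊝ p′
    ⊕-assoc     : ∀ p q r → (p ⊕ q) ⊕ r ≋ p ⊕ (q ⊕ r)
    ⊕-comm      : ∀ p q → p ⊕ q ≋ q ⊕ p
    ⊕-identityˡ : ∀ p → con R.0# ⊕ p ≋ p
    ⊕-inverseˡ  : ∀ p → ⊝ p ⊕ p ≋ con R.0#
    ⊛-assoc     : ∀ p q r → (p ⊛ q) ⊛ r ≋ p ⊛ (q ⊛ r)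
    ⊛-comm      : ∀ p q → p ⊛ q ≋ q ⊛ p
    ⊛-identityˡ : ∀ p → con R.1# ⊛ p ≋ p
    ⊛-distribˡ  : ∀ p q r → p ⊛ (q ⊕ r) ≋ (p ⊛ q) ⊕ (p ⊛ r)
    con-+       : ∀ r s → con (r R.+ s) ≋ con r ⊕ con s
    con-*       : ∀ r s → con (r R.* s) ≋ con r ⊛ con s

  -- An upper bound for the total degree in X, read off from an expression.
  degree : Poly R X → ℕ
  degree (con _) = 0
  degree (var _) = 1
  degree (p ⊕ q) = degree p ℕ.⊔ degree q
  degree (p ⊛ q) = degree p ℕ.+ degree q
  degree (⊝ p)   = degree p

  -- The total degree of the polynomial is the least bound over all
  -- expressions representing it.
  TotalDegree≤ : ℕ → Poly R X → Set (c ⊔ ℓ ⊔ x)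
  TotalDegree≤ d p = ∃[ q ] q ≋ p × degree q ≤ d

polyRing : CommutativeRing c ℓ → Set x → CommutativeRing (c ⊔ x) (c ⊔ ℓ ⊔ x)
polyRing R X = record
  { Carrier = Poly R X
  ; _≈_     = _≋_
  ; _+_     = _⊕_
  ; _*_     = _⊛_
  ; -_      = ⊝_
  ; 0#      = con (CommutativeRing.0# R)
  ; 1#      = con (CommutativeRing.1# R)
  ; isCommutativeRing = record
    { isRing = record
      { +-isAbelianGroup = record
        { isGroup = record
          { isMonoid = record
            { isSemigroup = record
              { isMagma = record
                { isEquivalence = record
                  { refl = ≋-refl ; sym = ≋-sym ; trans = ≋-trans }
                ; ∙-cong = ⊕-cong
                }
              ; assoc = ⊕-assoc
              }
            ; identity = ⊕-identityˡ
                       , λ p → ≋-trans (⊕-comm _ _) (⊕-identityˡ p)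
            }
          ; inverse = ⊕-inverseˡ
                    , λ p → ≋-trans (⊕-comm _ _) (⊕-inverseˡ p)
          ; ⁻¹-cong = ⊝-cong
          }
        ; comm = ⊕-comm
        }
      ; *-cong     = ⊛-cong
      ; *-assoc    = ⊛-assoc
      ; *-identity = ⊛-identityˡ
                   , λ p → ≋-trans (⊛-comm _ _) (⊛-identityˡ p)
      ; distrib    = ⊛-distribˡ
                   , λ p q r → ≋-trans (⊛-comm _ _)
                       (≋-trans (⊛-distribˡ p q r)
                         (⊕-cong (⊛-comm _ _) (⊛-comm _ _)))
      }
    ; *-comm = ⊛-comm
    }
  }

module _ {R : CommutativeRing c ℓ} {X : Set x} {Y : Set y} where

  substitute : (X → Poly R Y) → Poly R X → Poly R Y
  substitute f (con r) = con r
  substitute f (var i) = f i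
  substitute f (p ⊕ q) = substitute f p ⊕ substitute f q
  substitute f (p ⊛ q) = substitute f p ⊛ substitute f q
  substitute f (⊝ p)   = ⊝ substitute f p

  substitute-cong : (f : X → Poly R Y) → ∀ {p q} → p ≋ q → substitute f p ≋ substitute f q
  substitute-cong f ≋-refl            = ≋-refl
  substitute-cong f (≋-sym e)         = ≋-sym (substitute-cong f e)
  substitute-cong f (≋-trans e e′)    = ≋-trans (substitute-cong f e) (substitute-cong f e′)
  substitute-cong f (con-cong e)      = con-cong e
  substitute-cong f (⊕-cong e e′)     = ⊕-cong (substitute-cong f e) (substitute-cong f e′)
  substitute-cong f (⊛-cong e e′)     = ⊛-cong (substitute-cong f e) (substitute-cong f e′)
  substitute-cong f (⊝-cong e)        = ⊝-cong (substitute-cong f e)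
  substitute-cong f (⊕-assoc _ _ _)   = ⊕-assoc _ _ _
  substitute-cong f (⊕-comm _ _)      = ⊕-comm _ _
  substitute-cong f (⊕-identityˡ _)   = ⊕-identityˡ _
  substitute-cong f (⊕-inverseˡ _)    = ⊕-inverseˡ _
  substitute-cong f (⊛-assoc _ _ _)   = ⊛-assoc _ _ _
  substitute-cong f (⊛-comm _ _)      = ⊛-comm _ _
  substitute-cong f (⊛-identityˡ _)   = ⊛-identityˡ _
  substitute-cong f (⊛-distribˡ _ _ _) = ⊛-distribˡ _ _ _
  substitute-cong f (con-+ r s)       = con-+ r s
  substitute-cong f (con-* r s)       = con-* r s

  rename : (X → Y) → Poly R X → Poly R Y
  rename f = substitute (var ∘ f)

------------------------------------------------------------------------

module RingOperations (R : CommutativeRing c ℓ) where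

  open CommutativeRing R
  open RawSemiringDefs (Semiring.rawSemiring semiring) public using (sum; product; _^_)

  det : ∀ n → (Fin n → Fin n → Carrier) → Carrier
  det zero    M = 1#
  det (suc n) M = sum λ j → (- 1#) ^ toℕ j *
    (M Fin.zero j * det n (λ i k → M (Fin.suc i) (punchIn j k)))

------------------------------------------------------------------------

record CommutativeAlgebra (R : CommutativeRing c ℓ) a₁ ℓ₁
       : Set (c ⊔ ℓ ⊔ lsuc (a₁ ⊔ ℓ₁)) where
  private module R = CommutativeRing R
  field
    commutativeRing : CommutativeRing a₁ ℓ₁
  open CommutativeRing commutativeRing public
  open RingMorphisms R.rawRing rawRing using (IsRingHomomorphism)
  field
    ι                   : R.Carrier → Carrier
    ι-isRingHomomorphism : IsRingHomomorphism ι
  infixr 7 _·_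
  _·_ : R.Carrier → Carrier → Carrier
  r · p = ι r * p

module Tensor {R : CommutativeRing c ℓ}
              (A : CommutativeAlgebra R a₁ ℓ₁) (B : CommutativeAlgebra R a₂ ℓ₂) where

  private
    module R = CommutativeRing R
    module A = CommutativeAlgebra A
    module B = CommutativeAlgebra B

  infixl 7 _⊗_
  infixl 6 _+ᵀ_
  infix  8 -ᵀ_
  infix  4 _≈ᵀ_

  -- The free abelian group on the symbols p ⊗ q, modulo the relations of
  -- A ⊗_R B.
  data Carrierᵀ : Set (a₁ ⊔ a₂) where
    0ᵀ   : Carrierᵀ
    _⊗_  : A.Carrier → B.Carrier → Carrierᵀ
    _+ᵀ_ : Carrierᵀ → Carrierᵀ → Carrierᵀ
    -ᵀ_  : Carrierᵀ → Carrierᵀ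

  data _≈ᵀ_ : Carrierᵀ → Carrierᵀ → Set (c ⊔ a₁ ⊔ ℓ₁ ⊔ a₂ ⊔ ℓ₂) where
    ≈-refl      : ∀ {t} → t ≈ᵀ t
    ≈-sym       : ∀ {t u} → t ≈ᵀ u → u ≈ᵀ t
    ≈-trans     : ∀ {t u v} → t ≈ᵀ u → u ≈ᵀ v → t ≈ᵀ v
    +-cong      : ∀ {t t′ u u′} → t ≈ᵀ t′ → u ≈ᵀ u′ → t +ᵀ u ≈ᵀ t′ +ᵀ u′
    -‿cong      : ∀ {t t′} → t ≈ᵀ t′ → -ᵀ t ≈ᵀ -ᵀ t′
    +-assoc     : ∀ t u v → (t +ᵀ u) +ᵀ v ≈ᵀ t +ᵀ (u +ᵀ v)
    +-comm      : ∀ t u → t +ᵀ u ≈ᵀ u +ᵀ t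
    +-identityˡ : ∀ t → 0ᵀ +ᵀ t ≈ᵀ t
    -‿inverseˡ  : ∀ t → -ᵀ t +ᵀ t ≈ᵀ 0ᵀ
    ⊗-cong      : ∀ {p p′ q q′} → p A.≈ p′ → q B.≈ q′ → p ⊗ q ≈ᵀ p′ ⊗ q′
    ⊗-distribˡ  : ∀ p q q′ → p ⊗ (q B.+ q′) ≈ᵀ p ⊗ q +ᵀ p ⊗ q′
    ⊗-distribʳ  : ∀ p p′ q → (p A.+ p′) ⊗ q ≈ᵀ p ⊗ q +ᵀ p′ ⊗ q
    ⊗-balanced  : ∀ r p q → (r A.· p) ⊗ q ≈ᵀ p ⊗ (r B.· q)

  -- Multiplication is the biadditive extension of
  -- (p ⊗ q)(p′ ⊗ q′) = pp′ ⊗ qq′.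
  mulPure : A.Carrier → B.Carrier → Carrierᵀ → Carrierᵀ
  mulPure p q 0ᵀ         = 0ᵀ
  mulPure p q (p′ ⊗ q′)  = (p A.* p′) ⊗ (q B.* q′)
  mulPure p q (t +ᵀ u)   = mulPure p q t +ᵀ mulPure p q u
  mulPure p q (-ᵀ t)     = -ᵀ mulPure p q t

  infixl 7 _*ᵀ_
  _*ᵀ_ : Carrierᵀ → Carrierᵀ → Carrierᵀ
  0ᵀ       *ᵀ v = 0ᵀ
  (p ⊗ q)  *ᵀ v = mulPure p q v
  (t +ᵀ u) *ᵀ v = t *ᵀ v +ᵀ u *ᵀ v
  (-ᵀ t)   *ᵀ v = -ᵀ (t *ᵀ v)

  1ᵀ : Carrierᵀ
  1ᵀ = A.1# ⊗ B.1#

  +-abelianGroup : AbelianGroup _ _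
  +-abelianGroup = record
    { Carrier = Carrierᵀ ; _≈_ = _≈ᵀ_ ; _∙_ = _+ᵀ_ ; ε = 0ᵀ ; _⁻¹ = -ᵀ_
    ; isAbelianGroup = record
      { isGroup = record
        { isMonoid = record
          { isSemigroup = record
            { isMagma = record
              { isEquivalence = record { refl = ≈-refl ; sym = ≈-sym ; trans = ≈-trans }
              ; ∙-cong = +-cong
              }
            ; assoc = +-assoc
            }
          ; identity = +-identityˡ , λ t → ≈-trans (+-comm _ _) (+-identityˡ t)
          }
        ; inverse = -‿inverseˡ , λ t → ≈-trans (+-comm _ _) (-‿inverseˡ t)
        ; ⁻¹-cong = -‿cong
        }
      ; comm = +-comm
      }
    }

  private
    open AbelianGroupProperties +-abelianGroup
      using (ε⁻¹≈ε; ⁻¹-∙-comm)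
    open CommutativeSemigroupProperties (AbelianGroup.commutativeSemigroup +-abelianGroup)
      using (interchange)

    mulPure-congʳ : ∀ p q {t u} → t ≈ᵀ u → mulPure p q t ≈ᵀ mulPure p q u
    mulPure-congʳ p q ≈-refl          = ≈-refl
    mulPure-congʳ p q (≈-sym e)       = ≈-sym (mulPure-congʳ p q e)
    mulPure-congʳ p q (≈-trans e e′)  = ≈-trans (mulPure-congʳ p q e) (mulPure-congʳ p q e′)
    mulPure-congʳ p q (+-cong e e′)   = +-cong (mulPure-congʳ p q e) (mulPure-congʳ p q e′)
    mulPure-congʳ p q (-‿cong e)      = -‿cong (mulPure-congʳ p q e)
    mulPure-congʳ p q (+-assoc _ _ _) = +-assoc _ _ _
    mulPure-congʳ p q (+-comm _ _)    = +-comm _ _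
    mulPure-congʳ p q (+-identityˡ _) = +-identityˡ _
    mulPure-congʳ p q (-‿inverseˡ _)  = -‿inverseˡ _
    mulPure-congʳ p q (⊗-cong e e′)   = ⊗-cong (A.*-congˡ e) (B.*-congˡ e′)
    mulPure-congʳ p q (⊗-distribˡ _ _ _) =
      ≈-trans (⊗-cong A.refl (B.distribˡ _ _ _)) (⊗-distribˡ _ _ _)
    mulPure-congʳ p q (⊗-distribʳ _ _ _) =
      ≈-trans (⊗-cong (A.distribˡ _ _ _) B.refl) (⊗-distribʳ _ _ _)
    mulPure-congʳ p q (⊗-balanced r p′ q′) =
      ≈-trans (⊗-cong (xA p (A.ι r) p′) B.refl)
        (≈-trans (⊗-balanced r (p A.* p′) (q B.* q′))
          (⊗-cong A.refl (xB (B.ι r) q q′)))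
      where
      xA = CommutativeSemigroupProperties.x∙yz≈y∙xz A.*-commutativeSemigroup
      xB = CommutativeSemigroupProperties.x∙yz≈y∙xz B.*-commutativeSemigroup

    mulPure-cong : ∀ {p p′ q q′} t → p A.≈ p′ → q B.≈ q′ → mulPure p q t ≈ᵀ mulPure p′ q′ t
    mulPure-cong 0ᵀ       e f = ≈-refl
    mulPure-cong (p ⊗ q)  e f = ⊗-cong (A.*-congʳ e) (B.*-congʳ f)
    mulPure-cong (t +ᵀ u) e f = +-cong (mulPure-cong t e f) (mulPure-cong u e f)
    mulPure-cong (-ᵀ t)   e f = -‿cong (mulPure-cong t e f)

    mulPure-distribˡ : ∀ p q q′ t →
      mulPure p (q B.+ q′) t ≈ᵀ mulPure p q t +ᵀ mulPure p q′ t
    mulPure-distribˡ p q q′ 0ᵀ = ≈-sym (+-identityˡ _)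
    mulPure-distribˡ p q q′ (_ ⊗ _) =
      ≈-trans (⊗-cong A.refl (B.distribʳ _ _ _)) (⊗-distribˡ _ _ _)
    mulPure-distribˡ p q q′ (t +ᵀ u) =
      ≈-trans (+-cong (mulPure-distribˡ p q q′ t) (mulPure-distribˡ p q q′ u))
        (interchange _ _ _ _)
    mulPure-distribˡ p q q′ (-ᵀ t) =
      ≈-trans (-‿cong (mulPure-distribˡ p q q′ t)) (≈-sym (⁻¹-∙-comm _ _))

    mulPure-distribʳ : ∀ p p′ q t →
      mulPure (p A.+ p′) q t ≈ᵀ mulPure p q t +ᵀ mulPure p′ q t
    mulPure-distribʳ p p′ q 0ᵀ = ≈-sym (+-identityˡ _)
    mulPure-distribʳ p p′ q (_ ⊗ _) =
      ≈-trans (⊗-cong (A.distribʳ _ _ _) B.refl) (⊗-distribʳ _ _ _)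
    mulPure-distribʳ p p′ q (t +ᵀ u) =
      ≈-trans (+-cong (mulPure-distribʳ p p′ q t) (mulPure-distribʳ p p′ q u))
        (interchange _ _ _ _)
    mulPure-distribʳ p p′ q (-ᵀ t) =
      ≈-trans (-‿cong (mulPure-distribʳ p p′ q t)) (≈-sym (⁻¹-∙-comm _ _))

    mulPure-balanced : ∀ r p q t → mulPure (r A.· p) q t ≈ᵀ mulPure p (r B.· q) t
    mulPure-balanced r p q 0ᵀ = ≈-refl
    mulPure-balanced r p q (p′ ⊗ q′) =
      ≈-trans (⊗-cong (A.*-assoc _ _ _) B.refl)
        (≈-trans (⊗-balanced _ _ _) (⊗-cong A.refl (B.sym (B.*-assoc _ _ _))))
    mulPure-balanced r p q (t +ᵀ u) =
      +-cong (mulPure-balanced r p q t) (mulPure-balanced r p q u)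
    mulPure-balanced r p q (-ᵀ t) = -‿cong (mulPure-balanced r p q t)

    *-congˡ : ∀ t {u v} → u ≈ᵀ v → t *ᵀ u ≈ᵀ t *ᵀ v
    *-congˡ 0ᵀ        e = ≈-refl
    *-congˡ (p ⊗ q)   e = mulPure-congʳ p q e
    *-congˡ (t +ᵀ t′) e = +-cong (*-congˡ t e) (*-congˡ t′ e)
    *-congˡ (-ᵀ t)    e = -‿cong (*-congˡ t e)

    *-congʳ : ∀ v {t u} → t ≈ᵀ u → t *ᵀ v ≈ᵀ u *ᵀ v
    *-congʳ v ≈-refl               = ≈-refl
    *-congʳ v (≈-sym e)            = ≈-sym (*-congʳ v e)
    *-congʳ v (≈-trans e e′)       = ≈-trans (*-congʳ v e) (*-congʳ v e′)
    *-congʳ v (+-cong e e′)        = +-cong (*-congʳ v e) (*-congʳ v e′)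
    *-congʳ v (-‿cong e)           = -‿cong (*-congʳ v e)
    *-congʳ v (+-assoc _ _ _)      = +-assoc _ _ _
    *-congʳ v (+-comm _ _)         = +-comm _ _
    *-congʳ v (+-identityˡ _)      = +-identityˡ _
    *-congʳ v (-‿inverseˡ _)       = -‿inverseˡ _
    *-congʳ v (⊗-cong e f)         = mulPure-cong v e f
    *-congʳ v (⊗-distribˡ p q q′)  = mulPure-distribˡ p q q′ v
    *-congʳ v (⊗-distribʳ p p′ q)  = mulPure-distribʳ p p′ q v
    *-congʳ v (⊗-balanced r p q)   = mulPure-balanced r p q v

    *-zeroʳ : ∀ t → t *ᵀ 0ᵀ ≈ᵀ 0ᵀ
    *-zeroʳ 0ᵀ       = ≈-refl
    *-zeroʳ (_ ⊗ _)  = ≈-refl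
    *-zeroʳ (t +ᵀ u) = ≈-trans (+-cong (*-zeroʳ t) (*-zeroʳ u)) (+-identityˡ _)
    *-zeroʳ (-ᵀ t)   = ≈-trans (-‿cong (*-zeroʳ t)) ε⁻¹≈ε

    *-distribˡ : ∀ t u v → t *ᵀ (u +ᵀ v) ≈ᵀ t *ᵀ u +ᵀ t *ᵀ v
    *-distribˡ 0ᵀ        u v = ≈-sym (+-identityˡ _)
    *-distribˡ (_ ⊗ _)   u v = ≈-refl
    *-distribˡ (t +ᵀ t′) u v =
      ≈-trans (+-cong (*-distribˡ t u v) (*-distribˡ t′ u v)) (interchange _ _ _ _)
    *-distribˡ (-ᵀ t)    u v =
      ≈-trans (-‿cong (*-distribˡ t u v)) (≈-sym (⁻¹-∙-comm _ _))

    *-negʳ : ∀ t u → t *ᵀ (-ᵀ u) ≈ᵀ -ᵀ (t *ᵀ u)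
    *-negʳ 0ᵀ        u = ≈-sym ε⁻¹≈ε
    *-negʳ (_ ⊗ _)   u = ≈-refl
    *-negʳ (t +ᵀ t′) u = ≈-trans (+-cong (*-negʳ t u) (*-negʳ t′ u)) (⁻¹-∙-comm _ _)
    *-negʳ (-ᵀ t)    u = -‿cong (*-negʳ t u)

    *-comm : ∀ t u → t *ᵀ u ≈ᵀ u *ᵀ t
    *-comm 0ᵀ u = ≈-sym (*-zeroʳ u)
    *-comm (t +ᵀ t′) u =
      ≈-trans (+-cong (*-comm t u) (*-comm t′ u)) (≈-sym (*-distribˡ u t t′))
    *-comm (-ᵀ t) u = ≈-trans (-‿cong (*-comm t u)) (≈-sym (*-negʳ u t))
    *-comm (p ⊗ q) 0ᵀ = ≈-refl
    *-comm (p ⊗ q) (p′ ⊗ q′) = ⊗-cong (A.*-comm _ _) (B.*-comm _ _)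
    *-comm (p ⊗ q) (u +ᵀ u′) = +-cong (*-comm (p ⊗ q) u) (*-comm (p ⊗ q) u′)
    *-comm (p ⊗ q) (-ᵀ u) = -‿cong (*-comm (p ⊗ q) u)

    mulPure-assoc : ∀ p q u v → mulPure p q u *ᵀ v ≈ᵀ mulPure p q (u *ᵀ v)
    mulPure-assoc p q 0ᵀ v = ≈-refl
    mulPure-assoc p q (u +ᵀ u′) v =
      +-cong (mulPure-assoc p q u v) (mulPure-assoc p q u′ v)
    mulPure-assoc p q (-ᵀ u) v = -‿cong (mulPure-assoc p q u v)
    mulPure-assoc p q (p′ ⊗ q′) 0ᵀ = ≈-refl
    mulPure-assoc p q (p′ ⊗ q′) (_ ⊗ _) = ⊗-cong (A.*-assoc _ _ _) (B.*-assoc _ _ _)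
    mulPure-assoc p q (p′ ⊗ q′) (v +ᵀ v′) =
      +-cong (mulPure-assoc p q (p′ ⊗ q′) v) (mulPure-assoc p q (p′ ⊗ q′) v′)
    mulPure-assoc p q (p′ ⊗ q′) (-ᵀ v) = -‿cong (mulPure-assoc p q (p′ ⊗ q′) v)

    *-assoc : ∀ t u v → (t *ᵀ u) *ᵀ v ≈ᵀ t *ᵀ (u *ᵀ v)
    *-assoc 0ᵀ        u v = ≈-refl
    *-assoc (p ⊗ q)   u v = mulPure-assoc p q u v
    *-assoc (t +ᵀ t′) u v = +-cong (*-assoc t u v) (*-assoc t′ u v)
    *-assoc (-ᵀ t)    u v = -‿cong (*-assoc t u v)

    *-identityˡ : ∀ t → 1ᵀ *ᵀ t ≈ᵀ t
    *-identityˡ 0ᵀ       = ≈-refl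
    *-identityˡ (p ⊗ q)  = ⊗-cong (A.*-identityˡ p) (B.*-identityˡ q)
    *-identityˡ (t +ᵀ u) = +-cong (*-identityˡ t) (*-identityˡ u)
    *-identityˡ (-ᵀ t)   = -‿cong (*-identityˡ t)

  tensorRing : CommutativeRing _ _
  tensorRing = record
    { Carrier = Carrierᵀ ; _≈_ = _≈ᵀ_
    ; _+_ = _+ᵀ_ ; _*_ = _*ᵀ_ ; -_ = -ᵀ_ ; 0# = 0ᵀ ; 1# = 1ᵀ
    ; isCommutativeRing = record
      { isRing = record
        { +-isAbelianGroup = AbelianGroup.isAbelianGroup +-abelianGroup
        ; *-cong     = λ {t} {t′} {u} {u′} e f → ≈-trans (*-congʳ u e) (*-congˡ t′ f)
        ; *-assoc    = *-assoc
        ; *-identity = *-identityˡ , λ t → ≈-trans (*-comm t 1ᵀ) (*-identityˡ t)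
        ; distrib    = *-distribˡ , λ _ _ _ → ≈-refl
        }
      ; *-comm = *-comm
      }
    }

  private
    module T = CommutativeRing tensorRing
    module ιA = RingMorphisms.IsRingHomomorphism A.ι-isRingHomomorphism

    0⊗ : ∀ q → A.0# ⊗ q ≈ᵀ 0ᵀ
    0⊗ q = AbelianGroupProperties.identityˡ-unique +-abelianGroup _ (A.0# ⊗ q)
      (≈-trans (≈-sym (⊗-distribʳ _ _ _)) (⊗-cong (A.+-identityˡ _) B.refl))

    neg⊗ : ∀ p q → (A.- p) ⊗ q ≈ᵀ -ᵀ (p ⊗ q)
    neg⊗ p q = AbelianGroupProperties.inverseˡ-unique +-abelianGroup _ _
      (≈-trans (≈-sym (⊗-distribʳ _ _ _))
        (≈-trans (⊗-cong (A.-‿inverseˡ p) B.refl) (0⊗ q)))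

  tensorAlgebra : CommutativeAlgebra R _ _
  tensorAlgebra = record
    { commutativeRing = tensorRing
    ; ι = λ r → A.ι r ⊗ B.1#
    ; ι-isRingHomomorphism = record
      { isSemiringHomomorphism = record
        { isNearSemiringHomomorphism = record
          { +-isMonoidHomomorphism = record
            { isMagmaHomomorphism = record
              { isRelHomomorphism = record
                { cong = λ e → ⊗-cong (ιA.⟦⟧-cong e) B.refl }
              ; homo = λ r s →
                  ≈-trans (⊗-cong (ιA.+-homo r s) B.refl) (⊗-distribʳ _ _ _)
              }
            ; ε-homo = ≈-trans (⊗-cong ιA.0#-homo B.refl) (0⊗ _)
            }
          ; *-homo = λ r s → ⊗-cong (ιA.*-homo r s) (B.sym (B.*-identityˡ _))
          }
        ; 1#-homo = ⊗-cong ιA.1#-homo B.refl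
        }
      ; -‿homo = λ r → ≈-trans (⊗-cong (ιA.-‿homo r) B.refl) (neg⊗ _ _)
      }
    }

record IsAlgebraHomomorphism {R : CommutativeRing c ℓ}
       (A : CommutativeAlgebra R a₁ ℓ₁) (B : CommutativeAlgebra R a₂ ℓ₂)
       (f : CommutativeAlgebra.Carrier A → CommutativeAlgebra.Carrier B)
       : Set (c ⊔ a₁ ⊔ ℓ₁ ⊔ ℓ₂) where
  private
    module A = CommutativeAlgebra A
    module B = CommutativeAlgebra B
  open RingMorphisms A.rawRing B.rawRing using (IsRingHomomorphism)
  field
    isRingHomomorphism : IsRingHomomorphism f
    linear             : ∀ r p → f (r A.· p) B.≈ r B.· f p

------------------------------------------------------------------------

ℚ[a]-ring : CommutativeRing 0ℓ 0ℓ
ℚ[a]-ring = polyRing ℚ-ring ℤ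

ℚ[a] : Set
ℚ[a] = CommutativeRing.Carrier ℚ[a]-ring

a : ℤ → ℚ[a]
a = var

a′ : ℤ → ℚ[a]
a′ i = ⊝ a (ℤ.- i ℤ.+ + 1)

at-a′ : ℚ[a] → ℚ[a]
at-a′ = substitute a′

------------------------------------------------------------------------

-- ℚ[a][x₁,…,xₙ]; the indeterminate xᵢ is var applied to the element
-- i ∸ 1 of Fin n.
ℚ[a][x] : ℕ → CommutativeRing 0ℓ 0ℓ
ℚ[a][x] n = polyRing ℚ[a]-ring (Fin n)

Polyₓ : ℕ → Set
Polyₓ n = CommutativeRing.Carrier (ℚ[a][x] n)

Symmetric : ∀ {n} → Polyₓ n → Set
Symmetric {n} p = (σ : Permutation′ n) → rename (σ ⟨$⟩ʳ_) p ≋ p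

-- P(x₁,…,xₙ₊₁) ↦ P(x₁,…,xₙ,aₙ₊₁)
setLast : ∀ n → Polyₓ (suc n) → Polyₓ n
setLast n = substitute (insertAt var (fromℕ n) (con (a (+ suc n))))

record Λ : Set where
  field
    at        : ∀ n → Polyₓ n
    symmetric : ∀ n → Symmetric (at n)
    bounded   : ∃[ d ] ∀ n → TotalDegree≤ d (at n)
    stable    : ∀ n → setLast n (at (suc n)) ≋ at n

open Λ public using (at)

infix 4 _≈Λ_
_≈Λ_ : Λ → Λ → Set
P ≈Λ Q = ∀ n → at P n ≋ at Q n

constΛ : ℚ[a] → Λ
constΛ r = record
  { at        = λ n → con r
  ; symmetric = λ n σ → ≋-refl
  ; bounded   = 0 , λ n → con r , ≋-refl , z≤n
  ; stable    = λ n → ≋-refl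
  }

infixl 6 _+Λ_
_+Λ_ : Λ → Λ → Λ
P +Λ Q = record
  { at        = λ n → at P n ⊕ at Q n
  ; symmetric = λ n σ → ⊕-cong (P.symmetric n σ) (Q.symmetric n σ)
  ; bounded   = proj₁ P.bounded ℕ.⊔ proj₁ Q.bounded , λ n →
      let (p , p≋ , dp) = proj₂ P.bounded n
          (q , q≋ , dq) = proj₂ Q.bounded n
      in p ⊕ q , ⊕-cong p≋ q≋ , ℕ.⊔-mono-≤ dp dq
  ; stable    = λ n → ⊕-cong (P.stable n) (Q.stable n)
  }
  where module P = Λ P
        module Q = Λ Q

infixl 7 _*Λ_
_*Λ_ : Λ → Λ → Λ
P *Λ Q = record
  { at        = λ n → at P n ⊛ at Q n
  ; symmetric = λ n σ → ⊛-cong (P.symmetric n σ) (Q.symmetric n σ)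
  ; bounded   = proj₁ P.bounded ℕ.+ proj₁ Q.bounded , λ n →
      let (p , p≋ , dp) = proj₂ P.bounded n
          (q , q≋ , dq) = proj₂ Q.bounded n
      in p ⊛ q , ⊛-cong p≋ q≋ , ℕ.+-mono-≤ dp dq
  ; stable    = λ n → ⊛-cong (P.stable n) (Q.stable n)
  }
  where module P = Λ P
        module Q = Λ Q

infix 8 -Λ_
-Λ_ : Λ → Λ
-Λ P = record
  { at        = λ n → ⊝ at P n
  ; symmetric = λ n σ → ⊝-cong (P.symmetric n σ)
  ; bounded   = proj₁ P.bounded , λ n →
      let (p , p≋ , dp) = proj₂ P.bounded n in ⊝ p , ⊝-cong p≋ , dp
  ; stable    = λ n → ⊝-cong (P.stable n)
  }
  where module P = Λ P

Λ-ring : CommutativeRing 0ℓ 0ℓ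
Λ-ring = record
  { Carrier = Λ ; _≈_ = _≈Λ_
  ; _+_ = _+Λ_ ; _*_ = _*Λ_ ; -_ = -Λ_
  ; 0# = constΛ (CommutativeRing.0# ℚ[a]-ring) ; 1# = constΛ (CommutativeRing.1# ℚ[a]-ring)
  ; isCommutativeRing = record
    { isRing = record
      { +-isAbelianGroup = record
        { isGroup = record
          { isMonoid = record
            { isSemigroup = record
              { isMagma = record
                { isEquivalence = record
                  { refl  = λ n → ≋-refl
                  ; sym   = λ e n → ≋-sym (e n)
                  ; trans = λ e f n → ≋-trans (e n) (f n)
                  }
                ; ∙-cong = λ e f n → ⊕-cong (e n) (f n)
                }
              ; assoc = λ P Q S n → ⊕-assoc _ _ _
              }
            ; identity = (λ P n → S.+-identityˡ n _) , (λ P n → S.+-identityʳ n _)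
            }
          ; inverse = (λ P n → S.-‿inverseˡ n _) , (λ P n → S.-‿inverseʳ n _)
          ; ⁻¹-cong = λ e n → ⊝-cong (e n)
          }
        ; comm = λ P Q n → ⊕-comm _ _
        }
      ; *-cong     = λ e f n → ⊛-cong (e n) (f n)
      ; *-assoc    = λ P Q S n → ⊛-assoc _ _ _
      ; *-identity = (λ P n → S.*-identityˡ n _) , (λ P n → S.*-identityʳ n _)
      ; distrib    = (λ P Q T n → S.distribˡ n _ _ _) , (λ P Q T n → S.distribʳ n _ _ _)
      }
    ; *-comm = λ P Q n → ⊛-comm _ _
    }
  }
  where module S n = CommutativeRing (ℚ[a][x] n)

Λ-algebra : CommutativeAlgebra ℚ[a]-ring 0ℓ 0ℓ
Λ-algebra = record
  { commutativeRing = Λ-ring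
  ; ι = constΛ
  ; ι-isRingHomomorphism = record
    { isSemiringHomomorphism = record
      { isNearSemiringHomomorphism = record
        { +-isMonoidHomomorphism = record
          { isMagmaHomomorphism = record
            { isRelHomomorphism = record { cong = λ e n → con-cong e }
            ; homo = λ r s n → con-+ r s
            }
          ; ε-homo = λ n → ≋-refl
          }
        ; *-homo = λ r s n → con-* r s
        }
      ; 1#-homo = λ n → ≋-refl
      }
    ; -‿homo = λ r n → AbelianGroupProperties.inverseˡ-unique (S.+-abelianGroup n) _ _
        (≋-trans (≋-sym (con-+ _ _)) (con-cong (⊕-inverseˡ r)))
    }
  }
  where module S n = CommutativeRing (ℚ[a][x] n)

------------------------------------------------------------------------

module _ (n : ℕ) where
  open CommutativeRing (ℚ[a][x] n)
  open RingOperations (ℚ[a][x] n)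

  powerSum : ℕ → Polyₓ n
  powerSum k = sum λ (i : Fin n) → var i ^ k - con (a (+ suc (toℕ i))) ^ k

  -- (xᵢ‖a)ʳ = (xᵢ - aₙ)(xᵢ - aₙ₋₁)⋯(xᵢ - aₙ₋ᵣ₊₁)
  shiftedPower : Fin n → ℕ → Polyₓ n
  shiftedPower i r = product λ (m : Fin r) → var i - con (a (n ⊖ toℕ m))

  -- The exponent in column j is λⱼ + n - j, with j counted from 1.
  alternant : Partition → Polyₓ n
  alternant κ = det n λ i j → shiftedPower i (part κ (toℕ j) ℕ.+ (n ∸ suc (toℕ j)))

  vandermonde : Polyₓ n
  vandermonde = product λ (i : Fin n) → product λ (j : Fin n) →
    if does (i Fin.<? j) then var i - var j else 1#

private
  module _ {m n : ℕ} (f : Fin m → Polyₓ n) where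
    module M = RingOperations (ℚ[a][x] m)
    module N = RingOperations (ℚ[a][x] n)

    substitute-sum : ∀ {l} (g : Fin l → Polyₓ m) →
      substitute f (M.sum g) ≡ N.sum (λ i → substitute f (g i))
    substitute-sum {zero}  g = ≡.refl
    substitute-sum {suc l} g = ≡.cong (substitute f (g Fin.zero) ⊕_) (substitute-sum (λ i → g (Fin.suc i)))

    substitute-^ : ∀ p k → substitute f (p M.^ k) ≡ substitute f p N.^ k
    substitute-^ p zero    = ≡.refl
    substitute-^ p (suc k) = ≡.cong (substitute f p ⊛_) (substitute-^ p k)

    substitute-powerSum : ∀ k → substitute f (powerSum m k) ≋
      N.sum (λ i → f i N.^ k ⊕ ⊝ (con (a (+ suc (toℕ i))) N.^ k))
    substitute-powerSum k =
      ≋-trans (CommutativeRing.reflexive (ℚ[a][x] n) 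
          (substitute-sum (λ i → var i M.^ k ⊕ ⊝ (con (a (+ suc (toℕ i))) M.^ k))))
        (SumProperties.sum-cong-≋ (CommutativeRing.+-commutativeMonoid (ℚ[a][x] n))
          (λ i → CommutativeRing.reflexive (ℚ[a][x] n)
            (≡.cong₂ (λ u v → u ⊕ ⊝ v) (substitute-^ (var i) k) (substitute-^ (con _) k))))

  powerSum-symmetric : ∀ k n → Symmetric (powerSum n k)
  powerSum-symmetric k n σ =
    ≋-trans (substitute-powerSum (λ i → var (σ ⟨$⟩ʳ i)) k)
      (≋-trans (∑-distrib-+ (λ i → X (σ ⟨$⟩ʳ i)) C)
        (≋-trans (⊕-cong (≋-sym (sum-permute X σ)) ≋-refl)
          (≋-sym (∑-distrib-+ X C))))
    where
    open SumProperties (CommutativeRing.+-commutativeMonoid (ℚ[a][x] n))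
    open RingOperations (ℚ[a][x] n) using (_^_)
    X C : Fin n → Polyₓ n
    X i = var i ^ k
    C i = ⊝ (con (a (+ suc (toℕ i))) ^ k)

  degree-^ : ∀ n (p : Polyₓ n) k → let open RingOperations (ℚ[a][x] n) in
    degree (p ^ k) ≡ k ℕ.* degree p
  degree-^ n p zero    = ≡.refl
  degree-^ n p (suc k) = ≡.cong (degree p ℕ.+_) (degree-^ n p k)

  degree-sum : ∀ n k {l} (g : Fin l → Polyₓ n) → (∀ i → degree (g i) ≤ k) →
    degree (RingOperations.sum (ℚ[a][x] n) g) ≤ k
  degree-sum n k {zero}  g h = z≤n
  degree-sum n k {suc l} g h =
    ℕ.⊔-lub (h Fin.zero) (degree-sum n k (λ i → g (Fin.suc i)) (λ i → h (Fin.suc i)))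

  powerSum-bounded : ∀ k n → degree (powerSum n k) ≤ k
  powerSum-bounded k n = degree-sum n k (λ i → var i ^ k ⊕ ⊝ (con (a (+ suc (toℕ i))) ^ k)) λ i → ℕ.⊔-lub
    (ℕ.≤-reflexive (≡.trans (degree-^ n (var i) k) (ℕ.*-identityʳ k)))
    (ℕ.≤-trans (ℕ.≤-reflexive (≡.trans (degree-^ n (con (a (+ suc (toℕ i)))) k) (ℕ.*-zeroʳ k))) z≤n)
    where open RingOperations (ℚ[a][x] n) using (_^_)

  insertAt-inject₁ : ∀ {A : Set} {n} (f : Vector A n) v i →
    insertAt f (fromℕ n) v (inject₁ i) ≡ f i
  insertAt-inject₁ f v Fin.zero    = ≡.refl
  insertAt-inject₁ f v (Fin.suc i) = insertAt-inject₁ (λ j → f (Fin.suc j)) v i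

  powerSum-stable : ∀ k n → setLast n (powerSum (suc n) k) ≋ powerSum n k
  powerSum-stable k n =
    ≋-trans (substitute-powerSum ins k)
      (≋-trans (sum-init-last t)
        (≋-trans (⊕-cong (sum-cong-≋ init≋) last≋) (S.+-identityʳ _)))
    where
    module S = CommutativeRing (ℚ[a][x] n)
    open SumProperties S.+-commutativeMonoid
    open RingOperations (ℚ[a][x] n) using (_^_)
    ins : Fin (suc n) → Polyₓ n
    ins = insertAt var (fromℕ n) (con (a (+ suc n)))
    term : Polyₓ n → ℕ → Polyₓ n
    term u i = u ^ k ⊕ ⊝ (con (a (+ suc i)) ^ k)
    t : Fin (suc n) → Polyₓ n
    t i = term (ins i) (toℕ i)
    init≋ : ∀ i → t (inject₁ i) ≋ term (var i) (toℕ i)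
    init≋ i = S.reflexive (≡.cong₂ term (insertAt-inject₁ var _ i) (toℕ-inject₁ i))
    last≋ : t (fromℕ n) ≋ S.0#
    last≋ = ≋-trans
      (S.reflexive (≡.cong₂ term (insertAt-lookup var (fromℕ n) _) (toℕ-fromℕ n)))
      (S.-‿inverseʳ _)

-- pₖ(x‖a); this is only meant for k ≥ 1.
doublePowerSum : ℕ → Λ
doublePowerSum k = record
  { at        = λ n → powerSum n k
  ; symmetric = powerSum-symmetric k
  ; bounded   = k , λ n → powerSum n k , ≋-refl , powerSum-bounded k n
  ; stable    = powerSum-stable k
  }

-- P = s_λ(x‖a).  The quotient alternant/vandermonde is the unique
-- polynomial whose product with the Vandermonde product is the alternant.
record IsDoubleSchur (κ : Partition) (P : Λ) : Set where
  field
    quotient : ∀ n → ℓength κ ≤ n → at P n ⊛ vandermonde n ≋ alternant n κ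
    vanish   : ∀ n → n < ℓength κ → at P n ≋ con (con 0ℚ)

------------------------------------------------------------------------

Λ⊗Λ : CommutativeAlgebra ℚ[a]-ring 0ℓ 0ℓ
Λ⊗Λ = Tensor.tensorAlgebra Λ-algebra Λ-algebra

module Λ⊗Λ = CommutativeAlgebra Λ⊗Λ

open Tensor Λ-algebra Λ-algebra public using (_⊗_)

1Λ : Λ
1Λ = CommutativeAlgebra.1# Λ-algebra

record IsComultiplication (Δ : Λ → Λ⊗Λ.Carrier) : Set where
  field
    isAlgebraHomomorphism : IsAlgebraHomomorphism Λ-algebra Λ⊗Λ Δ
    powerSum-primitive : ∀ k → 1 ≤ k →
      Δ (doublePowerSum k) Λ⊗Λ.≈ doublePowerSum k ⊗ 1Λ Λ⊗Λ.+ 1Λ ⊗ doublePowerSum k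

∑⊗ : List (Partition × Partition) → (Partition → Partition → Λ⊗Λ.Carrier) → Λ⊗Λ.Carrier
∑⊗ L f = List.foldr (λ (κ , μ) t → f κ μ Λ⊗Λ.+ t) Λ⊗Λ.0# L

-- ĉ κ μ ν is the coefficient of s_κ ⊗ s_μ in Δ(s_ν).  Like any expansion in
-- a basis, the sum has finitely many nonzero coefficients: all those outside
-- a duplicate-free list of index pairs are zero.
IsDualLR : (Partition → Λ) → (Λ → Λ⊗Λ.Carrier) →
           (Partition → Partition → Partition → ℚ[a]) → Set
IsDualLR s Δ ĉ = ∀ ν → ∃[ L ] Unique L
  × (∀ κ μ → ¬ (κ , μ) ∈ L → ĉ κ μ ν ≋ con 0ℚ)
  × Δ (s ν) Λ⊗Λ.≈ ∑⊗ L (λ κ μ → ĉ κ μ ν Λ⊗Λ.· (s κ ⊗ s μ))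

{-# OPTIONS --safe #-}

-- The values of P ∈ Λ(x‖a) at the points a_μ = (a_{1−μ₁}, a_{2−μ₂}, …), taken
-- over all partitions μ, determine P.  The values of the double Schur functions
-- vanish unless λ ⊆ μ and satisfy the recursion
--   (p₁(a_μ‖a) − p₁(a_λ‖a)) s_λ(a_μ‖a) = Σ s_κ(a_μ‖a),
-- summed over the κ obtained from λ by adding a box; together with s_∅ = 1 this
-- determines them.  All of these conditions are invariant under conjugating the
-- partitions and substituting a′ for a, so s_λ′(a_μ′‖a) turns into s_λ(a_μ‖a).
-- On pₖ(x‖a) the same operation is multiplication by (−1)ᵏ⁻¹, which preserves
-- primitivity; since the pₖ(x‖a) generate Λ(x‖a), it is therefore compatible
-- with Δ.  The coefficients of Δ(s_ν) can be read off from its values at pairs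
-- of points, because s_λ ⊗ s_μ is triangular with respect to inclusion.
module Submission where

open import Defs

open import Algebra.Bundles using (CommutativeRing)
open import Algebra.Morphism.Structures using (module RingMorphisms)
import Algebra.Properties.AbelianGroup as AbelianGroupProperties
import Algebra.Properties.CommutativeMonoid.Sum as SumProperties
import Algebra.Properties.CommutativeSemigroup as CommutativeSemigroupProperties
import Algebra.Properties.Ring as RingProperties
import Algebra.Properties.Semiring.Exp as Exp
import Algebra.Properties.Semiring.Mult as Mult
import Algebra.Properties.Semiring.Sum as SemiringSum
import Algebra.Solver.Ring
open import Algebra.Solver.Ring.AlmostCommutativeRing
  using (fromCommutativeRing; _-Raw-AlmostCommutative⟶_)
open import Data.Bool.Base using (if_then_else_; true; false)
open import Data.Fin.Base as Fin using (Fin; toℕ; fromℕ; inject₁; punchIn; punchOut)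
open import Data.Fin.Permutation as Perm using (Permutation′; _⟨$⟩ʳ_)
open import Data.Fin.Properties as Fin using (toℕ-inject₁; toℕ-fromℕ)
open import Data.Fin.Relation.Unary.Top using (view; ‵fromℕ; ‵inject₁)
open import Data.Integer.Base as ℤ using (ℤ; +_; -[1+_]; _⊖_)
import Data.Integer.Properties as ℤ
open import Data.List.Base as List
  using (List; []; _∷_; _++_; length; applyUpTo; deduplicate)
import Data.List.Membership.DecPropositional as DecMembership
open import Data.List.Membership.Propositional using (_∈_; _∉_)
open import Data.List.Membership.Propositional.Properties
  using (∈-∃++; ∈-map⁺; ∈-++⁺ˡ; ∈-++⁺ʳ; ∈-deduplicate⁺)
open import Data.List.Properties using (filter-accept; filter-reject; length-applyUpTo)
open import Data.List.Relation.Binary.Permutation.Propositional using (↭⇒↭ₛ; ↭-sym)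
open import Data.List.Relation.Binary.Permutation.Propositional.Properties using (shift; ∈-resp-↭)
import Data.List.Relation.Binary.Permutation.Setoid.Properties as Permutationₛ
open import Data.List.Relation.Unary.All as All using (All; []; _∷_)
import Data.List.Relation.Unary.All.Properties as All
open import Data.List.Relation.Unary.AllPairs using ([]; _∷_)
open import Data.List.Relation.Unary.Any using (here; there)
open import Data.List.Relation.Unary.Linked as Linked using (Linked; []; [-]; _∷_)
import Data.List.Relation.Unary.Linked.Properties as Linked
open import Data.List.Relation.Unary.Unique.DecPropositional.Properties using (deduplicate-!)
open import Data.List.Relation.Unary.Unique.Propositional using (Unique)
import Data.List.Relation.Unary.Unique.Propositional.Properties as Unique
open import Data.Maybe.Base using (Maybe; just; nothing)
open import Data.Nat.Base as ℕ using (ℕ; zero; suc; _∸_; _≤_; _<_; _≥_; z≤n; s≤s)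
import Data.Nat.ListAction as ℕ
import Data.Nat.Properties as ℕ
open import Data.Product.Base using (∃-syntax; _×_; _,_; proj₁; proj₂)
open import Data.Product.Properties using (≡-dec)
open import Data.Rational.Base as ℚ using (ℚ; 0ℚ; 1ℚ; 1/_)
open import Data.Rational.Properties as ℚ using () renaming (+-*-commutativeRing to ℚ-ring)
open import Data.Sum.Base using (_⊎_; inj₁; inj₂)
open import Data.Unit.Base using (⊤)
open import Data.Vec.Base as Vec
  using (Vec; []; _∷_; _∷ʳ_; updateAt; lookup; zipWith; replicate; initLast)
open import Data.Vec.Functional using (Vector; insertAt; removeAt)
open import Data.Vec.Functional.Properties using (insertAt-lookup)
open import Function.Base using (_∘_; id)
open import Level using (Level; _⊔_)
open import Relation.Binary.Definitions using (DecidableEquality; tri<; tri≈; tri>)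
open import Relation.Binary.PropositionalEquality.Core as ≡ using (_≡_; _≢_)
open import Relation.Binary.PropositionalEquality.Properties using () renaming (setoid to ≡-setoid)
open import Relation.Nullary.Decidable using (dec-true; dec-false; _×-dec_)
open import Relation.Nullary.Decidable.Core using (Dec; yes; no; does; recompute)
open import Relation.Nullary.Negation.Core using (¬_; contradiction)

-- Equality in `Poly` is generated by axioms, so at the start neither cancellation nor comparison of
-- coefficients is available in Q[a]. Every factor that is divided out is first shown to be regular.
-- The basic regular elements are aₘ - r with r free of aₘ; the Vandermonde factors and the
-- differences of weights have this form, and all other cancelled factors are products of these or
-- divide such products. The diagonal value s_μ(a_μ‖a) is not computed as a product over boxes.
-- Running the recursion from μ down to ∅ gives num · s_μ(a_μ‖a) = den with den regular, and a
-- factor of a regular element is regular. The conjugated values satisfy a recursion with the same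
-- coefficients and so share num and den: one argument yields both uniqueness and regularity.
-- Generation by the pₖ(x‖a) has to be proved from the definition of Λ by sequences. A symmetric
-- polynomial is averaged and rewritten in power sums at a single level n = d, the degree bound, and
-- the bound then forces agreement at all levels. The operation on the pₖ is applied to an
-- expression of s_ν, and its result is identified with s_ν′ by its values.

private
  variable
    c ℓ c′ ℓ′ x : Level

-- The integers map to every commutative ring and have decidable equality. As coefficients they let
-- identities be normalised in rings such as `Poly`, whose equality comes with no decision
-- procedure.
module IntegerSolver (R : CommutativeRing c ℓ) where

  open CommutativeRing R
  open RingProperties ring using (-‿distribˡ-*; -‿distribʳ-*; -0#≈0#; -‿involutive)
  open AbelianGroupProperties +-abelianGroup using (⁻¹-∙-comm)
  open Mult semiring using (×-homo-+; ×1-homo-*; ×-homo-1) renaming (_×_ to _•_)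
  open import Relation.Binary.Reasoning.Setoid setoid

  private
    ⟦_⟧ : ℤ → Carrier
    ⟦ + n ⟧      = n • 1#
    ⟦ -[1+ n ] ⟧ = - (suc n • 1#)

    ⊖-homo : ∀ m n → ⟦ m ⊖ n ⟧ ≈ m • 1# - n • 1#
    ⊖-homo m zero = sym (trans (+-congˡ -0#≈0#) (+-identityʳ _))
    ⊖-homo zero (suc n) = sym (+-identityˡ _)
    ⊖-homo (suc m) (suc n) = begin
      ⟦ suc m ⊖ suc n ⟧             ≡⟨ ≡.cong ⟦_⟧ (ℤ.[1+m]⊖[1+n]≡m⊖n m n) ⟩
      ⟦ m ⊖ n ⟧                     ≈⟨ ⊖-homo m n ⟩
      m • 1# - n • 1#               ≈⟨ +-congʳ (trans (+-congʳ (-‿inverseʳ 1#)) (+-identityˡ _)) ⟨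
      ((1# - 1#) + m • 1#) - n • 1# ≈⟨ +-congʳ (trans (+-assoc _ _ _) (trans (+-congˡ (+-comm _ _)) (sym (+-assoc _ _ _)))) ⟩
      (suc m • 1# - 1#) - n • 1#    ≈⟨ +-assoc _ _ _ ⟩
      suc m • 1# + (- 1# - n • 1#)  ≈⟨ +-congˡ (⁻¹-∙-comm _ _) ⟩
      suc m • 1# - suc n • 1#       ∎

    neg-homo : ∀ i → ⟦ ℤ.- i ⟧ ≈ - ⟦ i ⟧
    neg-homo (+ zero)  = sym -0#≈0#
    neg-homo (+ suc n) = refl
    neg-homo -[1+ n ]  = sym (-‿involutive _)

    +-homo : ∀ i j → ⟦ i ℤ.+ j ⟧ ≈ ⟦ i ⟧ + ⟦ j ⟧
    +-homo (+ m) (+ n)         = ×-homo-+ 1# m n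
    +-homo (+ m) -[1+ n ]      = ⊖-homo m (suc n)
    +-homo -[1+ m ] (+ n)      = trans (⊖-homo n (suc m)) (+-comm _ _)
    +-homo -[1+ m ] -[1+ n ]   = begin
      - (1# + (1# + (m ℕ.+ n) • 1#)) ≈⟨ -‿cong (+-congˡ (trans (+-congˡ (×-homo-+ 1# m n)) (trans (sym (+-assoc _ _ _)) (trans (+-congʳ (+-comm _ _)) (+-assoc _ _ _))))) ⟩
      - (1# + (m • 1# + suc n • 1#)) ≈⟨ -‿cong (+-assoc _ _ _) ⟨
      - (suc m • 1# + suc n • 1#)    ≈⟨ ⁻¹-∙-comm _ _ ⟨
      - (suc m • 1#) - suc n • 1#    ∎

    pos-*-homo : ∀ m j → ⟦ + m ℤ.* j ⟧ ≈ m • 1# * ⟦ j ⟧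
    pos-*-homo m (+ n) = trans (reflexive (≡.cong ⟦_⟧ (≡.sym (ℤ.pos-* m n)))) (×1-homo-* m n)
    pos-*-homo m -[1+ n ] = begin
      ⟦ + m ℤ.* -[1+ n ] ⟧         ≡⟨ ≡.cong ⟦_⟧ (ℤ.neg-distribʳ-* (+ m) (+ suc n)) ⟨
      ⟦ ℤ.- (+ m ℤ.* + suc n) ⟧    ≈⟨ neg-homo (+ m ℤ.* + suc n) ⟩
      - ⟦ + m ℤ.* + suc n ⟧        ≈⟨ -‿cong (pos-*-homo m (+ suc n)) ⟩
      - (m • 1# * (suc n • 1#))    ≈⟨ -‿distribʳ-* _ _ ⟩
      m • 1# * - (suc n • 1#)      ∎

    *-homo : ∀ i j → ⟦ i ℤ.* j ⟧ ≈ ⟦ i ⟧ * ⟦ j ⟧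
    *-homo (+ m) j = pos-*-homo m j
    *-homo -[1+ m ] j = begin
      ⟦ -[1+ m ] ℤ.* j ⟧         ≡⟨ ≡.cong ⟦_⟧ (ℤ.neg-distribˡ-* (+ suc m) j) ⟨
      ⟦ ℤ.- (+ suc m ℤ.* j) ⟧    ≈⟨ neg-homo (+ suc m ℤ.* j) ⟩
      - ⟦ + suc m ℤ.* j ⟧        ≈⟨ -‿cong (pos-*-homo (suc m) j) ⟩
      - (suc m • 1# * ⟦ j ⟧)     ≈⟨ -‿distribˡ-* _ _ ⟩
      - (suc m • 1#) * ⟦ j ⟧     ∎

    homomorphism : ℤ.+-*-rawRing -Raw-AlmostCommutative⟶ fromCommutativeRing R
    homomorphism = record
      { ⟦_⟧ = ⟦_⟧ ; +-homo = +-homo ; *-homo = *-homo ; -‿homo = neg-homo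
      ; 0-homo = refl ; 1-homo = ×-homo-1 1# }

    _coeff≟_ : ∀ i j → Maybe (⟦ i ⟧ ≈ ⟦ j ⟧)
    i coeff≟ j with i ℤ.≟ j
    ... | yes i≡j = just (reflexive (≡.cong ⟦_⟧ i≡j))
    ... | no  _   = nothing

  open Algebra.Solver.Ring ℤ.+-*-rawRing (fromCommutativeRing R) homomorphism _coeff≟_ public
    using (solve; _:=_; _:+_; _:*_; _:-_; :-_; con)

-- Homomorphisms and regular elements

record Hom (R : CommutativeRing c ℓ) (S : CommutativeRing c′ ℓ′) : Set (c ⊔ ℓ ⊔ c′ ⊔ ℓ′) where
  private
    module R = CommutativeRing R
    module S = CommutativeRing S
  field
    ⟦_⟧    : R.Carrier → S.Carrier
    ⟦⟧-cong : ∀ {r s} → r R.≈ s → ⟦ r ⟧ S.≈ ⟦ s ⟧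
    +-homo : ∀ r s → ⟦ r R.+ s ⟧ S.≈ ⟦ r ⟧ S.+ ⟦ s ⟧
    *-homo : ∀ r s → ⟦ r R.* s ⟧ S.≈ ⟦ r ⟧ S.* ⟦ s ⟧
    1-homo : ⟦ R.1# ⟧ S.≈ S.1#

  0-homo : ⟦ R.0# ⟧ S.≈ S.0#
  0-homo = AbelianGroupProperties.identityˡ-unique S.+-abelianGroup _ ⟦ R.0# ⟧
    (S.trans (S.sym (+-homo _ _)) (⟦⟧-cong (R.+-identityˡ _)))

  -‿homo : ∀ r → ⟦ R.- r ⟧ S.≈ S.- ⟦ r ⟧
  -‿homo r = AbelianGroupProperties.inverseˡ-unique S.+-abelianGroup _ _
    (S.trans (S.sym (+-homo _ _)) (S.trans (⟦⟧-cong (R.-‿inverseˡ r)) 0-homo))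

  private
    module OR = RingOperations R
    module OS = RingOperations S

  ^-homo : ∀ r k → ⟦ r OR.^ k ⟧ S.≈ ⟦ r ⟧ OS.^ k
  ^-homo r zero    = 1-homo
  ^-homo r (suc k) = S.trans (*-homo _ _) (S.*-congˡ (^-homo r k))

  sum-homo : ∀ {n} (t : Fin n → R.Carrier) → ⟦ OR.sum t ⟧ S.≈ OS.sum (λ i → ⟦ t i ⟧)
  sum-homo {zero}  t = 0-homo
  sum-homo {suc n} t = S.trans (+-homo _ _) (S.+-congˡ (sum-homo (t ∘ Fin.suc)))

  product-homo : ∀ {n} (t : Fin n → R.Carrier) → ⟦ OR.product t ⟧ S.≈ OS.product (λ i → ⟦ t i ⟧)
  product-homo {zero}  t = 1-homo
  product-homo {suc n} t = S.trans (*-homo _ _) (S.*-congˡ (product-homo (t ∘ Fin.suc)))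

  det-homo : ∀ n M → ⟦ OR.det n M ⟧ S.≈ OS.det n (λ i j → ⟦ M i j ⟧)
  det-homo zero    M = 1-homo
  det-homo (suc n) M = S.trans (sum-homo {suc n} term) (SemiringSum.sum-cong-≋ S.semiring {suc n} {⟦_⟧ ∘ term} {term′} λ j →
    S.trans (*-homo ((R.- R.1#) OR.^ toℕ j) (M Fin.zero j R.* OR.det n (minor j)))
      (S.*-cong (S.trans (^-homo _ (toℕ j)) (Exp.^-congˡ S.semiring (toℕ j) (S.trans (-‿homo _) (S.-‿cong 1-homo))))
        (S.trans (*-homo (M Fin.zero j) (OR.det n (minor j))) (S.*-congˡ (det-homo n (minor j))))))
    where
    minor : Fin (suc n) → Fin n → Fin n → R.Carrier
    minor j i k = M (Fin.suc i) (punchIn j k)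
    term : Fin (suc n) → R.Carrier
    term j = (R.- R.1#) OR.^ toℕ j R.*
      (M Fin.zero j R.* OR.det n (minor j))
    term′ : Fin (suc n) → S.Carrier
    term′ j = (S.- S.1#) OS.^ toℕ j S.*
      (⟦ M Fin.zero j ⟧ S.* OS.det n (λ i k → ⟦ minor j i k ⟧))

id-hom : (R : CommutativeRing c ℓ) → Hom R R
id-hom R = record
  { ⟦_⟧ = id ; ⟦⟧-cong = id ; +-homo = λ _ _ → refl ; *-homo = λ _ _ → refl ; 1-homo = refl }
  where open CommutativeRing R

module _ {R : CommutativeRing c ℓ} {S : CommutativeRing c′ ℓ′} {X : Set x}
         (h : Hom R S) (f : X → CommutativeRing.Carrier S) where

  private
    module R = CommutativeRing R
    module S = CommutativeRing S
    module h = Hom h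

  evaluate : Poly R X → S.Carrier
  evaluate (con r) = h.⟦ r ⟧
  evaluate (var i) = f i
  evaluate (p ⊕ q) = evaluate p S.+ evaluate q
  evaluate (p ⊛ q) = evaluate p S.* evaluate q
  evaluate (⊝ p)   = S.- evaluate p

  evaluate-cong : ∀ {p q} → p ≋ q → evaluate p S.≈ evaluate q
  evaluate-cong ≋-refl             = S.refl
  evaluate-cong (≋-sym e)          = S.sym (evaluate-cong e)
  evaluate-cong (≋-trans e e′)     = S.trans (evaluate-cong e) (evaluate-cong e′)
  evaluate-cong (con-cong e)       = h.⟦⟧-cong e
  evaluate-cong (⊕-cong e e′)      = S.+-cong (evaluate-cong e) (evaluate-cong e′)
  evaluate-cong (⊛-cong e e′)      = S.*-cong (evaluate-cong e) (evaluate-cong e′)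
  evaluate-cong (⊝-cong e)         = S.-‿cong (evaluate-cong e)
  evaluate-cong (⊕-assoc _ _ _)    = S.+-assoc _ _ _
  evaluate-cong (⊕-comm _ _)       = S.+-comm _ _
  evaluate-cong (⊕-identityˡ _)    = S.trans (S.+-congʳ h.0-homo) (S.+-identityˡ _)
  evaluate-cong (⊕-inverseˡ _)     = S.trans (S.-‿inverseˡ _) (S.sym h.0-homo)
  evaluate-cong (⊛-assoc _ _ _)    = S.*-assoc _ _ _
  evaluate-cong (⊛-comm _ _)       = S.*-comm _ _
  evaluate-cong (⊛-identityˡ _)    = S.trans (S.*-congʳ h.1-homo) (S.*-identityˡ _)
  evaluate-cong (⊛-distribˡ _ _ _) = S.distribˡ _ _ _
  evaluate-cong (con-+ r s)        = h.+-homo r s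
  evaluate-cong (con-* r s)        = h.*-homo r s

  evaluateHom : Hom (polyRing R X) S
  evaluateHom = record
    { ⟦_⟧ = evaluate ; ⟦⟧-cong = evaluate-cong
    ; +-homo = λ _ _ → S.refl ; *-homo = λ _ _ → S.refl ; 1-homo = h.1-homo }

module _ {R : CommutativeRing c ℓ} {S : CommutativeRing c′ ℓ′} {X : Set x}
         (g h : Hom (polyRing R X) S) where
  private
    module S = CommutativeRing S
    module g = Hom g
    module h = Hom h

  homs-agree : (∀ r → g.⟦ con r ⟧ S.≈ h.⟦ con r ⟧) → (∀ i → g.⟦ var i ⟧ S.≈ h.⟦ var i ⟧) →
               ∀ p → g.⟦ p ⟧ S.≈ h.⟦ p ⟧
  homs-agree hc hv (con r) = hc r
  homs-agree hc hv (var i) = hv i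
  homs-agree hc hv (p ⊕ q) = S.trans (g.+-homo p q)
    (S.trans (S.+-cong (homs-agree hc hv p) (homs-agree hc hv q)) (S.sym (h.+-homo p q)))
  homs-agree hc hv (p ⊛ q) = S.trans (g.*-homo p q)
    (S.trans (S.*-cong (homs-agree hc hv p) (homs-agree hc hv q)) (S.sym (h.*-homo p q)))
  homs-agree hc hv (⊝ p)   = S.trans (g.-‿homo p)
    (S.trans (S.-‿cong (homs-agree hc hv p)) (S.sym (h.-‿homo p)))

infixr 9 _∘ʰ_
_∘ʰ_ : ∀ {c₁ ℓ₁ c₂ ℓ₂ c₃ ℓ₃} {R : CommutativeRing c₁ ℓ₁} {S : CommutativeRing c₂ ℓ₂}
       {T : CommutativeRing c₃ ℓ₃} → Hom S T → Hom R S → Hom R T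
_∘ʰ_ {T = T} g f = record
  { ⟦_⟧ = λ r → g.⟦ f.⟦ r ⟧ ⟧
  ; ⟦⟧-cong = λ e → g.⟦⟧-cong (f.⟦⟧-cong e)
  ; +-homo = λ r s → T.trans (g.⟦⟧-cong (f.+-homo r s)) (g.+-homo _ _)
  ; *-homo = λ r s → T.trans (g.⟦⟧-cong (f.*-homo r s)) (g.*-homo _ _)
  ; 1-homo = T.trans (g.⟦⟧-cong f.1-homo) g.1-homo }
  where module f = Hom f
        module g = Hom g
        module T = CommutativeRing T

substituteHom : {R : CommutativeRing c ℓ} {X Y : Set} → (X → Poly R Y) →
                Hom (polyRing R X) (polyRing R Y)
substituteHom f = record
  { ⟦_⟧ = substitute f ; ⟦⟧-cong = substitute-cong f
  ; +-homo = λ _ _ → ≋-refl ; *-homo = λ _ _ → ≋-refl ; 1-homo = ≋-refl }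

conHom : (R : CommutativeRing c ℓ) (X : Set x) → Hom R (polyRing R X)
conHom R X = record
  { ⟦_⟧ = con ; ⟦⟧-cong = con-cong ; +-homo = con-+ ; *-homo = con-* ; 1-homo = ≋-refl }

module _ (R : CommutativeRing c ℓ) where
  open CommutativeRing R
  open RingOperations R

  Regular : Carrier → Set (c ⊔ ℓ)
  Regular r = ∀ y → r * y ≈ 0# → y ≈ 0#

  regular-1 : Regular 1#
  regular-1 y e = trans (sym (*-identityˡ y)) e

  regular-* : ∀ {r s} → Regular r → Regular s → Regular (r * s)
  regular-* ρ σ y e = σ y (ρ _ (trans (sym (*-assoc _ _ _)) e))

  regular-≈ : ∀ {r s} → r ≈ s → Regular r → Regular s
  regular-≈ r≈s ρ y e = ρ y (trans (*-congʳ r≈s) e)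

  regular-factor : ∀ {r s} → Regular (r * s) → Regular s
  regular-factor {r} {s} ρ y e = ρ y (trans (*-assoc _ _ _) (trans (*-congˡ e) (zeroʳ r)))

  regular-product : ∀ {n} (t : Fin n → Carrier) → (∀ i → Regular (t i)) → Regular (product t)
  regular-product {zero}  t ρ = regular-1
  regular-product {suc n} t ρ = regular-* (ρ Fin.zero) (regular-product (t ∘ Fin.suc) (ρ ∘ Fin.suc))

  cancel : ∀ {r y z} → Regular r → r * y ≈ r * z → y ≈ z
  cancel {r} {y} {z} ρ e = trans (solve 2 (λ y z → y := (y :- z) :+ z) refl y z)
    (trans (+-congʳ (ρ (y - z) (trans (solve 3 (λ r y z → r :* (y :- z) := r :* y :- r :* z) refl r y z)
      (trans (+-congʳ e) (-‿inverseʳ _))))) (+-identityˡ z))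
    where open IntegerSolver R

-- Every polynomial p satisfies p = Z p + (x − r) D p, where Z sets the
-- indeterminate x to r.  If r does not involve x, then D((x − r) p) = p.
module DividedDifference {R : CommutativeRing c ℓ} {X : Set} (_≟_ : DecidableEquality X)
                         (m : X) (r : Poly R X) where

  private module P = CommutativeRing (polyRing R X)
  open IntegerSolver (polyRing R X)
  open import Relation.Binary.Reasoning.Setoid P.setoid

  value : X → Poly R X
  value i with i ≟ m
  ... | yes _ = r
  ... | no  _ = var i

  Z : Poly R X → Poly R X
  Z = substitute value

  D : Poly R X → Poly R X
  D (con _) = P.0#
  D (var i) with i ≟ m
  ... | yes _ = P.1#
  ... | no  _ = P.0#
  D (p ⊕ q) = D p ⊕ D q
  -- The product rule of a divided difference: pq - Zp Zq = (p - Zp) q + Zp (q - Zq).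
  D (p ⊛ q) = D p ⊛ q ⊕ Z p ⊛ D q
  D (⊝ p)   = ⊝ D p

  private
    u : Poly R X
    u = var m ⊕ ⊝ r

    expand : ∀ p → p ≋ Z p ⊕ u ⊛ D p
    expand (con s) = ≋-sym (≋-trans (P.+-congˡ (P.zeroʳ _)) (P.+-identityʳ _))
    expand (var i) with i ≟ m
    ... | yes ≡.refl = ≋-trans (solve 2 (λ x r → x := r :+ (x :- r)) ≋-refl (var i) r)
                         (P.+-congˡ (P.sym (P.*-identityʳ _)))
    ... | no  _      = ≋-sym (≋-trans (P.+-congˡ (P.zeroʳ _)) (P.+-identityʳ _))
    expand (p ⊕ q) = ≋-trans (⊕-cong (expand p) (expand q))
      (solve 5 (λ a b c d u → (a :+ u :* b) :+ (c :+ u :* d) := (a :+ c) :+ u :* (b :+ d)) ≋-refl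
        (Z p) (D p) (Z q) (D q) u)
    expand (p ⊛ q) = ≋-trans (⊛-cong (expand p) ≋-refl)
      (≋-trans (solve 4 (λ a b q u → (a :+ u :* b) :* q := a :* q :+ u :* (b :* q)) ≋-refl (Z p) (D p) q u)
        (≋-trans (P.+-congʳ (P.*-congˡ (expand q)))
          (solve 6 (λ a b c d q u → a :* (c :+ u :* d) :+ u :* (b :* q) := a :* c :+ u :* (b :* q :+ a :* d)) ≋-refl
            (Z p) (D p) (Z q) (D q) q u)))
    expand (⊝ p) = ≋-trans (⊝-cong (expand p))
      (solve 3 (λ a b u → :- (a :+ u :* b) := :- a :+ u :* (:- b)) ≋-refl (Z p) (D p) u)

    -- The product rule treats the two factors unequally, so commutativity is the one axiom that
    -- needs `expand`: writing the untouched factor as Z + u D makes both sides symmetric.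
    D-cong : ∀ {p q} → p ≋ q → D p ≋ D q
    D-cong ≋-refl = ≋-refl
    D-cong (≋-sym e) = ≋-sym (D-cong e)
    D-cong (≋-trans e e′) = ≋-trans (D-cong e) (D-cong e′)
    D-cong (con-cong _) = ≋-refl
    D-cong (⊕-cong e e′) = ⊕-cong (D-cong e) (D-cong e′)
    D-cong (⊛-cong e e′) = ⊕-cong (⊛-cong (D-cong e) e′) (⊛-cong (substitute-cong value e) (D-cong e′))
    D-cong (⊝-cong e) = ⊝-cong (D-cong e)
    D-cong (⊕-assoc _ _ _) = ⊕-assoc _ _ _
    D-cong (⊕-comm _ _) = ⊕-comm _ _
    D-cong (⊕-identityˡ _) = ⊕-identityˡ _
    D-cong (⊕-inverseˡ _) = ⊕-inverseˡ _
    D-cong (⊛-assoc p q s) =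
      solve 7 (λ q s Zp Zq Dp Dq Ds →
          (Dp :* q :+ Zp :* Dq) :* s :+ (Zp :* Zq) :* Ds := Dp :* (q :* s) :+ Zp :* (Dq :* s :+ Zq :* Ds)) ≋-refl
        q s (Z p) (Z q) (D p) (D q) (D s)
    D-cong (⊛-comm p q) = begin
      D p ⊛ q ⊕ Z p ⊛ D q                  ≈⟨ P.+-congʳ (P.*-congˡ (expand q)) ⟩
      D p ⊛ (Z q ⊕ u ⊛ D q) ⊕ Z p ⊛ D q    ≈⟨ solve 5 (λ Zp Dp Zq Dq u →
                                               Dp :* (Zq :+ u :* Dq) :+ Zp :* Dq := Dq :* (Zp :+ u :* Dp) :+ Zq :* Dp)
                                               ≋-refl (Z p) (D p) (Z q) (D q) u ⟩
      D q ⊛ (Z p ⊕ u ⊛ D p) ⊕ Z q ⊛ D p    ≈⟨ P.+-congʳ (P.*-congˡ (expand p)) ⟨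
      D q ⊛ p ⊕ Z q ⊛ D p                  ∎
    D-cong (⊛-identityˡ p) = ≋-trans (P.+-cong (P.zeroˡ _) (P.*-identityˡ _)) (P.+-identityˡ _)
    D-cong (⊛-distribˡ p q s) =
      solve 6 (λ q s Zp Dp Dq Ds →
          Dp :* (q :+ s) :+ Zp :* (Dq :+ Ds) := (Dp :* q :+ Zp :* Dq) :+ (Dp :* s :+ Zp :* Ds)) ≋-refl
        q s (Z p) (D p) (D q) (D s)
    D-cong (con-+ _ _) = ≋-sym (P.+-identityˡ _)
    D-cong (con-* _ _) = ≋-sym (≋-trans (P.+-cong (P.zeroˡ _) (P.zeroʳ _)) (P.+-identityˡ _))

  -- Read off the expression, hence not invariant under `≋`; the elements it is applied to are
  -- explicit sums of indeterminates.
  Free : Poly R X → Set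
  Free (con _) = ⊤
  Free (var i) = i ≢ m
  Free (p ⊕ q) = Free p × Free q
  Free (p ⊛ q) = Free p × Free q
  Free (⊝ p)   = Free p

  Z-free : ∀ p → Free p → Z p ≋ p
  Z-free (con _) _ = ≋-refl
  Z-free (var i) i≢m with i ≟ m
  ... | yes i≡m = contradiction i≡m i≢m
  ... | no  _   = ≋-refl
  Z-free (p ⊕ q) (f , g) = ⊕-cong (Z-free p f) (Z-free q g)
  Z-free (p ⊛ q) (f , g) = ⊛-cong (Z-free p f) (Z-free q g)
  Z-free (⊝ p)   f       = ⊝-cong (Z-free p f)

  D-free : ∀ p → Free p → D p ≋ P.0#
  D-free (con _) _ = ≋-refl
  D-free (var i) i≢m with i ≟ m
  ... | yes i≡m = contradiction i≡m i≢m
  ... | no  _   = ≋-refl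
  D-free (p ⊕ q) (f , g) = ≋-trans (⊕-cong (D-free p f) (D-free q g)) (P.+-identityˡ _)
  D-free (p ⊛ q) (f , g) = ≋-trans (⊕-cong (P.*-congʳ (D-free p f)) (P.*-congˡ (D-free q g)))
    (≋-trans (P.+-cong (P.zeroˡ _) (P.zeroʳ _)) (P.+-identityˡ _))
  D-free (⊝ p)   f       = ≋-trans (⊝-cong (D-free p f)) (RingProperties.-0#≈0# P.ring)

  private
    D-var : D (var m) ≋ P.1#
    D-var with m ≟ m
    ... | yes _   = ≋-refl
    ... | no  m≢m = contradiction ≡.refl m≢m

    Z-var : Z (var m) ≋ r
    Z-var with m ≟ m
    ... | yes _   = ≋-refl
    ... | no  m≢m = contradiction ≡.refl m≢m

  var-free-regular : Free r → Regular (polyRing R X) u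
  var-free-regular r-free y uy≋0 = begin
    y                      ≈⟨ ≋-trans (P.+-identityʳ _) (P.*-identityˡ y) ⟨
    P.1# ⊛ y ⊕ P.0#        ≈⟨ P.+-cong (P.*-congʳ Du≋1) (≋-trans (P.*-congʳ Zu≋0) (P.zeroˡ _)) ⟨
    D u ⊛ y ⊕ Z u ⊛ D y    ≈⟨ D-cong uy≋0 ⟩
    P.0#                   ∎
    where
    Du≋1 : D u ≋ P.1#
    Du≋1 = ≋-trans (⊕-cong D-var (≋-trans (⊝-cong (D-free r r-free)) (RingProperties.-0#≈0# P.ring))) (P.+-identityʳ _)
    Zu≋0 : Z u ≋ P.0#
    Zu≋0 = ≋-trans (⊕-cong Z-var (⊝-cong (Z-free r r-free))) (P.-‿inverseʳ r)

-- Determinants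

-- For the Laplace expansion of a matrix whose columns `inject₁ k` and `suc k` are equal: a minor
-- either loses one of them or still has both, side by side.
punchIn-adjacent : ∀ {n} (j : Fin (suc (suc n))) (k : Fin (suc n)) →
  j ≡ inject₁ k ⊎ j ≡ Fin.suc k ⊎
  (∃[ k′ ] punchIn j (inject₁ k′) ≡ inject₁ k × punchIn j (Fin.suc k′) ≡ Fin.suc k)
punchIn-adjacent Fin.zero Fin.zero = inj₁ ≡.refl
punchIn-adjacent Fin.zero (Fin.suc k) = inj₂ (inj₂ (k , ≡.refl , ≡.refl))
punchIn-adjacent (Fin.suc Fin.zero) Fin.zero = inj₂ (inj₁ ≡.refl)
punchIn-adjacent {suc n} (Fin.suc (Fin.suc j)) Fin.zero = inj₂ (inj₂ (Fin.zero , ≡.refl , ≡.refl))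
punchIn-adjacent {suc n} (Fin.suc j) (Fin.suc k) with punchIn-adjacent j k
... | inj₁ e = inj₁ (≡.cong Fin.suc e)
... | inj₂ (inj₁ e) = inj₂ (inj₁ (≡.cong Fin.suc e))
... | inj₂ (inj₂ (k′ , e , e′)) = inj₂ (inj₂ (Fin.suc k′ , ≡.cong Fin.suc e , ≡.cong Fin.suc e′))

-- The minors obtained by deleting one of two adjacent columns differ only in which of the two
-- survives, and it survives at the same place.
punchIn-inject₁-suc : ∀ {n} (k : Fin n) c →
  punchIn (inject₁ k) c ≡ punchIn (Fin.suc k) c ⊎
  (punchIn (inject₁ k) c ≡ Fin.suc k × punchIn (Fin.suc k) c ≡ inject₁ k)
punchIn-inject₁-suc Fin.zero Fin.zero = inj₂ (≡.refl , ≡.refl)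
punchIn-inject₁-suc Fin.zero (Fin.suc c) = inj₁ ≡.refl
punchIn-inject₁-suc (Fin.suc k) Fin.zero = inj₁ ≡.refl
punchIn-inject₁-suc (Fin.suc k) (Fin.suc c) with punchIn-inject₁-suc k c
... | inj₁ e = inj₁ (≡.cong Fin.suc e)
... | inj₂ (e , e′) = inj₂ (≡.cong Fin.suc e , ≡.cong Fin.suc e′)

toℕ-punchIn-≤ : ∀ {n} (j : Fin (suc n)) c → toℕ (punchIn j c) ≤ suc (toℕ c)
toℕ-punchIn-≤ Fin.zero c = ℕ.≤-refl
toℕ-punchIn-≤ (Fin.suc j) Fin.zero = z≤n
toℕ-punchIn-≤ (Fin.suc j) (Fin.suc c) = s≤s (toℕ-punchIn-≤ j c)

toℕ-punchIn-< : ∀ {n} (j : Fin (suc n)) c → toℕ c < toℕ j → toℕ (punchIn j c) ≡ toℕ c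
toℕ-punchIn-< (Fin.suc j) Fin.zero    _       = ≡.refl
toℕ-punchIn-< (Fin.suc j) (Fin.suc c) (s≤s l) = ≡.cong suc (toℕ-punchIn-< j c l)

module Determinant {c ℓ} (R : CommutativeRing c ℓ) where
  open CommutativeRing R hiding (zero)
  open RingOperations R
  open SemiringSum semiring
    using (sum-cong-≋; ∑-distrib-+; ∑-comm; *-distribˡ-sum; *-distribʳ-sum; sum-remove; sum-init-last)
  module Π = SumProperties *-commutativeMonoid
  open IntegerSolver R
  open import Relation.Binary.Reasoning.Setoid setoid

  Matrix : ℕ → Set c
  Matrix n = Fin n → Fin n → Carrier

  minor : ∀ {n} → Matrix (suc n) → Fin (suc n) → Matrix n
  minor M j i k = M (Fin.suc i) (punchIn j k)

  sum-zero : ∀ {n} (t : Fin n → Carrier) → (∀ i → t i ≈ 0#) → sum t ≈ 0#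
  sum-zero {zero}  t e = refl
  sum-zero {suc n} t e = trans (+-cong (e Fin.zero) (sum-zero (t ∘ Fin.suc) (e ∘ Fin.suc))) (+-identityˡ _)

  ∑-cong : ∀ {n} (t u : Fin n → Carrier) → (∀ i → t i ≈ u i) → sum t ≈ sum u
  ∑-cong t u = sum-cong-≋ {x = t} {y = u}

  det-cong : ∀ n {M N : Matrix n} → (∀ i j → M i j ≈ N i j) → det n M ≈ det n N
  det-cong zero    e = refl
  det-cong (suc n) {M} {N} e = ∑-cong (term M) (term N) λ j →
    *-congˡ {(- 1#) ^ toℕ j} (*-cong (e Fin.zero j) (det-cong n λ i k → e (Fin.suc i) (punchIn j k)))
    where
    term : Matrix (suc n) → Fin (suc n) → Carrier
    term N j = (- 1#) ^ toℕ j * (N Fin.zero j * det n (minor N j))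

  -- In the expansion along the first row, the term of column k has a minor free of that column, and
  -- every other minor contains it at position `punchOut`. The shape A + s B serves the column
  -- operations and `pieri` alike.
  det-linear : ∀ n {M A B : Matrix n} s k →
    (∀ i → M i k ≈ A i k + s * B i k) →
    (∀ i j → j ≢ k → M i j ≈ A i j) → (∀ i j → j ≢ k → M i j ≈ B i j) →
    det n M ≈ det n A + s * det n B
  det-linear (suc n) {M} {A} {B} s k Mk MA MB = begin
    sum (term M)                              ≈⟨ ∑-cong (term M) _ terms ⟩
    sum (λ j → term A j + s * term B j)       ≈⟨ ∑-distrib-+ (term A) (λ j → s * term B j) ⟩
    sum (term A) + sum (λ j → s * term B j)   ≈⟨ +-congˡ (*-distribˡ-sum s (term B)) ⟨
    sum (term A) + s * sum (term B)           ∎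
    where
    term : Matrix (suc n) → Fin (suc n) → Carrier
    term N j = (- 1#) ^ toℕ j * (N Fin.zero j * det n (minor N j))
    terms : ∀ j → term M j ≈ term A j + s * term B j
    terms j with j Fin.≟ k
    ... | yes ≡.refl = begin
      term M j
        ≈⟨ *-congˡ (*-congʳ (Mk Fin.zero)) ⟩
      σ * ((A Fin.zero j + s * B Fin.zero j) * det n (minor M j))
        ≈⟨ solve 5 (λ σ a s b d → σ :* ((a :+ s :* b) :* d) := σ :* (a :* d) :+ s :* (σ :* (b :* d))) refl
             σ _ s _ _ ⟩
      σ * (A Fin.zero j * det n (minor M j)) + s * (σ * (B Fin.zero j * det n (minor M j)))
        ≈⟨ +-cong (*-congˡ (*-congˡ (det-cong n λ i l → MA _ _ (Fin.punchInᵢ≢i j l))))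
                  (*-congˡ (*-congˡ (*-congˡ (det-cong n λ i l → MB _ _ (Fin.punchInᵢ≢i j l))))) ⟩
      term A j + s * term B j ∎
      where σ = (- 1#) ^ toℕ j
    ... | no j≢k = begin
      term M j
        ≈⟨ *-congˡ (*-congˡ (det-linear n s k′ (λ i → at-k i) (λ i l l≢k′ → MA _ _ (off l l≢k′)) (λ i l l≢k′ → MB _ _ (off l l≢k′)))) ⟩
      σ * (M Fin.zero j * (det n (minor A j) + s * det n (minor B j)))
        ≈⟨ solve 5 (λ σ m a s b → σ :* (m :* (a :+ s :* b)) := σ :* (m :* a) :+ s :* (σ :* (m :* b))) refl
             σ _ _ s _ ⟩
      σ * (M Fin.zero j * det n (minor A j)) + s * (σ * (M Fin.zero j * det n (minor B j)))
        ≈⟨ +-cong (*-congˡ (*-congʳ (MA _ _ j≢k))) (*-congˡ (*-congˡ (*-congʳ (MB _ _ j≢k)))) ⟩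
      term A j + s * term B j ∎
      where
      σ = (- 1#) ^ toℕ j
      k′ = punchOut j≢k
      in-k : punchIn j k′ ≡ k
      in-k = Fin.punchIn-punchOut j≢k
      at-k : ∀ i → minor M j i k′ ≈ minor A j i k′ + s * minor B j i k′
      at-k i rewrite in-k = Mk (Fin.suc i)
      off : ∀ l → l ≢ k′ → punchIn j l ≢ k
      off l l≢k′ e = l≢k′ (Fin.punchIn-injective j l k′ (≡.trans e (≡.sym in-k)))

  private
    sum-adjacent : ∀ {n} (t : Fin (suc (suc n)) → Carrier) k → t (inject₁ k) + t (Fin.suc k) ≈ 0# →
      (∀ j → j ≢ inject₁ k → j ≢ Fin.suc k → t j ≈ 0#) → sum t ≈ 0#
    sum-adjacent t Fin.zero e z = trans (sym (+-assoc _ _ _)) (trans (+-cong e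
      (sum-zero _ λ j → z (Fin.suc (Fin.suc j)) (λ ()) (λ ()))) (+-identityˡ _))
    sum-adjacent {suc n} t (Fin.suc k) e z = trans (+-cong (z Fin.zero (λ ()) (λ ()))
      (sum-adjacent (t ∘ Fin.suc) k e λ j j≢ j≢′ → z (Fin.suc j) (j≢ ∘ Fin.suc-injective) (j≢′ ∘ Fin.suc-injective)))
      (+-identityˡ _)

  -- The two terms at the equal columns have equal minors and opposite signs; every other minor
  -- inherits two equal adjacent columns.
  det-adjacent : ∀ n (M : Matrix (suc n)) (k : Fin n) → (∀ i → M i (inject₁ k) ≈ M i (Fin.suc k)) →
    det (suc n) M ≈ 0#
  det-adjacent (suc n) M k e = sum-adjacent term k pair others
    where
    term : Fin (suc (suc n)) → Carrier
    term j = (- 1#) ^ toℕ j * (M Fin.zero j * det (suc n) (minor M j))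
    minors : det (suc n) (minor M (Fin.suc k)) ≈ det (suc n) (minor M (inject₁ k))
    minors = det-cong (suc n) columns
      where
      columns : ∀ i l → minor M (Fin.suc k) i l ≈ minor M (inject₁ k) i l
      columns i l with punchIn-inject₁-suc k l
      ... | inj₁ eq rewrite eq = refl
      ... | inj₂ (eq , eq′) rewrite eq | eq′ = e (Fin.suc i)
    pair : term (inject₁ k) + term (Fin.suc k) ≈ 0#
    pair = begin
      term (inject₁ k) + term (Fin.suc k)
        ≈⟨ +-congˡ (*-congˡ (*-cong (sym (e Fin.zero)) minors)) ⟩
      term (inject₁ k) + (- 1# * (- 1#) ^ toℕ k) * y
        ≡⟨ ≡.cong (λ l → (- 1#) ^ l * y + (- 1# * (- 1#) ^ toℕ k) * y) (toℕ-inject₁ k) ⟩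
      (- 1#) ^ toℕ k * y + (- 1# * (- 1#) ^ toℕ k) * y
        ≈⟨ solve 3 (λ o s y → s :* y :+ (:- o :* s) :* y := (s :* y) :- o :* (s :* y)) refl 1# _ y ⟩
      (- 1#) ^ toℕ k * y - 1# * ((- 1#) ^ toℕ k * y)
        ≈⟨ +-congˡ (-‿cong (*-identityˡ _)) ⟩
      (- 1#) ^ toℕ k * y - (- 1#) ^ toℕ k * y
        ≈⟨ -‿inverseʳ _ ⟩
      0# ∎
      where y = M Fin.zero (inject₁ k) * det (suc n) (minor M (inject₁ k))
    others : ∀ j → j ≢ inject₁ k → j ≢ Fin.suc k → term j ≈ 0#
    others j j≢ j≢′ with punchIn-adjacent j k
    ... | inj₁ j≡ = contradiction j≡ j≢
    ... | inj₂ (inj₁ j≡) = contradiction j≡ j≢′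
    others j _ _ | inj₂ (inj₂ (k′ , eq , eq′)) =
      trans (*-congˡ (trans (*-congˡ (det-adjacent n (minor M j) k′ columns)) (zeroʳ _))) (zeroʳ _)
      where
      columns : ∀ i → minor M j i (inject₁ k′) ≈ minor M j i (Fin.suc k′)
      columns i rewrite eq | eq′ = e (Fin.suc i)

  -- The zero block has n - p rows and q > p columns, so every permutation meets it. Deleting the
  -- first row and any column leaves a block for p - 1 and q - 1; once p is 0, the first row is zero
  -- in the first q columns, and deleting a later column keeps these.
  det-zeroBlock : ∀ n (M : Matrix n) p q → p < q → q ≤ n →
    (∀ i j → p ≤ toℕ i → toℕ j < q → M i j ≈ 0#) → det n M ≈ 0#
  det-zeroBlock zero    M p       zero    () _ z
  det-zeroBlock (suc n) M zero    q       0<q _ z = sum-zero (λ j → (- 1#) ^ toℕ j * (M Fin.zero j * det n (minor M j)))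
    λ j → trans (*-congˡ {(- 1#) ^ toℕ j} (cofactor j)) (zeroʳ _)
    where
    cofactor : ∀ j → M Fin.zero j * det n (minor M j) ≈ 0#
    cofactor j with toℕ j ℕ.<? q
    ... | yes j<q = trans (*-congʳ (z Fin.zero j z≤n j<q)) (zeroˡ _)
    ... | no  j≮q = trans (*-congˡ (det-zeroBlock n (minor M j) zero q 0<q
            (ℕ.≤-trans q≤j (ℕ.≤-pred (Fin.toℕ<n j))) λ i l _ l<q →
            z (Fin.suc i) _ z≤n (≡.subst (_< q) (≡.sym (toℕ-punchIn-< j l (ℕ.<-≤-trans l<q q≤j))) l<q))) (zeroʳ _)
      where
      q≤j : q ≤ toℕ j
      q≤j = ℕ.≮⇒≥ j≮q
  det-zeroBlock (suc n) M (suc p) (suc q) (s≤s p<q) (s≤s q≤n) z = sum-zero (λ j → (- 1#) ^ toℕ j * (M Fin.zero j * det n (minor M j))) λ j →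
    trans (*-congˡ {(- 1#) ^ toℕ j} (trans (*-congˡ {M Fin.zero j} (det-zeroBlock n (minor M j) p q p<q q≤n λ i l p≤i l<q →
      z (Fin.suc i) _ (s≤s p≤i) (s≤s (ℕ.≤-trans (toℕ-punchIn-≤ j l) l<q)))) (zeroʳ _))) (zeroʳ _)

  det-scaleRows : ∀ n (r : Fin n → Carrier) (M : Matrix n) →
    det n (λ i j → r i * M i j) ≈ product r * det n M
  det-scaleRows zero    r M = sym (*-identityˡ _)
  det-scaleRows (suc n) r M = begin
    sum (λ j → (- 1#) ^ toℕ j * ((r Fin.zero * M Fin.zero j) * det n (λ i l → r (Fin.suc i) * minor M j i l)))
      ≈⟨ ∑-cong {suc n} _ scaled (λ j → trans (*-congˡ (*-congˡ (det-scaleRows n (r ∘ Fin.suc) (minor M j))))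
           (solve 5 (λ σ r m p d → σ :* ((r :* m) :* (p :* d)) := (r :* p) :* (σ :* (m :* d))) refl
             ((- 1#) ^ toℕ j) (r Fin.zero) (M Fin.zero j) (product (r ∘ Fin.suc)) (det n (minor M j)))) ⟩
    sum scaled
      ≈⟨ *-distribˡ-sum (product r) (λ j → (- 1#) ^ toℕ j * (M Fin.zero j * det n (minor M j))) ⟨
    product r * det (suc n) M ∎
    where
    scaled : Fin (suc n) → Carrier
    scaled j = product r * ((- 1#) ^ toℕ j * (M Fin.zero j * det n (minor M j)))

  setColumn : ∀ {n} → Fin n → (Fin n → Carrier) → Matrix n → Matrix n
  setColumn j f M i k = if does (k Fin.≟ j) then f i else M i k

  setColumn-≡ : ∀ {n} j f (M : Matrix n) i → setColumn j f M i j ≡ f i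
  setColumn-≡ j f M i rewrite dec-true (j Fin.≟ j) ≡.refl = ≡.refl

  setColumn-≢ : ∀ {n} j f (M : Matrix n) i {k} → k ≢ j → setColumn j f M i k ≡ M i k
  setColumn-≢ j f M i {k} k≢j rewrite dec-false (k Fin.≟ j) k≢j = ≡.refl

  -- In the term of a permutation, scaling column j contributes xᵢ for the row i that meets this
  -- column, and over all j each xᵢ occurs once. In the expansion along the first row, j = l
  -- accounts for the first x, and the other j for the remaining ones by induction on the minor.
  det-scaleColumns : ∀ n (x : Fin n → Carrier) (M : Matrix n) →
    sum x * det n M ≈ sum (λ j → det n (setColumn j (λ i → x i * M i j) M))
  det-scaleColumns zero    x M = zeroˡ _
  det-scaleColumns (suc n) x M = sym (begin
    sum (λ j → sum (term j))
      ≈⟨ ∑-comm term ⟩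
    sum (λ l → sum (λ j → term j l))
      ≈⟨ ∑-cong _ step₁ (λ l → trans (sum-remove {i = l} (λ j → term j l))
           (+-cong (diagonal l) (trans (sum-cong-≋ (off-diagonal l)) (sym (*-distribˡ-sum (cofactor l) (scaled l)))))) ⟩
    sum step₁
      ≈⟨ ∑-cong step₁ step₂ (λ l → +-congˡ (*-congˡ {cofactor l} (sym (det-scaleColumns n (x ∘ Fin.suc) (minor M l))))) ⟩
    sum step₂
      ≈⟨ ∑-cong step₂ step₃ (λ l → solve 5 (λ s x m d y → s :* (x :* m :* d) :+ (s :* m) :* (y :* d) := (x :+ y) :* (s :* (m :* d))) refl
           (σ l) x₀ (M Fin.zero l) (det n (minor M l)) (sum (x ∘ Fin.suc))) ⟩
    sum step₃
      ≈⟨ *-distribˡ-sum (sum x) (λ l → σ l * (M Fin.zero l * det n (minor M l))) ⟨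
    sum x * det (suc n) M ∎)
    where
    x₀ = x Fin.zero
    σ : Fin (suc n) → Carrier
    σ l = (- 1#) ^ toℕ l
    cofactor : Fin (suc n) → Carrier
    cofactor l = σ l * M Fin.zero l
    N : Fin (suc n) → Matrix (suc n)
    N j = setColumn j (λ i → x i * M i j) M
    term : Fin (suc n) → Fin (suc n) → Carrier
    term j l = σ l * (N j Fin.zero l * det n (minor (N j) l))
    scaled : Fin (suc n) → Fin n → Carrier
    scaled l j = det n (setColumn j (λ i → x (Fin.suc i) * minor M l i j) (minor M l))
    step₁ step₂ step₃ : Fin (suc n) → Carrier
    step₁ l = σ l * (x₀ * M Fin.zero l * det n (minor M l)) + cofactor l * sum (scaled l)
    step₂ l = σ l * (x₀ * M Fin.zero l * det n (minor M l)) + cofactor l * (sum (x ∘ Fin.suc) * det n (minor M l))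
    step₃ l = sum x * (σ l * (M Fin.zero l * det n (minor M l)))
    column : Fin (suc n) → Fin (suc n) → Carrier
    column j i = x i * M i j
    diagonal : ∀ l → term l l ≈ σ l * (x₀ * M Fin.zero l * det n (minor M l))
    diagonal l = *-congˡ (*-cong (reflexive (setColumn-≡ l (column l) M Fin.zero))
      (det-cong n λ i k → reflexive (setColumn-≢ l (column l) M (Fin.suc i) (Fin.punchInᵢ≢i l k))))
    off-diagonal : ∀ l j → term (punchIn l j) l ≈ cofactor l * scaled l j
    off-diagonal l j = trans (*-congˡ (*-cong
        (reflexive (setColumn-≢ (punchIn l j) (column (punchIn l j)) M Fin.zero (Fin.punchInᵢ≢i l j ∘ ≡.sym)))
        (det-cong n columns)))
      (sym (*-assoc _ _ _))
      where
      columns : ∀ i k → minor (N (punchIn l j)) l i k ≈ setColumn j (λ i → x (Fin.suc i) * minor M l i j) (minor M l) i k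
      columns i k with k Fin.≟ j
      ... | yes ≡.refl = reflexive (setColumn-≡ (punchIn l k) (column (punchIn l k)) M (Fin.suc i))
      ... | no  k≢j = reflexive (setColumn-≢ (punchIn l j) (column (punchIn l j)) M (Fin.suc i) (k≢j ∘ Fin.punchIn-injective l k j))

  private
    module _ {n} (M N : Matrix (suc n)) where
      hybrid : ℕ → Matrix (suc n)
      hybrid k i j = if does (toℕ j ℕ.<? k) then N i j else M i j

      hybrid-< : ∀ {k} i j → toℕ j < k → hybrid k i j ≡ N i j
      hybrid-< {k} i j l rewrite dec-true (toℕ j ℕ.<? k) l = ≡.refl

      hybrid-≮ : ∀ {k} i j → ¬ toℕ j < k → hybrid k i j ≡ M i j
      hybrid-≮ {k} i j l rewrite dec-false (toℕ j ℕ.<? k) l = ≡.refl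

  -- Columns are replaced from left to right, so column `suc k` is still that of M when column k is
  -- treated. The correction term then has two equal adjacent columns.
  det-columnOperations : ∀ n (M N : Matrix (suc n)) (s : Fin n → Carrier) →
    (∀ i j → M i (inject₁ j) ≈ N i (inject₁ j) + s j * M i (Fin.suc j)) →
    (∀ i → M i (fromℕ n) ≈ N i (fromℕ n)) →
    det (suc n) M ≈ det (suc n) N
  det-columnOperations n M N s e e-last = trans (steps n ℕ.≤-refl) (det-cong (suc n) final)
    where
    step : ∀ k → det (suc n) (hybrid M N (toℕ k)) ≈ det (suc n) (hybrid M N (suc (toℕ k)))
    step k = begin
      det (suc n) (hybrid M N (toℕ k))
        ≈⟨ det-linear (suc n) {B = B} (s k) (inject₁ k) at-k off-k off-B ⟩
      det (suc n) (hybrid M N (suc (toℕ k))) + s k * det (suc n) B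
        ≈⟨ +-congˡ (trans (*-congˡ (det-adjacent n B k adjacent)) (zeroʳ _)) ⟩
      det (suc n) (hybrid M N (suc (toℕ k))) + 0#
        ≈⟨ +-identityʳ _ ⟩
      det (suc n) (hybrid M N (suc (toℕ k))) ∎
      where
      next : Fin (suc n) → Carrier
      next i = M i (Fin.suc k)
      B : Matrix (suc n)
      B = setColumn (inject₁ k) next (hybrid M N (toℕ k))
      suc≢inject₁ : Fin.suc k ≢ inject₁ k
      suc≢inject₁ eq = ℕ.1+n≢n (≡.trans (≡.cong toℕ eq) (toℕ-inject₁ k))
      adjacent : ∀ i → B i (inject₁ k) ≈ B i (Fin.suc k)
      adjacent i = reflexive (≡.trans (setColumn-≡ (inject₁ k) next (hybrid M N (toℕ k)) i) (≡.sym (≡.trans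
        (setColumn-≢ (inject₁ k) next (hybrid M N (toℕ k)) i suc≢inject₁)
        (hybrid-≮ M N i (Fin.suc k) (ℕ.<-asym (ℕ.n<1+n _))))))
      at-k : ∀ i → hybrid M N (toℕ k) i (inject₁ k) ≈ hybrid M N (suc (toℕ k)) i (inject₁ k) + s k * B i (inject₁ k)
      at-k i = trans (reflexive (hybrid-≮ M N i (inject₁ k) (ℕ.<-irrefl (toℕ-inject₁ k))))
        (trans (e i k) (+-cong
          (reflexive (≡.sym (hybrid-< M N i (inject₁ k) (s≤s (ℕ.≤-reflexive (toℕ-inject₁ k))))))
          (*-congˡ (reflexive (≡.sym (setColumn-≡ (inject₁ k) next (hybrid M N (toℕ k)) i))))))
      off-k : ∀ i j → j ≢ inject₁ k → hybrid M N (toℕ k) i j ≈ hybrid M N (suc (toℕ k)) i j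
      off-k i j j≢ with toℕ j ℕ.<? toℕ k
      ... | yes j<k = reflexive (≡.trans (hybrid-< M N i j j<k) (≡.sym (hybrid-< M N i j (ℕ.m<n⇒m<1+n j<k))))
      ... | no  j≮k = reflexive (≡.trans (hybrid-≮ M N i j j≮k) (≡.sym (hybrid-≮ M N i j λ j<1+k → j≢ (Fin.toℕ-injective
              (≡.trans (ℕ.≤-antisym (ℕ.≤-pred j<1+k) (ℕ.≮⇒≥ j≮k)) (≡.sym (toℕ-inject₁ k)))))))
      off-B : ∀ i j → j ≢ inject₁ k → hybrid M N (toℕ k) i j ≈ B i j
      off-B i j j≢ = reflexive (≡.sym (setColumn-≢ (inject₁ k) next (hybrid M N (toℕ k)) i j≢))
    steps : ∀ k → k ≤ n → det (suc n) M ≈ det (suc n) (hybrid M N k)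
    steps zero    _   = refl
    steps (suc k) k<n = trans (steps k (ℕ.<⇒≤ k<n))
      (≡.subst (λ l → det (suc n) (hybrid M N l) ≈ det (suc n) (hybrid M N (suc l)))
        (Fin.toℕ-fromℕ< k<n) (step (Fin.fromℕ< k<n)))
    final : ∀ i j → hybrid M N n i j ≈ N i j
    final i j with toℕ j ℕ.<? n
    ... | yes j<n = reflexive (hybrid-< M N i j j<n)
    ... | no  j≮n = trans (reflexive (≡.trans (hybrid-≮ M N i j j≮n) (≡.cong (M i) j≡))) (trans (e-last i) (reflexive (≡.cong (N i) (≡.sym j≡))))
      where
      j≡ : j ≡ fromℕ n
      j≡ = Fin.toℕ-injective (≡.trans (ℕ.≤-antisym (ℕ.≤-pred (Fin.toℕ<n j)) (ℕ.≮⇒≥ j≮n)) (≡.sym (toℕ-fromℕ n)))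

  -- For b m = a (n ⊖ m), `power r x` is (x‖a)ʳ at level n. An arbitrary b keeps the determinant
  -- identities apart from the bookkeeping of indices.
  module Factorial (b : ℕ → Carrier) where

    power : ℕ → Carrier → Carrier
    power r x = product λ (m : Fin r) → x - b (toℕ m)

    power-suc : ∀ r x → power (suc r) x ≈ power r x * (x - b r)
    power-suc r x = trans (Π.sum-init-last {r} (λ m → x - b (toℕ m))) (*-cong
      (Π.sum-cong-≋ {r} λ m → reflexive (≡.cong (λ l → x - b l) (toℕ-inject₁ m)))
      (reflexive (≡.cong (λ l → x - b l) (toℕ-fromℕ r))))

    bump : ∀ {n} → (Fin n → ℕ) → Fin n → Fin n → ℕ
    bump β j k = if does (k Fin.≟ j) then suc (β k) else β k

    powers : ∀ {n} → (Fin n → Carrier) → (Fin n → ℕ) → Matrix n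
    powers x β i j = power (β j) (x i)

    -- Since x times a power of exponent r is the power of exponent r + 1 plus b r times the power,
    -- scaling column j by the xᵢ raises its exponent up to a multiple of the same determinant.
    -- Summing over j with `det-scaleColumns` collects these multiples on the left.
    pieri : ∀ n (x : Fin n → Carrier) β →
      (sum x - sum (b ∘ β)) * det n (powers x β) ≈ sum λ j → det n (powers x (bump β j))
    pieri n x β = begin
      (sum x - sum (b ∘ β)) * A
        ≈⟨ solve 3 (λ x b A → (x :- b) :* A := x :* A :- b :* A) refl (sum x) _ A ⟩
      sum x * A - sum (b ∘ β) * A
        ≈⟨ +-congʳ (trans (det-scaleColumns n x (powers x β)) (sum-cong-≋ column)) ⟩
      sum (λ j → det n (powers x (bump β j)) + b (β j) * A) - sum (b ∘ β) * A
        ≈⟨ +-congʳ (trans (∑-distrib-+ (λ j → det n (powers x (bump β j))) _) (+-congˡ (sym (*-distribʳ-sum A (b ∘ β))))) ⟩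
      (sum (λ j → det n (powers x (bump β j))) + sum (b ∘ β) * A) - sum (b ∘ β) * A
        ≈⟨ solve 2 (λ s t → (s :+ t) :- t := s) refl _ _ ⟩
      sum (λ j → det n (powers x (bump β j))) ∎
      where
      A = det n (powers x β)
      column : ∀ j → det n (setColumn j (λ i → x i * powers x β i j) (powers x β)) ≈
               det n (powers x (bump β j)) + b (β j) * A
      column j = det-linear n (b (β j)) j at-j off (λ i k k≢j → reflexive (setColumn-≢ j xⱼ (powers x β) i k≢j))
        where
        xⱼ : Fin n → Carrier
        xⱼ i = x i * powers x β i j
        at-j : ∀ i → setColumn j (λ i → x i * powers x β i j) (powers x β) i j ≈
               powers x (bump β j) i j + b (β j) * powers x β i j
        at-j i rewrite dec-true (j Fin.≟ j) ≡.refl =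
          trans (solve 3 (λ x p b → x :* p := p :* (x :- b) :+ b :* p) refl (x i) _ (b (β j)))
            (+-congʳ (sym (power-suc (β j) (x i))))
        off : ∀ i k → k ≢ j → setColumn j (λ i → x i * powers x β i j) (powers x β) i k ≈ powers x (bump β j) i k
        off i k k≢j rewrite dec-false (k Fin.≟ j) k≢j = refl

    -- Subtracting (x₀ - b r) times the next column turns the power of exponent r + 1 into (x - x₀)
    -- times the power of exponent r. The first row then vanishes except for its last entry, and the
    -- minor there is, up to the row factors xᵢ - x₀, the same determinant for the remaining points.
    vandermonde-det : ∀ n (x : Fin n → Carrier) →
      det n (powers x (λ j → n ∸ suc (toℕ j))) ≈
      product λ i → product λ j → if does (i Fin.<? j) then x i - x j else 1#
    vandermonde-det zero    x = refl
    vandermonde-det (suc n) x = begin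
      det (suc n) M
        ≈⟨ det-columnOperations n M N (λ j → x₀ - b (n ∸ suc (toℕ j))) operation (λ i → reflexive (last-column i)) ⟩
      sum term
        ≈⟨ sum-init-last term ⟩
      sum (term ∘ inject₁) + term (fromℕ n)
        ≈⟨ +-cong (sum-zero _ init-term) last-term ⟩
      0# + product (λ i → x₀ - x (Fin.suc i)) * det n (powers (x ∘ Fin.suc) (λ j → n ∸ suc (toℕ j)))
        ≈⟨ +-identityˡ _ ⟩
      product (λ i → x₀ - x (Fin.suc i)) * det n (powers (x ∘ Fin.suc) (λ j → n ∸ suc (toℕ j)))
        -- Each row of the target product begins with a factor 1, for j = 0.
        ≈⟨ *-cong (sym (*-identityˡ _)) (trans (vandermonde-det n (x ∘ Fin.suc))
             (Π.sum-cong-≋ {n} λ i → sym (*-identityˡ _))) ⟩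
      (product λ i → product λ j → if does (i Fin.<? j) then x i - x j else 1#) ∎
      where
      x₀ = x Fin.zero
      M N : Matrix (suc n)
      M = powers x (λ j → suc n ∸ suc (toℕ j))
      N i j = if does (toℕ j ℕ.<? n) then (x i - x₀) * power (n ∸ suc (toℕ j)) (x i) else 1#
      term : Fin (suc n) → Carrier
      term j = (- 1#) ^ toℕ j * (N Fin.zero j * det n (minor N j))
      N-< : ∀ i {j} → toℕ j < n → N i j ≡ (x i - x₀) * power (n ∸ suc (toℕ j)) (x i)
      N-< i {j} l rewrite dec-true (toℕ j ℕ.<? n) l = ≡.refl
      N-last : ∀ i → N i (fromℕ n) ≡ 1#
      N-last i rewrite dec-false (toℕ (fromℕ n) ℕ.<? n) (ℕ.<-irrefl (toℕ-fromℕ n)) = ≡.refl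
      last-column : ∀ i → M i (fromℕ n) ≡ N i (fromℕ n)
      last-column i = ≡.trans
        (≡.cong (λ l → power l (x i)) (≡.trans (≡.cong (n ∸_) (toℕ-fromℕ n)) (ℕ.n∸n≡0 n)))
        (≡.sym (N-last i))
      inject₁-< : ∀ (j : Fin n) → toℕ (inject₁ j) < n
      inject₁-< j = ≡.subst (_< n) (≡.sym (toℕ-inject₁ j)) (Fin.toℕ<n j)
      operation : ∀ i j → M i (inject₁ j) ≈ N i (inject₁ j) + (x₀ - b (n ∸ suc (toℕ j))) * M i (Fin.suc j)
      operation i j = begin
        power (n ∸ toℕ (inject₁ j)) (x i)
          ≡⟨ ≡.cong (λ l → power l (x i)) (≡.trans (≡.cong (n ∸_) (toℕ-inject₁ j)) (ℕ.+-∸-assoc 1 (Fin.toℕ<n j))) ⟩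
        power (suc r) (x i)
          ≈⟨ power-suc r (x i) ⟩
        power r (x i) * (x i - b r)
          ≈⟨ solve 4 (λ p x b y → p :* (x :- b) := (x :- y) :* p :+ (y :- b) :* p) refl (power r (x i)) (x i) (b r) x₀ ⟩
        (x i - x₀) * power r (x i) + (x₀ - b r) * power r (x i)
          ≡⟨ ≡.cong (_+ (x₀ - b r) * power r (x i)) (≡.trans
               (≡.cong (λ l → (x i - x₀) * power (n ∸ suc l) (x i)) (≡.sym (toℕ-inject₁ j)))
               (≡.sym (N-< i (inject₁-< j)))) ⟩
        N i (inject₁ j) + (x₀ - b r) * power r (x i) ∎
        where r = n ∸ suc (toℕ j)
      init-term : ∀ j → term (inject₁ j) ≈ 0#
      init-term j = trans (*-congˡ (trans (*-congʳ (trans (reflexive (N-< Fin.zero (inject₁-< j)))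
        (trans (*-congʳ (-‿inverseʳ x₀)) (zeroˡ _)))) (zeroˡ _))) (zeroʳ _)
      -- The sign of the last cofactor turns the n row factors xᵢ - x₀ into x₀ - xᵢ.
      signs : ∀ m (y : Fin m → Carrier) → (- 1#) ^ m * product (λ i → y i - x₀) ≈ product (λ i → x₀ - y i)
      signs zero    y = *-identityˡ _
      signs (suc m) y = trans
        (solve 5 (λ o s y x p → (:- o :* s) :* ((y :- x) :* p) := (o :* (x :- y)) :* (s :* p)) refl
          1# ((- 1#) ^ m) (y Fin.zero) x₀ _)
        (*-cong (*-identityˡ _) (signs m (y ∘ Fin.suc)))
      minor-last : ∀ i k → minor N (fromℕ n) i k ≈
        (x (Fin.suc i) - x₀) * powers (x ∘ Fin.suc) (λ j → n ∸ suc (toℕ j)) i k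
      minor-last i k = reflexive (≡.trans
        (N-< (Fin.suc i) (≡.subst (_< n) (≡.sym to-k) (Fin.toℕ<n k)))
        (≡.cong (λ l → (x (Fin.suc i) - x₀) * power (n ∸ suc l) (x (Fin.suc i))) to-k))
        where
        to-k : toℕ (punchIn (fromℕ n) k) ≡ toℕ k
        to-k = toℕ-punchIn-< (fromℕ n) k (≡.subst (toℕ k <_) (≡.sym (toℕ-fromℕ n)) (Fin.toℕ<n k))
      last-term : term (fromℕ n) ≈ product (λ i → x₀ - x (Fin.suc i)) * det n (powers (x ∘ Fin.suc) (λ j → n ∸ suc (toℕ j)))
      last-term = begin
        (- 1#) ^ toℕ (fromℕ n) * (N Fin.zero (fromℕ n) * det n (minor N (fromℕ n)))
          ≈⟨ *-cong (reflexive (≡.cong ((- 1#) ^_) (toℕ-fromℕ n)))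
               (trans (*-congʳ (reflexive (N-last Fin.zero))) (*-identityˡ _)) ⟩
        (- 1#) ^ n * det n (minor N (fromℕ n))
          ≈⟨ *-congˡ (trans (det-cong n minor-last) (det-scaleRows n (λ i → x (Fin.suc i) - x₀) _)) ⟩
        (- 1#) ^ n * (product (λ i → x (Fin.suc i) - x₀) * d)
          ≈⟨ *-assoc _ _ _ ⟨
        (- 1#) ^ n * product (λ i → x (Fin.suc i) - x₀) * d
          ≈⟨ *-congʳ (signs n (x ∘ Fin.suc)) ⟩
        product (λ i → x₀ - x (Fin.suc i)) * d ∎
        where d = det n (powers (x ∘ Fin.suc) (λ j → n ∸ suc (toℕ j)))

-- Partitions

nth : List ℕ → ℕ → ℕ
nth []       _       = 0
nth (m ∷ _)  zero    = m
nth (_ ∷ ms) (suc i) = nth ms i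

private
  -- goOf is solved by unification to the auxiliary function of `part`.
  mutual
    goOf : Partition → List ℕ → ℕ → ℕ
    goOf = _

    part≡goOf : ∀ κ i → part κ i ≡ goOf κ (parts κ) i
    part≡goOf κ i with parts κ
    ... | ms = ≡.refl

  goOf≡nth : ∀ κ ms i → goOf κ ms i ≡ nth ms i
  goOf≡nth κ []       i       = ≡.refl
  goOf≡nth κ (m ∷ ms) zero    = ≡.refl
  goOf≡nth κ (m ∷ ms) (suc i) = goOf≡nth κ ms i

part≡nth : ∀ κ i → part κ i ≡ nth (parts κ) i
part≡nth κ i = ≡.trans (part≡goOf κ i) (goOf≡nth κ (parts κ) i)

-- Serves to compare partitions box by box: (i, j) is a box of κ when j < part κ i, so an inclusion
-- of boxes in a row becomes an inequality of parts.
<⊆⇒≤ : ∀ {m n} → (∀ {j} → j < m → j < n) → m ≤ n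
<⊆⇒≤ f = ℕ.≮⇒≥ λ n<m → ℕ.<-irrefl ≡.refl (f n<m)

nth-suc : ∀ {ms} → Linked _≥_ ms → ∀ i → nth ms (suc i) ≤ nth ms i
nth-suc []       i       = z≤n
nth-suc [-]      zero    = z≤n
nth-suc [-]      (suc i) = z≤n
nth-suc (m≥ ∷ _) zero    = m≥
nth-suc (_ ∷ ms) (suc i) = nth-suc ms i

nth-≥ : ∀ ms {i} → length ms ≤ i → nth ms i ≡ 0
nth-≥ []       _       = ≡.refl
nth-≥ (_ ∷ ms) (s≤s l) = nth-≥ ms l

nth-positive : ∀ {ms} → All (0 <_) ms → ∀ {i} → i < length ms → 0 < nth ms i
nth-positive (p ∷ _)  {zero}  _       = p
nth-positive (_ ∷ ps) {suc i} (s≤s l) = nth-positive ps l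

nth-applyUpTo : ∀ f n → (∀ i → n ≤ i → f i ≡ 0) → ∀ i → nth (applyUpTo f n) i ≡ f i
nth-applyUpTo f zero    z i       = ≡.sym (z i z≤n)
nth-applyUpTo f (suc n) z zero    = ≡.refl
nth-applyUpTo f (suc n) z (suc i) = nth-applyUpTo (f ∘ suc) n (λ j n≤j → z (suc j) (s≤s n≤j)) i

nth-ext : ∀ {ms ns} → All (0 <_) ms → All (0 <_) ns → (∀ i → nth ms i ≡ nth ns i) → ms ≡ ns
nth-ext []       []       e = ≡.refl
nth-ext []       (p ∷ _)  e = contradiction (e 0) (ℕ.<⇒≢ p)
nth-ext (p ∷ _)  []       e = contradiction (≡.sym (e 0)) (ℕ.<⇒≢ p)
nth-ext (_ ∷ ps) (_ ∷ qs) e = ≡.cong₂ _∷_ (e 0) (nth-ext ps qs (e ∘ suc))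

-- The field is irrelevant, but the property is decidable, so a usable proof can be recomputed.
decreasing′ : ∀ κ → Linked _≥_ (parts κ)
decreasing′ (partition ms d _) = recompute (Linked.linked? ℕ._≥?_ ms) d

positive′ : ∀ κ → All (0 <_) (parts κ)
positive′ (partition ms _ p) = recompute (All.all? (0 ℕ.<?_) ms) p

part-suc : ∀ κ i → part κ (suc i) ≤ part κ i
part-suc κ i = ≡.subst₂ _≤_ (≡.sym (part≡nth κ (suc i))) (≡.sym (part≡nth κ i)) (nth-suc (decreasing′ κ) i)

antitone : ∀ {f : ℕ → ℕ} → (∀ i → f (suc i) ≤ f i) → ∀ {i j} → i ≤ j → f j ≤ f i
antitone h {zero}  {zero}  z≤n       = ℕ.≤-refl
antitone h {zero}  {suc j} z≤n       = ℕ.≤-trans (h j) (antitone h {zero} {j} z≤n)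
antitone h {suc i} {suc j} (s≤s i≤j) = antitone (h ∘ suc) i≤j

part-antitone : ∀ κ {i j} → i ≤ j → part κ j ≤ part κ i
part-antitone κ = antitone (part-suc κ)

part-≥ℓ : ∀ κ {i} → ℓength κ ≤ i → part κ i ≡ 0
part-≥ℓ κ {i} l = ≡.trans (part≡nth κ i) (nth-≥ (parts κ) l)

part-<ℓ : ∀ κ {i} → i < ℓength κ → 0 < part κ i
part-<ℓ κ {i} l = ≡.subst (0 <_) (≡.sym (part≡nth κ i)) (nth-positive (positive′ κ) l)

part-ext : ∀ κ κ′ → (∀ i → part κ i ≡ part κ′ i) → κ ≡ κ′
part-ext κ@(partition _ _ _) κ′@(partition _ _ _) e
  with nth-ext (positive′ κ) (positive′ κ′)
         (λ i → ≡.trans (≡.sym (part≡nth κ i)) (≡.trans (e i) (part≡nth κ′ i)))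
... | ≡.refl = ≡.refl

private
  nth≤head : ∀ {m ms} → Linked _≥_ (m ∷ ms) → ∀ i → nth (m ∷ ms) i ≤ m
  nth≤head l i = antitone (nth-suc l) {0} {i} z≤n

  tail : ∀ {m ms} → Linked _≥_ (m ∷ ms) → Linked _≥_ ms
  tail [-]      = []
  tail (_ ∷ ms) = ms

  count>⇒nth : ∀ {ms} → Linked _≥_ ms → ∀ i j → i < count> j ms → j < nth ms i
  count>⇒nth {m ∷ ms} l i j c with j ℕ.<? m
  count>⇒nth {m ∷ ms} l zero    j c | yes j<m = j<m
  count>⇒nth {m ∷ ms} l (suc i) j c | yes j<m = count>⇒nth (tail l) i j
    (ℕ.≤-pred (≡.subst (λ xs → suc i < length xs) (filter-accept (j ℕ.<?_) {xs = ms} j<m) c))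
  ... | no j≮m = contradiction
    (ℕ.<-≤-trans (count>⇒nth (tail l) i j (≡.subst (λ xs → i < length xs) (filter-reject (j ℕ.<?_) {xs = ms} j≮m) c))
                 (nth≤head l (suc i)))
    j≮m

  nth⇒count> : ∀ {ms} → Linked _≥_ ms → ∀ i j → j < nth ms i → i < count> j ms
  nth⇒count> {m ∷ ms} l i j b = ≡.subst (λ xs → i < length xs)
    (≡.sym (filter-accept (j ℕ.<?_) {xs = ms} (ℕ.<-≤-trans b (nth≤head l i)))) (lemma i b)
    where
    lemma : ∀ i → j < nth (m ∷ ms) i → i < suc (count> j ms)
    lemma zero    _ = s≤s z≤n
    lemma (suc i) b = s≤s (nth⇒count> (tail l) i j b)

  count>-≥largest : ∀ {ms} → Linked _≥_ ms → ∀ j → largest ms ≤ j → count> j ms ≡ 0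
  count>-≥largest {[]}     _ j _ = ≡.refl
  count>-≥largest {m ∷ ms} l j m≤j = ℕ.n≤0⇒n≡0 (<⊆⇒≤ λ {i} i<c → contradiction
    (ℕ.<-≤-trans (count>⇒nth l i j i<c) (nth≤head l i)) (ℕ.≤⇒≯ m≤j))

  partᵗ≡count> : ∀ κ j → part (κ ᵗ) j ≡ count> j (parts κ)
  partᵗ≡count> κ j = ≡.trans (part≡nth (κ ᵗ) j)
    (nth-applyUpTo (λ j → count> j (parts κ)) (largest (parts κ)) (count>-≥largest (decreasing′ κ)) j)

-- Because the parts decrease, row i is longer than j exactly when more than i parts exceed j. This
-- reflection of boxes, with its converse, is the source of the later facts about conjugation.
box-ᵗ : ∀ κ {i j} → j < part κ i → i < part (κ ᵗ) j
box-ᵗ κ {i} {j} b = ≡.subst (i <_) (≡.sym (partᵗ≡count> κ j))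
  (nth⇒count> (decreasing′ κ) i j (≡.subst (j <_) (part≡nth κ i) b))

box-ᵗ⁻¹ : ∀ κ {i j} → i < part (κ ᵗ) j → j < part κ i
box-ᵗ⁻¹ κ {i} {j} b = ≡.subst (j <_) (≡.sym (part≡nth κ i))
  (count>⇒nth (decreasing′ κ) i j (≡.subst (i <_) (partᵗ≡count> κ j) b))

box-ext : ∀ κ κ′ → (∀ {i j} → j < part κ i → j < part κ′ i) → (∀ {i j} → j < part κ′ i → j < part κ i) → κ ≡ κ′
box-ext κ κ′ f g = part-ext κ κ′ λ i → ℕ.≤-antisym (<⊆⇒≤ f) (<⊆⇒≤ g)

ᵗ-involutive : ∀ κ → κ ᵗ ᵗ ≡ κ
ᵗ-involutive κ = box-ext (κ ᵗ ᵗ) κ (box-ᵗ⁻¹ κ ∘ box-ᵗ⁻¹ (κ ᵗ)) (box-ᵗ (κ ᵗ) ∘ box-ᵗ κ)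

infix 4 _⊆ₚ_
_⊆ₚ_ : Partition → Partition → Set
κ ⊆ₚ μ = ∀ i → part κ i ≤ part μ i

ᵗ-mono : ∀ κ μ → κ ⊆ₚ μ → κ ᵗ ⊆ₚ μ ᵗ
ᵗ-mono κ μ κ⊆μ i = <⊆⇒≤ λ b → box-ᵗ μ (ℕ.<-≤-trans (box-ᵗ⁻¹ κ b) (κ⊆μ _))

private
  search : {P : ℕ → Set} → (∀ i → Dec (P i)) → ∀ n →
    (∀ i → i < n → P i) ⊎ ∃[ i ] (∀ j → j < i → P j) × ¬ P i
  search P? zero = inj₁ λ _ ()
  search P? (suc n) with search P? n
  ... | inj₂ found = inj₂ found
  ... | inj₁ all with P? n
  ...   | no ¬Pn = inj₂ (n , all , ¬Pn)
  ...   | yes Pn = inj₁ λ i i<1+n → lemma i (ℕ.m≤n⇒m<n∨m≡n (ℕ.≤-pred i<1+n))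
    where
    lemma : ∀ i → i < n ⊎ i ≡ n → _
    lemma i (inj₁ i<n)    = all i i<n
    lemma i (inj₂ ≡.refl) = Pn

-- It is the least differing row that is returned: `weight-difference-regular` uses that the rows
-- above it agree.
difference : ∀ κ κ′ → κ ≡ κ′ ⊎ ∃[ i ] (∀ j → j < i → part κ j ≡ part κ′ j) × part κ i ≢ part κ′ i
difference κ κ′ with search (λ i → part κ i ℕ.≟ part κ′ i) (ℓength κ ℕ.⊔ ℓength κ′)
... | inj₂ found = inj₂ found
... | inj₁ all = inj₁ (part-ext κ κ′ lemma)
  where
  lemma : ∀ i → part κ i ≡ part κ′ i
  lemma i with i ℕ.<? ℓength κ ℕ.⊔ ℓength κ′
  ... | yes i<n = all i i<n
  ... | no i≮n = ≡.trans (part-≥ℓ κ (ℕ.m⊔n≤o⇒m≤o _ _ (ℕ.≮⇒≥ i≮n)))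
                   (≡.sym (part-≥ℓ κ′ (ℕ.m⊔n≤o⇒n≤o _ _ (ℕ.≮⇒≥ i≮n))))

_⊆ₚ?_ : ∀ κ μ → κ ⊆ₚ μ ⊎ ∃[ i ] part μ i < part κ i
κ ⊆ₚ? μ with search (λ i → part κ i ℕ.≤? part μ i) (ℓength κ)
... | inj₂ (i , _ , κᵢ≰μᵢ) = inj₂ (i , ℕ.≰⇒> κᵢ≰μᵢ)
... | inj₁ all = inj₁ lemma
  where
  lemma : ∀ i → part κ i ≤ part μ i
  lemma i with i ℕ.<? ℓength κ
  ... | yes i<n = all i i<n
  ... | no i≮n = ≡.subst (_≤ part μ i) (≡.sym (part-≥ℓ κ (ℕ.≮⇒≥ i≮n))) z≤n

size : Partition → ℕ
size κ = ℕ.sum (parts κ)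

private
  sum-mono : ∀ ms ns → (∀ i → nth ms i ≤ nth ns i) → ℕ.sum ms ≤ ℕ.sum ns
  sum-mono []       ns       h = z≤n
  sum-mono (m ∷ ms) []       h = ℕ.+-mono-≤ (h 0) (sum-mono ms [] (h ∘ suc))
  sum-mono (m ∷ ms) (n ∷ ns) h = ℕ.+-mono-≤ (h 0) (sum-mono ms ns (h ∘ suc))

  sum-strict : ∀ ms ns → (∀ i → nth ms i ≤ nth ns i) → ∀ i → nth ms i < nth ns i → ℕ.sum ms < ℕ.sum ns
  sum-strict []       (n ∷ ns) h zero    l = ℕ.<-≤-trans l (ℕ.m≤m+n n _)
  sum-strict []       (n ∷ ns) h (suc i) l = ℕ.<-≤-trans (sum-strict [] ns (h ∘ suc) i l) (ℕ.m≤n+m _ n)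
  sum-strict (m ∷ ms) (n ∷ ns) h zero    l = ℕ.+-mono-<-≤ l (sum-mono ms ns (h ∘ suc))
  sum-strict (m ∷ ms) (n ∷ ns) h (suc i) l = ℕ.+-mono-≤-< (h 0) (sum-strict ms ns (h ∘ suc) i l)

size-mono : ∀ κ μ → κ ⊆ₚ μ → size κ ≤ size μ
size-mono κ μ h = sum-mono (parts κ) (parts μ) λ i → ≡.subst₂ _≤_ (part≡nth κ i) (part≡nth μ i) (h i)

size-strict : ∀ κ μ → κ ⊆ₚ μ → κ ≢ μ → size κ < size μ
size-strict κ μ h κ≢μ with difference κ μ
... | inj₁ κ≡μ = contradiction κ≡μ κ≢μ
... | inj₂ (i , _ , κᵢ≢μᵢ) = sum-strict (parts κ) (parts μ)
  (λ i → ≡.subst₂ _≤_ (part≡nth κ i) (part≡nth μ i) (h i)) i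
  (≡.subst₂ _<_ (part≡nth κ i) (part≡nth μ i) (ℕ.≤∧≢⇒< (h i) κᵢ≢μᵢ))

_≟ₚ_ : ∀ κ μ → Dec (κ ≡ μ)
κ ≟ₚ μ with difference κ μ
... | inj₁ κ≡μ = yes κ≡μ
... | inj₂ (_ , _ , differ) = no λ { ≡.refl → differ ≡.refl }

-- A box that can be added, in row i and column j counted from 0. Prescribing both the row length
-- and the column length makes conjugation an exchange of the two conditions.
Corner : Partition → ℕ → ℕ → Set
Corner κ i j = part κ i ≡ j × part (κ ᵗ) j ≡ i

corner? : ∀ κ i j → Dec (Corner κ i j)
corner? κ i j = part κ i ℕ.≟ j ×-dec part (κ ᵗ) j ℕ.≟ i

corner-ᵗ : ∀ κ {i j} → Corner κ i j → Corner (κ ᵗ) j i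
corner-ᵗ κ {i} {j} (r , c) = c , ≡.trans (≡.cong (λ κ → part κ i) (ᵗ-involutive κ)) r

private
  module AddBox (κ : Partition) {i j : ℕ} (corner : Corner κ i j) where

    rows : ℕ → ℕ
    rows k = if does (k ℕ.≟ i) then suc j else part κ k

    rows-≡ : rows i ≡ suc j
    rows-≡ rewrite dec-true (i ℕ.≟ i) ≡.refl = ≡.refl

    rows-≢ : ∀ {k} → k ≢ i → rows k ≡ part κ k
    rows-≢ {k} k≢i rewrite dec-false (k ℕ.≟ i) k≢i = ≡.refl

    above : ∀ {k} → k < i → j < part κ k
    above k<i = box-ᵗ⁻¹ κ (ℕ.<-≤-trans k<i (ℕ.≤-reflexive (≡.sym (proj₂ corner))))

    rows-suc : ∀ k → rows (suc k) ≤ rows k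
    rows-suc k with k ℕ.≟ i | suc k ℕ.≟ i
    ... | yes ≡.refl | yes e = contradiction e ℕ.1+n≢n
    ... | yes ≡.refl | no k≢i = ≡.subst₂ _≤_ (≡.sym (rows-≢ k≢i)) (≡.sym rows-≡)
            (ℕ.m≤n⇒m≤1+n (ℕ.≤-trans (part-suc κ k) (ℕ.≤-reflexive (proj₁ corner))))
    ... | no k≢i | yes ≡.refl = ≡.subst₂ _≤_ (≡.sym rows-≡) (≡.sym (rows-≢ k≢i)) (above (ℕ.n<1+n k))
    ... | no k≢i | no 1+k≢i = ≡.subst₂ _≤_ (≡.sym (rows-≢ 1+k≢i)) (≡.sym (rows-≢ k≢i)) (part-suc κ k)

    -- The added box may open a new row, hence the maximum.
    number : ℕ
    number = ℓength κ ℕ.⊔ suc i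

    rows-positive : ∀ {k} → k < number → 0 < rows k
    rows-positive {k} k<n with k ℕ.≟ i
    ... | yes ≡.refl = ≡.subst (0 <_) (≡.sym rows-≡) (s≤s z≤n)
    ... | no k≢i with k ℕ.<? ℓength κ
    ...   | yes k<ℓ = ≡.subst (0 <_) (≡.sym (rows-≢ k≢i)) (part-<ℓ κ k<ℓ)
    ...   | no k≮ℓ = ≡.subst (0 <_) (≡.sym (rows-≢ k≢i)) (ℕ.≤-<-trans z≤n (above (ℕ.≤∧≢⇒< (ℕ.≤-pred k<1+i) k≢i)))
      where
      k<1+i : k < suc i
      k<1+i with ℕ.⊔-sel (ℓength κ) (suc i)
      ... | inj₁ e = contradiction (≡.subst (k <_) e k<n) k≮ℓ
      ... | inj₂ e = ≡.subst (k <_) e k<n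

    rows-zero : ∀ k → number ≤ k → rows k ≡ 0
    rows-zero k n≤k = ≡.trans
      (rows-≢ λ { ≡.refl → ℕ.<-irrefl ≡.refl (ℕ.m⊔n≤o⇒n≤o (ℓength κ) _ n≤k) })
      (part-≥ℓ κ (ℕ.m⊔n≤o⇒m≤o _ _ n≤k))

addBox : ∀ κ {i j} → Corner κ i j → Partition
addBox κ corner = partition (applyUpTo rows number)
  (Linked.applyUpTo⁺₂ rows number rows-suc)
  (All.applyUpTo⁺₁ rows number rows-positive)
  where open AddBox κ corner

part-addBox : ∀ κ {i j} (corner : Corner κ i j) k →
  part (addBox κ corner) k ≡ (if does (k ℕ.≟ i) then suc j else part κ k)
part-addBox κ corner k = ≡.trans (part≡nth (addBox κ corner) k) (nth-applyUpTo rows number rows-zero k)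
  where open AddBox κ corner

ℓength-addBox : ∀ κ {i j} (corner : Corner κ i j) {n} → ℓength κ ≤ n → i < n → ℓength (addBox κ corner) ≤ n
ℓength-addBox κ {i} corner ℓ≤n i<n = ℕ.≤-trans
  (ℕ.≤-reflexive (length-applyUpTo rows number)) (ℕ.⊔-lub ℓ≤n i<n)
  where
  open AddBox κ corner
  open import Data.List.Properties using (length-applyUpTo)

part-addBox-≡ : ∀ κ {i j} (corner : Corner κ i j) → part (addBox κ corner) i ≡ suc j
part-addBox-≡ κ corner = ≡.trans (part-addBox κ corner _) (AddBox.rows-≡ κ corner)

part-addBox-≢ : ∀ κ {i j} (corner : Corner κ i j) {k} → k ≢ i → part (addBox κ corner) k ≡ part κ k
part-addBox-≢ κ corner k≢i = ≡.trans (part-addBox κ corner _) (AddBox.rows-≢ κ corner k≢i)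

size-addBox : ∀ κ {i j} (corner : Corner κ i j) → size κ < size (addBox κ corner)
size-addBox κ {i} corner = size-strict κ (addBox κ corner) ⊆ λ e → ℕ.1+n≢n (≡.trans (≡.sym (part-addBox-≡ κ corner))
  (≡.trans (≡.cong (λ κ → part κ i) (≡.sym e)) (proj₁ corner)))
  where
  ⊆ : κ ⊆ₚ addBox κ corner
  ⊆ k with k ℕ.≟ i
  ... | yes ≡.refl = ≡.subst₂ _≤_ (≡.sym (proj₁ corner)) (≡.sym (part-addBox-≡ κ corner)) (ℕ.n≤1+n _)
  ... | no k≢i = ℕ.≤-reflexive (≡.sym (part-addBox-≢ κ corner k≢i))

private
  box-addBox-ᵗ : ∀ κ {i j} (corner : Corner κ i j) (corner′ : Corner (κ ᵗ) j i) {k l} →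
    k < part (addBox κ corner) l → l < part (addBox (κ ᵗ) corner′) k
  box-addBox-ᵗ κ {i} {j} corner corner′ {k} {l} b with l ℕ.≟ i | k ℕ.≟ j
  ... | yes ≡.refl | yes ≡.refl = ≡.subst (i <_) (≡.sym (part-addBox-≡ (κ ᵗ) corner′)) (ℕ.n<1+n i)
  ... | yes ≡.refl | no k≢j = ≡.subst (i <_) (≡.sym (part-addBox-≢ (κ ᵗ) corner′ k≢j)) (box-ᵗ κ
          (≡.subst (k <_) (≡.sym (proj₁ corner))
            (ℕ.≤∧≢⇒< (ℕ.≤-pred (≡.subst (k <_) (part-addBox-≡ κ corner) b)) k≢j)))
  ... | no l≢i | yes ≡.refl = ≡.subst (l <_) (≡.sym (part-addBox-≡ (κ ᵗ) corner′)) (ℕ.m<n⇒m<1+n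
          (≡.subst (l <_) (proj₂ corner) (box-ᵗ κ (≡.subst (j <_) (part-addBox-≢ κ corner l≢i) b))))
  ... | no l≢i | no k≢j = ≡.subst (l <_) (≡.sym (part-addBox-≢ (κ ᵗ) corner′ k≢j))
          (box-ᵗ κ (≡.subst (k <_) (part-addBox-≢ κ corner l≢i) b))

addBox-cong : ∀ {κ κ′ i j} (corner : Corner κ i j) (corner′ : Corner κ′ i j) → κ ≡ κ′ → addBox κ corner ≡ addBox κ′ corner′
addBox-cong {κ} corner corner′ ≡.refl = part-ext _ _ λ k →
  ≡.trans (part-addBox κ corner k) (≡.sym (part-addBox κ corner′ k))

addBox-ᵗ : ∀ κ {i j} (corner : Corner κ i j) (corner′ : Corner (κ ᵗ) j i) → addBox κ corner ᵗ ≡ addBox (κ ᵗ) corner′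
addBox-ᵗ κ {i} {j} corner corner′ = box-ext _ _
  (λ b → box-addBox-ᵗ κ corner corner′ (box-ᵗ⁻¹ (addBox κ corner) b))
  (λ {l} {k} b → box-ᵗ (addBox κ corner) (≡.subst (λ κ → l < part κ k)
    (addBox-cong (corner-ᵗ (κ ᵗ) corner′) corner (ᵗ-involutive κ))
    (box-addBox-ᵗ (κ ᵗ) corner′ (corner-ᵗ (κ ᵗ) corner′) b)))

∅ : Partition
∅ = partition [] [] []

-- These are the two outcomes of raising one exponent of an alternant: a partition with one more box
-- or, below a row of the same length, a repeated exponent.
row-corner : ∀ κ i → Corner κ i (part κ i) ⊎ ∃[ k ] i ≡ suc k × part κ k ≡ part κ i
row-corner κ i with part (κ ᵗ) (part κ i) ℕ.≟ i
... | yes e = inj₁ (≡.refl , e)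
... | no c≢i = inj₂ (lemma i ≤i c≢i)
  where
  ≤i : part (κ ᵗ) (part κ i) ≤ i
  ≤i = ℕ.≮⇒≥ λ b → ℕ.<-irrefl ≡.refl (box-ᵗ⁻¹ κ b)
  lemma : ∀ i → part (κ ᵗ) (part κ i) ≤ i → part (κ ᵗ) (part κ i) ≢ i → ∃[ k ] i ≡ suc k × part κ k ≡ part κ i
  lemma zero    c≤ c≢ = contradiction (ℕ.n≤0⇒n≡0 c≤) c≢
  lemma (suc k) c≤ c≢ = k , ≡.refl , ℕ.≤-antisym
    (ℕ.≮⇒≥ λ b → ℕ.<⇒≱ (box-ᵗ κ b) (ℕ.≤-pred (ℕ.≤∧≢⇒< c≤ c≢)))
    (part-suc κ k)

-- Generation by power sums

sum-updateAt : ∀ {r} (K : Vec ℕ r) j k → Vec.sum (updateAt K j (k ℕ.+_)) ≡ k ℕ.+ Vec.sum K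
sum-updateAt (l ∷ K) Fin.zero    k = ℕ.+-assoc k l _
sum-updateAt (l ∷ K) (Fin.suc j) k = ≡.trans (≡.cong (l ℕ.+_) (sum-updateAt K j k)) (x∙yz≈y∙xz l k _)
  where open CommutativeSemigroupProperties ℕ.+-commutativeSemigroup using (x∙yz≈y∙xz)

sum-∷ʳ : ∀ {r} (K : Vec ℕ r) k → Vec.sum (K ∷ʳ k) ≡ k ℕ.+ Vec.sum K
sum-∷ʳ []      k = ≡.refl
sum-∷ʳ (l ∷ K) k = ≡.trans (≡.cong (l ℕ.+_) (sum-∷ʳ K k)) (x∙yz≈y∙xz l k _)
  where open CommutativeSemigroupProperties ℕ.+-commutativeSemigroup using (x∙yz≈y∙xz)

sum-zipWith-+ : ∀ {r} (K L : Vec ℕ r) → Vec.sum (zipWith ℕ._+_ K L) ≡ Vec.sum K ℕ.+ Vec.sum L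
sum-zipWith-+ []      []      = ≡.refl
sum-zipWith-+ (k ∷ K) (l ∷ L) = ≡.trans (≡.cong (k ℕ.+ l ℕ.+_) (sum-zipWith-+ K L)) (interchange k l _ _)
  where open CommutativeSemigroupProperties ℕ.+-commutativeSemigroup using (interchange)

module MonomialSums {c ℓ} (S : CommutativeRing c ℓ) where
  open CommutativeRing S hiding (zero)
  open RingOperations S
  open SemiringSum semiring using (∑-distrib-+; ∑-comm; *-distribˡ-sum; *-distribʳ-sum; sum-remove)
  open Determinant S using (∑-cong; sum-zero)
  open Exp semiring using (^-homo-*; ^-congˡ)
  open IntegerSolver S
  open import Relation.Binary.Reasoning.Setoid setoid

  powers : ∀ {n} → (Fin n → Carrier) → ℕ → Carrier
  powers v k = sum λ i → v i ^ k

  -- The sum of v(i₁)^k₁ ⋯ v(iᵣ)^kᵣ over all tuples of distinct indices i₁, …, iᵣ.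
  monomialSum : ∀ {n r} → (Fin n → Carrier) → Vec ℕ r → Carrier
  monomialSum             v []      = 1#
  monomialSum {n = zero}  v (k ∷ K) = 0#
  monomialSum {n = suc n} v (k ∷ K) = sum λ i → v i ^ k * monomialSum (v ∘ punchIn i) K

  -- The index chosen by the power sum is either new, which appends k to the exponents, or equal to
  -- some iⱼ, which adds k to the exponent of iⱼ.
  powers-*-monomialSum : ∀ {n r} (v : Fin n → Carrier) k (K : Vec ℕ r) →
    powers v k * monomialSum v K ≈
    monomialSum v (K ∷ʳ k) + sum λ j → monomialSum v (updateAt K j (k ℕ.+_))
  powers-*-monomialSum {zero} v k [] = trans (zeroˡ _) (sym (+-identityˡ _))
  powers-*-monomialSum {zero} v k (l ∷ K) = trans (zeroʳ _) (sym (trans (+-identityˡ _)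
    (sum-zero (λ j → monomialSum v (updateAt (l ∷ K) j (k ℕ.+_))) λ { Fin.zero → refl ; (Fin.suc j) → refl })))
  powers-*-monomialSum {suc n} v k [] = trans (*-identityʳ _)
    (trans (∑-cong {suc n} _ _ λ i → sym (*-identityʳ (v i ^ k))) (sym (+-identityʳ _)))
  powers-*-monomialSum {suc n} {suc r} v k (l ∷ K) = begin
    powers v k * sum term
      ≈⟨ *-distribˡ-sum (powers v k) term ⟩
    sum (λ i → powers v k * term i)
      ≈⟨ ∑-cong {suc n} _ _ split ⟩
    sum (λ i → v i ^ (k ℕ.+ l) * M i K + (v i ^ l * M i (K ∷ʳ k) + sum λ j → v i ^ l * M i (updateAt K j (k ℕ.+_))))
      ≈⟨ trans (∑-distrib-+ (λ i → v i ^ (k ℕ.+ l) * M i K)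
             (λ i → v i ^ l * M i (K ∷ʳ k) + sum λ j → v i ^ l * M i (updateAt K j (k ℕ.+_)))) (+-congˡ
           (trans (∑-distrib-+ (λ i → v i ^ l * M i (K ∷ʳ k)) (λ i → sum λ j → v i ^ l * M i (updateAt K j (k ℕ.+_))))
             (+-congˡ (∑-comm {suc n} {r} (λ i j → v i ^ l * M i (updateAt K j (k ℕ.+_))))))) ⟩
    monomialSum v (k ℕ.+ l ∷ K) + (monomialSum v (l ∷ (K ∷ʳ k)) +
      sum λ j → monomialSum v (l ∷ updateAt K j (k ℕ.+_)))
      ≈⟨ solve 3 (λ x y z → x :+ (y :+ z) := y :+ (x :+ z)) refl
           (monomialSum v (k ℕ.+ l ∷ K)) (monomialSum v (l ∷ (K ∷ʳ k))) _ ⟩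
    monomialSum v (l ∷ (K ∷ʳ k)) + (sum λ j → monomialSum v (updateAt (l ∷ K) j (k ℕ.+_))) ∎
    where
    M : ∀ {r} → Fin (suc n) → Vec ℕ r → Carrier
    M i K = monomialSum (v ∘ punchIn i) K
    term : Fin (suc n) → Carrier
    term i = v i ^ l * M i K
    split : ∀ i → powers v k * term i ≈
      v i ^ (k ℕ.+ l) * M i K + (v i ^ l * M i (K ∷ʳ k) + sum λ j → v i ^ l * M i (updateAt K j (k ℕ.+_)))
    split i = begin
      powers v k * term i
        ≈⟨ *-congʳ (sum-remove {i = i} (λ i → v i ^ k)) ⟩
      (v i ^ k + powers (v ∘ punchIn i) k) * (v i ^ l * M i K)
        ≈⟨ solve 4 (λ x p y m → (x :+ p) :* (y :* m) := (x :* y) :* m :+ y :* (p :* m)) refl (v i ^ k) _ (v i ^ l) (M i K) ⟩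
      v i ^ k * v i ^ l * M i K + v i ^ l * (powers (v ∘ punchIn i) k * M i K)
        ≈⟨ +-cong (*-congʳ (sym (^-homo-* (v i) k l))) (*-congˡ (powers-*-monomialSum (v ∘ punchIn i) k K)) ⟩
      v i ^ (k ℕ.+ l) * M i K + v i ^ l * (M i (K ∷ʳ k) + sum λ j → M i (updateAt K j (k ℕ.+_)))
        ≈⟨ +-congˡ (trans (distribˡ (v i ^ l) _ _) (+-congˡ (*-distribˡ-sum (v i ^ l) λ j → M i (updateAt K j (k ℕ.+_))))) ⟩
      v i ^ (k ℕ.+ l) * M i K + (v i ^ l * M i (K ∷ʳ k) + sum λ j → v i ^ l * M i (updateAt K j (k ℕ.+_))) ∎

  monomial : ∀ {n} → (Fin n → Carrier) → Vec ℕ n → Carrier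
  monomial v []      = 1#
  monomial v (k ∷ e) = v Fin.zero ^ k * monomial (v ∘ Fin.suc) e

  monomial-cong : ∀ {n} {v w : Fin n → Carrier} → (∀ i → v i ≈ w i) → ∀ e → monomial v e ≈ monomial w e
  monomial-cong h []      = refl
  monomial-cong h (k ∷ e) = *-cong (^-congˡ k (h Fin.zero)) (monomial-cong (h ∘ Fin.suc) e)

  monomial-replicate-0 : ∀ {n} (v : Fin n → Carrier) → monomial v (replicate n 0) ≈ 1#
  monomial-replicate-0 {zero}  v = refl
  monomial-replicate-0 {suc n} v = trans (*-identityˡ _) (monomial-replicate-0 (v ∘ Fin.suc))

  monomial-unit : ∀ {n} (v : Fin n → Carrier) i → monomial v (updateAt (replicate n 0) i suc) ≈ v i
  monomial-unit v Fin.zero    = trans (*-cong (*-identityʳ _) (monomial-replicate-0 (v ∘ Fin.suc))) (*-identityʳ _)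
  monomial-unit v (Fin.suc i) = trans (*-identityˡ _) (monomial-unit (v ∘ Fin.suc) i)

  monomial-* : ∀ {n} (v : Fin n → Carrier) e f → monomial v e * monomial v f ≈ monomial v (zipWith ℕ._+_ e f)
  monomial-* v []      []      = *-identityˡ _
  monomial-* v (k ∷ e) (l ∷ f) = trans
    (solve 4 (λ x m y n → (x :* m) :* (y :* n) := (x :* y) :* (m :* n)) refl (v Fin.zero ^ k) _ (v Fin.zero ^ l) _)
    (*-cong (sym (^-homo-* (v Fin.zero) k l)) (monomial-* (v ∘ Fin.suc) e f))

  monomial-absent : ∀ {n} (v w : Fin n → Carrier) e i → (∀ j → j ≢ i → v j ≈ w j) → lookup e i ≡ 0 →
    monomial v e ≈ monomial w e
  monomial-absent v w (.0 ∷ e) Fin.zero h ≡.refl = *-congˡ (monomial-cong (λ j → h (Fin.suc j) λ ()) e)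
  monomial-absent v w (k ∷ e) (Fin.suc i) h z = *-cong (^-congˡ k (h Fin.zero λ ()))
    (monomial-absent (v ∘ Fin.suc) (w ∘ Fin.suc) e i (λ j j≢i → h (Fin.suc j) (j≢i ∘ Fin.suc-injective)) z)

  monomial-zero : ∀ {n} (v : Fin n → Carrier) e i → v i ≈ 0# → 0 < lookup e i → monomial v e ≈ 0#
  monomial-zero v (suc k ∷ e) Fin.zero    h _ = trans (*-congʳ (trans (*-congʳ h) (zeroˡ _))) (zeroˡ _)
  monomial-zero v (k ∷ e)     (Fin.suc i) h l = trans (*-congˡ (monomial-zero (v ∘ Fin.suc) e i h l)) (zeroʳ _)

  -- Permutations are enumerated by the image j of 0, so that the sum of a permuted monomial unfolds
  -- exactly like `monomialSum`.
  sumPermutations : ∀ n → (Permutation′ n → Carrier) → Carrier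
  sumPermutations zero    F = F Perm.id
  sumPermutations (suc n) F = sum λ j → sumPermutations n λ π → F (Perm.insert Fin.zero j π)

  sumPermutations-cong : ∀ n F G → (∀ π → F π ≈ G π) → sumPermutations n F ≈ sumPermutations n G
  sumPermutations-cong zero    F G h = h Perm.id
  sumPermutations-cong (suc n) F G h = ∑-cong {suc n} _ _ λ j → sumPermutations-cong n _ _ λ π → h (Perm.insert Fin.zero j π)

  sumPermutations-+ : ∀ n F G → sumPermutations n (λ π → F π + G π) ≈ sumPermutations n F + sumPermutations n G
  sumPermutations-+ zero    F G = refl
  sumPermutations-+ (suc n) F G = trans (∑-cong {suc n} _ _ λ j → sumPermutations-+ n (F ∘ Perm.insert Fin.zero j) (G ∘ Perm.insert Fin.zero j))
    (∑-distrib-+ {suc n} (λ j → sumPermutations n (F ∘ Perm.insert Fin.zero j))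
      (λ j → sumPermutations n (G ∘ Perm.insert Fin.zero j)))

  sumPermutations-* : ∀ n x F → sumPermutations n (λ π → x * F π) ≈ x * sumPermutations n F
  sumPermutations-* zero    x F = refl
  sumPermutations-* (suc n) x F = trans (∑-cong {suc n} _ _ λ j → sumPermutations-* n x (F ∘ Perm.insert Fin.zero j))
    (sym (*-distribˡ-sum {suc n} x (λ j → sumPermutations n (F ∘ Perm.insert Fin.zero j))))

  sumPermutations-monomial : ∀ n v e → sumPermutations n (λ π → monomial (v ∘ (π ⟨$⟩ʳ_)) e) ≈ monomialSum v e
  sumPermutations-monomial zero    v []      = refl
  sumPermutations-monomial (suc n) v (k ∷ e) = ∑-cong {suc n} _ _ λ j → trans
    (sumPermutations-* n (v j ^ k) (λ π → monomial (v ∘ punchIn j ∘ (π ⟨$⟩ʳ_)) e))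
    (*-congˡ (sumPermutations-monomial n (v ∘ punchIn j) e))

  -- Division by n!, one factor at a time; here rational coefficients enter the generation by power
  -- sums.
  sumPermutations-const : ∀ (h : Hom (ℚ.+-*-commutativeRing) S) n x →
    ∃[ q ] Hom.⟦_⟧ h q * sumPermutations n (λ _ → x) ≈ x
  sumPermutations-const h zero x = 1ℚ , trans (*-congʳ (Hom.1-homo h)) (*-identityˡ x)
  sumPermutations-const h (suc n) x = u ℚ.* q , (begin
    h.⟦ u ℚ.* q ⟧ * sum {suc n} (λ _ → y)
      ≈⟨ *-cong (h.*-homo u q) (trans (∑-cong {suc n} _ _ λ _ → sym (*-identityˡ y)) (sym (*-distribʳ-sum {suc n} y (λ _ → 1#)))) ⟩
    (h.⟦ u ⟧ * h.⟦ q ⟧) * (sum {suc n} (λ _ → 1#) * y)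
      ≈⟨ solve 4 (λ u q s y → (u :* q) :* (s :* y) := (u :* s) :* (q :* y)) refl h.⟦ u ⟧ h.⟦ q ⟧ _ y ⟩
    (h.⟦ u ⟧ * sum {suc n} (λ _ → 1#)) * (h.⟦ q ⟧ * y)
      ≈⟨ *-cong (trans (*-congˡ (trans (∑-cong {suc n} _ _ λ _ → sym h.1-homo) (sym (h.sum-homo {suc n} (λ _ → 1ℚ)))))
           (trans (sym (h.*-homo u _)) (trans (h.⟦⟧-cong (ℚ.*-inverseˡ (count (suc n)))) h.1-homo))) q-inverse ⟩
    1# * x
      ≈⟨ *-identityˡ x ⟩
    x ∎)
    where
    module h = Hom h
    y = sumPermutations n (λ _ → x)
    q = proj₁ (sumPermutations-const h n x)
    q-inverse = proj₂ (sumPermutations-const h n x)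
    count : ℕ → ℚ
    count m = RingOperations.sum ℚ.+-*-commutativeRing {m} λ _ → 1ℚ
    count-≥0 : ∀ m → ℚ.NonNegative (count m)
    count-≥0 zero    = _
    count-≥0 (suc m) = ℚ.nonNeg+nonNeg⇒nonNeg 1ℚ (count m) ⦃ count-≥0 m ⦄
    instance
      count-nonZero : ℚ.NonZero (count (suc n))
      count-nonZero = ℚ.pos⇒nonZero (count (suc n)) ⦃ ℚ.pos+nonNeg⇒pos 1ℚ (count n) ⦃ count-≥0 n ⦄ ⦄
    u : ℚ
    u = 1/ count (suc n)

module _ {c ℓ c′ ℓ′} {R : CommutativeRing c ℓ} {S : CommutativeRing c′ ℓ′} (h : Hom R S) where
  private
    module S = CommutativeRing S
    module h = Hom h
    module MR = MonomialSums R
    module MS = MonomialSums S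

  monomial-homo : ∀ {n} v (e : Vec ℕ n) → h.⟦ MR.monomial v e ⟧ S.≈ MS.monomial (h.⟦_⟧ ∘ v) e
  monomial-homo v []      = h.1-homo
  monomial-homo v (k ∷ e) = S.trans (h.*-homo _ _) (S.*-cong (h.^-homo _ k) (monomial-homo (v ∘ Fin.suc) e))

module 𝔸 = CommutativeRing ℚ[a]-ring

insertAt-inject₁ : ∀ {A : Set} {n} (f : Vector A n) v i →
  insertAt f (fromℕ n) v (inject₁ i) ≡ f i
insertAt-inject₁ f v Fin.zero    = ≡.refl
insertAt-inject₁ f v (Fin.suc i) = insertAt-inject₁ (f ∘ Fin.suc) v i

sum-replicate-0 : ∀ n → Vec.sum (replicate n 0) ≡ 0
sum-replicate-0 zero    = ≡.refl
sum-replicate-0 (suc n) = sum-replicate-0 n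

sum-unit : ∀ {n} (i : Fin n) → Vec.sum (updateAt (replicate n 0) i suc) ≡ 1
sum-unit {suc n} Fin.zero    = ≡.cong suc (sum-replicate-0 n)
sum-unit {suc n} (Fin.suc i) = sum-unit i

-- Records how P is written in the pₖ(x‖a) over Q[a], where pₖ has weight k and d bounds the weight.
-- It is kept as data because `twist` is defined by recursion on it.
data Generated : ℕ → Λ → Set where
  constant  : ∀ r → Generated 0 (constΛ r)
  generator : ∀ k → Generated (suc k) (doublePowerSum (suc k))
  _⟨+⟩_     : ∀ {d P Q} → Generated d P → Generated d Q → Generated d (P +Λ Q)
  _⟨*⟩_     : ∀ {d e P Q} → Generated d P → Generated e Q → Generated (d ℕ.+ e) (P *Λ Q)
  weaken    : ∀ {d e P} → d ≤ e → Generated d P → Generated e P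

generated-degree : ∀ {d P} → Generated d P → ∀ n → TotalDegree≤ d (at P n)
generated-degree (constant r) n = con r , ≋-refl , z≤n
generated-degree (generator k) n = proj₂ (Λ.bounded (doublePowerSum (suc k))) n
generated-degree (g ⟨+⟩ h) n =
  let (p , p≋ , dp) = generated-degree g n
      (q , q≋ , dq) = generated-degree h n
  in p ⊕ q , ⊕-cong p≋ q≋ , ℕ.⊔-lub dp dq
generated-degree (g ⟨*⟩ h) n =
  let (p , p≋ , dp) = generated-degree g n
      (q , q≋ , dq) = generated-degree h n
  in p ⊛ q , ⊛-cong p≋ q≋ , ℕ.+-mono-≤ dp dq
generated-degree (weaken d≤e g) n =
  let (p , p≋ , dp) = generated-degree g n in p , p≋ , ℕ.≤-trans dp d≤e

module FiniteLevel (n : ℕ) where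

  private module Sₙ = CommutativeRing (ℚ[a][x] n)
  open RingOperations (ℚ[a][x] n) using (sum; _^_)
  open MonomialSums (ℚ[a][x] n)
  open SemiringSum Sₙ.semiring using (∑-distrib-+)
  open Determinant (ℚ[a][x] n) using (∑-cong)
  open IntegerSolver (ℚ[a][x] n)
  open import Relation.Binary.Reasoning.Setoid Sₙ.setoid

  -- A polynomial in n variables together with a generated lift to Λ. The other levels of the lift
  -- are controlled only afterwards, by the degree bound.
  GeneratedAt : ℕ → Polyₓ n → Set
  GeneratedAt d p = ∃[ Q ] Generated d Q × at Q n ≋ p

  gen-≋ : ∀ {d p q} → p ≋ q → GeneratedAt d p → GeneratedAt d q
  gen-≋ p≋q (P , g , e) = P , g , ≋-trans e p≋q

  gen-≤ : ∀ {d e p} → d ≤ e → GeneratedAt d p → GeneratedAt e p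
  gen-≤ d≤e (P , g , e) = P , weaken d≤e g , e

  gen-con : ∀ d r → GeneratedAt d (con r)
  gen-con d r = constΛ r , weaken z≤n (constant r) , ≋-refl

  gen-+ : ∀ {d p q} → GeneratedAt d p → GeneratedAt d q → GeneratedAt d (p ⊕ q)
  gen-+ (P , g , e) (Q , h , f) = P +Λ Q , g ⟨+⟩ h , ⊕-cong e f

  gen-* : ∀ {d d′ p q} → GeneratedAt d p → GeneratedAt d′ q → GeneratedAt (d ℕ.+ d′) (p ⊛ q)
  gen-* (P , g , e) (Q , h , f) = P *Λ Q , g ⟨*⟩ h , ⊛-cong e f

  gen-scale : ∀ {d p} r → GeneratedAt d p → GeneratedAt d (con r ⊛ p)
  gen-scale r g = gen-* (gen-con 0 r) g

  gen-neg : ∀ {d p} → GeneratedAt d p → GeneratedAt d (⊝ p)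
  gen-neg {p = p} g = gen-≋ (≋-trans (Sₙ.*-congʳ (Hom.-‿homo (conHom ℚ[a]-ring (Fin n)) 𝔸.1#))
    (≋-trans (≋-sym (RingProperties.-‿distribˡ-* Sₙ.ring _ p)) (⊝-cong (Sₙ.*-identityˡ p)))) (gen-scale (⊝ 𝔸.1#) g)

  gen-sum : ∀ {d m} (t : Fin m → Polyₓ n) → (∀ i → GeneratedAt d (t i)) → GeneratedAt d (sum t)
  gen-sum {d} {zero}  t g = gen-con d _
  gen-sum {d} {suc m} t g = gen-+ (g Fin.zero) (gen-sum (t ∘ Fin.suc) (g ∘ Fin.suc))

  gen-powers : ∀ k → GeneratedAt k (powers var k)
  gen-powers zero    = gen-≋ (C.sum-homo {n} (λ _ → 𝔸.1#)) (gen-con 0 _)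
    where module C = Hom (conHom ℚ[a]-ring (Fin n))
  -- The ordinary power sum exceeds the double one by the sum of the powers of a₁, ..., aₙ. This
  -- constant depends on n, so the lift is tied to the level.
  gen-powers (suc k) = doublePowerSum (suc k) +Λ constΛ r , generator k ⟨+⟩ weaken z≤n (constant r) , (begin
    sum (λ i → var i ^ suc k ⊕ ⊝ aᵢ i) ⊕ con r
      ≈⟨ Sₙ.+-congˡ (≋-trans (C.sum-homo {n} (λ i → a (+ suc (toℕ i)) ^ₐ suc k)) (∑-cong {n} _ _ λ i → C.^-homo (a (+ suc (toℕ i))) (suc k))) ⟩
    sum (λ i → var i ^ suc k ⊕ ⊝ aᵢ i) ⊕ sum aᵢ
      ≈⟨ ∑-distrib-+ {n} (λ i → var i ^ suc k ⊕ ⊝ aᵢ i) aᵢ ⟨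
    sum (λ i → (var i ^ suc k ⊕ ⊝ aᵢ i) ⊕ aᵢ i)
      ≈⟨ ∑-cong {n} _ _ (λ i → solve 2 (λ x y → (x :- y) :+ y := x) ≋-refl (var i ^ suc k) (aᵢ i)) ⟩
    powers var (suc k) ∎)
    where
    module C = Hom (conHom ℚ[a]-ring (Fin n))
    open RingOperations ℚ[a]-ring using () renaming (sum to sumₐ; _^_ to _^ₐ_)
    aᵢ : Fin n → Polyₓ n
    aᵢ i = con (a (+ suc (toℕ i))) ^ suc k
    r : ℚ[a]
    r = sumₐ λ (i : Fin n) → a (+ suc (toℕ i)) ^ₐ suc k

  -- Solving `powers-*-monomialSum` for its first summand reduces r + 1 exponents to r of them, with
  -- the same total degree.
  gen-monomialSum : ∀ {r} (K : Vec ℕ r) → GeneratedAt (Vec.sum K) (monomialSum var K)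
  gen-monomialSum {zero}  [] = gen-con 0 _
  gen-monomialSum {suc r} K with initLast K
  ... | K₀ , k , ≡.refl = gen-≤ (ℕ.≤-reflexive (≡.sym (sum-∷ʳ K₀ k))) (gen-≋ difference′
    (gen-+ (gen-* (gen-powers k) (gen-monomialSum K₀)) (gen-neg (gen-sum bumped λ j →
      gen-≤ (ℕ.≤-reflexive (sum-updateAt K₀ j k)) (gen-monomialSum (updateAt K₀ j (k ℕ.+_)))))))
    where
    bumped : Fin r → Polyₓ n
    bumped j = monomialSum var (updateAt K₀ j (k ℕ.+_))
    difference′ : powers var k ⊛ monomialSum var K₀ ⊕ ⊝ sum bumped ≋ monomialSum var (K₀ ∷ʳ k)
    difference′ = ≋-trans (Sₙ.+-congʳ (powers-*-monomialSum var k K₀))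
      (solve 2 (λ x y → (x :+ y) :- y := x) ≋-refl (monomialSum var (K₀ ∷ʳ k)) (sum bumped))

  -- Here v stands for the variables when averaging, and for the differences xᵢ - a with a fixed a
  -- when testing what happens at xᵢ = a.
  data Span (v : Fin n → Polyₓ n) (Q : Vec ℕ n → Set) : Polyₓ n → Set where
    s-term : ∀ r e → Q e → Span v Q (con r ⊛ monomial v e)
    s-0    : Span v Q Sₙ.0#
    s-+    : ∀ {p q} → Span v Q p → Span v Q q → Span v Q (p ⊕ q)
    s-≋    : ∀ {p q} → p ≋ q → Span v Q p → Span v Q q

  module _ {v : Fin n → Polyₓ n} where

    span-map : ∀ {Q Q′ p} → (∀ e → Q e → Q′ e) → Span v Q p → Span v Q′ p
    span-map f (s-term r e q) = s-term r e (f e q)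
    span-map f s-0          = s-0
    span-map f (s-+ s t)    = s-+ (span-map f s) (span-map f t)
    span-map f (s-≋ e s)    = s-≋ e (span-map f s)

    span-neg : ∀ {Q p} → Span v Q p → Span v Q (⊝ p)
    span-neg (s-term r e q) = s-≋ (≋-trans (Sₙ.*-congʳ (Hom.-‿homo (conHom ℚ[a]-ring (Fin n)) r))
      (≋-sym (RingProperties.-‿distribˡ-* Sₙ.ring _ _))) (s-term (⊝ r) e q)
    span-neg s-0 = s-≋ (≋-sym (RingProperties.-0#≈0# Sₙ.ring)) s-0
    span-neg (s-+ {p} {q} s t) = s-≋ (solve 2 (λ x y → :- x :+ :- y := :- (x :+ y)) ≋-refl p q) (s-+ (span-neg s) (span-neg t))
    span-neg (s-≋ e s) = s-≋ (⊝-cong e) (span-neg s)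

    span-* : ∀ {d d′ p q} → Span v (λ e → Vec.sum e ≤ d) p → Span v (λ e → Vec.sum e ≤ d′) q →
      Span v (λ e → Vec.sum e ≤ d ℕ.+ d′) (p ⊛ q)
    span-* s-0 t = s-≋ (≋-sym (Sₙ.zeroˡ _)) s-0
    span-* (s-+ s s′) t = s-≋ (≋-sym (Sₙ.distribʳ _ _ _)) (s-+ (span-* s t) (span-* s′ t))
    span-* (s-≋ e s) t = s-≋ (Sₙ.*-congʳ e) (span-* s t)
    span-* (s-term r e q) s-0 = s-≋ (≋-sym (Sₙ.zeroʳ _)) s-0
    span-* (s-term r e q) (s-+ t t′) = s-≋ (≋-sym (Sₙ.distribˡ _ _ _)) (s-+ (span-* (s-term r e q) t) (span-* (s-term r e q) t′))
    span-* (s-term r e q) (s-≋ p≋q t) = s-≋ (Sₙ.*-congˡ p≋q) (span-* (s-term r e q) t)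
    span-* (s-term r e q) (s-term r′ e′ q′) = s-≋
      (≋-trans (⊛-cong (con-* r r′) (≋-sym (monomial-* v e e′)))
        (solve 4 (λ r r′ m m′ → (r :* r′) :* (m :* m′) := (r :* m) :* (r′ :* m′)) ≋-refl (con r) (con r′) _ _))
      (s-term (r 𝔸.* r′) (zipWith ℕ._+_ e e′) (≡.subst (_≤ _) (≡.sym (sum-zipWith-+ e e′)) (ℕ.+-mono-≤ q q′)))

    span-con : ∀ d r → Span v (λ e → Vec.sum e ≤ d) (con r)
    span-con d r = s-≋ (≋-trans (Sₙ.*-congˡ (monomial-replicate-0 v)) (Sₙ.*-identityʳ _))
      (s-term r (replicate n 0) (≡.subst (_≤ d) (≡.sym (sum-replicate-0 n)) z≤n))

    module _ (c : ℚ[a]) (translate : ∀ i → v i ⊕ con c ≋ var i) where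

      span-degree : ∀ {d} p → degree p ≤ d → Span v (λ e → Vec.sum e ≤ d) p
      span-degree {d} (con r) _ = span-con d r
      span-degree {d} (var i) 1≤d = s-≋ (translate i)
        (s-+ (s-≋ (≋-trans (Sₙ.*-identityˡ _) (monomial-unit v i)) (s-term 𝔸.1# (updateAt (replicate n 0) i suc) (≡.subst (_≤ d) (≡.sym (sum-unit i)) 1≤d)))
             (span-con d c))
      span-degree (p ⊕ q) l = s-+ (span-degree p (ℕ.m⊔n≤o⇒m≤o _ _ l)) (span-degree q (ℕ.m⊔n≤o⇒n≤o _ _ l))
      span-degree (p ⊛ q) l = span-map (λ _ h → ℕ.≤-trans h l) (span-* (span-degree p ℕ.≤-refl) (span-degree q ℕ.≤-refl))
      span-degree (⊝ p) l = span-neg (span-degree p l)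

    -- As h fixes the monomials without vᵢ and kills the others, p - h p consists of the terms in
    -- which vᵢ occurs. When h p = 0, this sharpens the description of p itself.
    span-refine : ∀ {Q} (h : Hom (ℚ[a][x] n) (ℚ[a][x] n)) i → (∀ r → Hom.⟦_⟧ h (con r) ≋ con r) →
      (∀ j → j ≢ i → Hom.⟦_⟧ h (v j) ≋ v j) → Hom.⟦_⟧ h (v i) ≋ Sₙ.0# →
      ∀ {p} → Span v Q p → Span v (λ e → Q e × 0 < lookup e i) (p ⊕ ⊝ Hom.⟦_⟧ h p)
    span-refine h i h-con h-≢ h-≡ s-0 = s-≋ (≋-trans (≋-sym (Sₙ.-‿inverseʳ _)) (Sₙ.+-congˡ (⊝-cong (≋-sym (Hom.0-homo h))))) s-0
    span-refine h i h-con h-≢ h-≡ (s-+ {p} {q} s t) = s-≋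
      (≋-trans (solve 4 (λ p q p′ q′ → (p :- p′) :+ (q :- q′) := (p :+ q) :- (p′ :+ q′)) ≋-refl p q _ _)
        (Sₙ.+-congˡ (⊝-cong (≋-sym (Hom.+-homo h p q)))))
      (s-+ (span-refine h i h-con h-≢ h-≡ s) (span-refine h i h-con h-≢ h-≡ t))
    span-refine h i h-con h-≢ h-≡ (s-≋ e s) = s-≋ (⊕-cong e (⊝-cong (Hom.⟦⟧-cong h e))) (span-refine h i h-con h-≢ h-≡ s)
    span-refine h i h-con h-≢ h-≡ (s-term r e q) with lookup e i in eq
    ... | zero = s-≋ (≋-sym (≋-trans (Sₙ.+-congˡ (⊝-cong (≋-trans h-term (Sₙ.*-congˡ
            (≋-sym (monomial-absent v (Hom.⟦_⟧ h ∘ v) e i (λ j j≢i → ≋-sym (h-≢ j j≢i)) eq)))))) (Sₙ.-‿inverseʳ _))) s-0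
      where
      h-term : Hom.⟦_⟧ h (con r ⊛ monomial v e) ≋ con r ⊛ monomial (Hom.⟦_⟧ h ∘ v) e
      h-term = ≋-trans (Hom.*-homo h _ _) (⊛-cong (h-con r) (monomial-homo h v e))
    ... | suc k = s-≋ (≋-sym (≋-trans (Sₙ.+-congˡ (≋-trans (⊝-cong (≋-trans h-term (≋-trans (Sₙ.*-congˡ
            (monomial-zero (Hom.⟦_⟧ h ∘ v) e i h-≡ 0<)) (Sₙ.zeroʳ _)))) (RingProperties.-0#≈0# Sₙ.ring))) (Sₙ.+-identityʳ _)))
            (s-term r e (q , 0<))
      where
      0< : 0 < lookup e i
      0< = ≡.subst (0 <_) (≡.sym eq) (s≤s z≤n)
      h-term : Hom.⟦_⟧ h (con r ⊛ monomial v e) ≋ con r ⊛ monomial (Hom.⟦_⟧ h ∘ v) e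
      h-term = ≋-trans (Hom.*-homo h _ _) (⊛-cong (h-con r) (monomial-homo h v e))

    span-⊥ : ∀ {Q p} → (∀ e → ¬ Q e) → Span v Q p → p ≋ Sₙ.0#
    span-⊥ ¬Q (s-term r e q) = contradiction q (¬Q e)
    span-⊥ ¬Q s-0 = ≋-refl
    span-⊥ ¬Q (s-+ s t) = ≋-trans (⊕-cong (span-⊥ ¬Q s) (span-⊥ ¬Q t)) (Sₙ.+-identityˡ _)
    span-⊥ ¬Q (s-≋ e s) = ≋-trans (≋-sym e) (span-⊥ ¬Q s)

  gen-symmetrized : ∀ {d p} → Span var (λ e → Vec.sum e ≤ d) p →
    GeneratedAt d (sumPermutations n λ σ → rename (σ ⟨$⟩ʳ_) p)
  gen-symmetrized (s-term r e l) = gen-≋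
    (≋-sym (≋-trans (sumPermutations-cong n _ _ λ σ → Sₙ.*-congˡ (monomial-homo (substituteHom (var ∘ (σ ⟨$⟩ʳ_))) var e))
      (≋-trans (sumPermutations-* n (con r) (λ σ → monomial (var ∘ (σ ⟨$⟩ʳ_)) e))
        (Sₙ.*-congˡ (sumPermutations-monomial n var e)))))
    (gen-scale r (gen-≤ l (gen-monomialSum e)))
  gen-symmetrized {d} s-0 = gen-≋ (≋-sym (≋-trans
      (sumPermutations-cong n _ (λ _ → Sₙ.0# ⊛ Sₙ.0#) (λ _ → ≋-sym (Sₙ.zeroˡ _)))
      (≋-trans (sumPermutations-* n Sₙ.0# (λ _ → Sₙ.0#)) (Sₙ.zeroˡ _)))) (gen-con d _)
  gen-symmetrized (s-+ {p} {q} s t) = gen-≋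
    (≋-sym (sumPermutations-+ n (λ σ → rename (σ ⟨$⟩ʳ_) p) (λ σ → rename (σ ⟨$⟩ʳ_) q)))
    (gen-+ (gen-symmetrized s) (gen-symmetrized t))
  gen-symmetrized (s-≋ e s) = gen-≋ (sumPermutations-cong n _ _ λ σ → substitute-cong (var ∘ (σ ⟨$⟩ʳ_)) e) (gen-symmetrized s)

  -- A symmetric polynomial is its own average over all permutations, and a monomial summed over all
  -- permutations is a `monomialSum`.
  gen-symmetric : ∀ {d p} → Symmetric p → TotalDegree≤ d p → GeneratedAt d p
  gen-symmetric {d} {p} symmetric (q , q≋p , dq) = gen-≋
    (≋-trans (Sₙ.*-congˡ (sumPermutations-cong n _ (λ _ → p) symmetric)) (proj₂ (sumPermutations-const h n p)))
    (gen-scale _ (gen-symmetrized (s-≋ q≋p (span-degree (con 0ℚ) (λ i → Sₙ.+-identityʳ _) q dq))))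
    where
    h : Hom ℚ-ring (ℚ[a][x] n)
    h = conHom ℚ[a]-ring (Fin n) ∘ʰ conHom ℚ-ring ℤ

-- P vanishes when its last indeterminate is set to aₙ₊₁, hence, by symmetry,
-- when any of them is; so every monomial in the differences xᵢ − aₙ₊₁ that
-- occurs in P involves all n + 1 of them, contradicting the degree bound.
vanishing-lifts : ∀ P {d} n → TotalDegree≤ d (at P (suc n)) → d ≤ n → at P n ≋ con 𝔸.0# → at P (suc n) ≋ con 𝔸.0#
vanishing-lifts P {d} n (q , q≋ , dq) d≤n vanishes =
  span-⊥ impossible (refine (suc n) ℕ.≤-refl)
  where
  open FiniteLevel (suc n)
  module S = CommutativeRing (ℚ[a][x] (suc n))
  p = at P (suc n)
  r = a (+ suc n)
  v : Fin (suc n) → Polyₓ (suc n)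
  v i = var i ⊕ ⊝ con r

  specialize : Fin (suc n) → Fin (suc n) → Polyₓ (suc n)
  specialize i j = if does (j Fin.≟ i) then con r else var j

  specialize-≡ : ∀ i → specialize i i ≡ con r
  specialize-≡ i rewrite dec-true (i Fin.≟ i) ≡.refl = ≡.refl

  specialize-≢ : ∀ i {j} → j ≢ i → specialize i j ≡ var j
  specialize-≢ i {j} j≢i rewrite dec-false (j Fin.≟ i) j≢i = ≡.refl

  specialized-0 : ∀ i → substitute (specialize i) p ≋ S.0#
  specialized-0 i = ≋-trans (≋-sym (substitute-cong (specialize i) (Λ.symmetric P (suc n) σ)))
    (≋-trans (homs-agree (substituteHom (specialize i) ∘ʰ substituteHom (var ∘ (σ ⟨$⟩ʳ_)))
               (substituteHom g ∘ʰ substituteHom (insertAt var (fromℕ n) (con r))) (λ _ → ≋-refl) on-var p)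
      (substitute-cong g (≋-trans (Λ.stable P n) vanishes)))
    where
    -- Exchanging xᵢ with the last variable makes setting xᵢ to aₙ₊₁ factor through `setLast`.
    σ : Permutation′ (suc n)
    σ = Perm.transpose (fromℕ n) i
    σ-last : σ ⟨$⟩ʳ fromℕ n ≡ i
    σ-last rewrite dec-true (fromℕ n Fin.≟ fromℕ n) ≡.refl = ≡.refl
    g : Fin n → Polyₓ (suc n)
    g j = specialize i (σ ⟨$⟩ʳ inject₁ j)
    on-var : ∀ j → specialize i (σ ⟨$⟩ʳ j) ≋ substitute g (insertAt var (fromℕ n) (con r) j)
    on-var j with view j
    ... | ‵fromℕ = S.reflexive (≡.trans (≡.trans (≡.cong (specialize i) σ-last) (specialize-≡ i))
            (≡.sym (≡.cong (substitute g) (insertAt-lookup var (fromℕ n) (con r)))))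
    ... | ‵inject₁ j = S.reflexive (≡.sym (≡.cong (substitute g) (insertAt-inject₁ var (con r) j)))

  refine : ∀ k → k ≤ suc n → Span v (λ e → Vec.sum e ≤ d × ∀ i → toℕ i < k → 0 < lookup e i) p
  refine zero    _   = span-map (λ _ l → l , λ _ ()) (s-≋ q≋ (span-degree r translate q dq))
    where
    open IntegerSolver (ℚ[a][x] (suc n))
    translate : ∀ i → v i ⊕ con r ≋ var i
    translate i = solve 2 (λ x y → (x :- y) :+ y := x) ≋-refl (var i) (con r)
  refine (suc k) k<n = span-map extend (s-≋ unchanged
    (span-refine (substituteHom (specialize i)) i (λ _ → ≋-refl)
      (λ j j≢i → S.+-congʳ (S.reflexive (specialize-≢ i j≢i)))
      (≋-trans (S.+-congʳ (S.reflexive (specialize-≡ i))) (S.-‿inverseʳ _))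
      (refine k (ℕ.<⇒≤ k<n))))
    where
    i = Fin.fromℕ< k<n
    unchanged : p ⊕ ⊝ substitute (specialize i) p ≋ p
    unchanged = ≋-trans (S.+-congˡ (≋-trans (⊝-cong (specialized-0 i)) (RingProperties.-0#≈0# S.ring))) (S.+-identityʳ p)
    extend : ∀ e → (Vec.sum e ≤ d × (∀ i → toℕ i < k → 0 < lookup e i)) × 0 < lookup e i →
      Vec.sum e ≤ d × (∀ i → toℕ i < suc k → 0 < lookup e i)
    extend e ((l , below) , at-i) = l , λ j j≤k → case (ℕ.m≤n⇒m<n∨m≡n (ℕ.≤-pred j≤k))
      where
      case : ∀ {j : Fin (suc n)} → toℕ j < k ⊎ toℕ j ≡ k → 0 < lookup e j
      case {j} (inj₁ j<k) = below j j<k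
      case {j} (inj₂ j≡k) = ≡.subst (λ j → 0 < lookup e j)
        (Fin.toℕ-injective (≡.trans (Fin.toℕ-fromℕ< k<n) (≡.sym j≡k))) at-i

  impossible : ∀ (e : Vec ℕ (suc n)) → ¬ (Vec.sum e ≤ d × (∀ i → toℕ i < suc n → 0 < lookup e i))
  impossible e (l , positive) = ℕ.<⇒≱ (s≤s d≤n) (ℕ.≤-trans (length≤sum e λ i → positive i (Fin.toℕ<n i)) l)
    where
    length≤sum : ∀ {m} (e : Vec ℕ m) → (∀ i → 0 < lookup e i) → m ≤ Vec.sum e
    length≤sum []      _ = z≤n
    length≤sum (k ∷ e) h = ℕ.+-mono-≤ (h Fin.zero) (length≤sum e (h ∘ Fin.suc))

-- Q is chosen to agree with P in d variables, where d bounds the degree of P. The difference has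
-- degree at most d and vanishes at level d; `vanishing-lifts` carries this to all n ≥ d, and
-- stability to all n ≤ d.
generated : ∀ P → ∃[ d ] ∃[ Q ] Generated d Q × Q ≈Λ P
generated P = d , Q , Q-generated , λ n → difference-0 n (vanish n)
  where
  d = proj₁ (Λ.bounded P)
  at-d = FiniteLevel.gen-symmetric d (Λ.symmetric P d) (proj₂ (Λ.bounded P) d)
  Q = proj₁ at-d
  Q-generated = proj₁ (proj₂ at-d)
  D = Q +Λ -Λ P
  difference-0 : ∀ n → at D n ≋ con 𝔸.0# → at Q n ≋ at P n
  difference-0 n e = ≋-trans (solve 2 (λ x y → x := (x :- y) :+ y) ≋-refl (at Q n) (at P n)) (≋-trans (⊕-cong e ≋-refl) (⊕-identityˡ _))
    where open IntegerSolver (ℚ[a][x] n)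
  degree-D : ∀ n → TotalDegree≤ d (at D n)
  degree-D n =
    let (q , q≋ , dq) = generated-degree Q-generated n
        (p , p≋ , dp) = proj₂ (Λ.bounded P) n
    in q ⊕ ⊝ p , ⊕-cong q≋ (⊝-cong p≋) , ℕ.⊔-lub dq dp
  above : ∀ k → at D (k ℕ.+ d) ≋ con 𝔸.0#
  above zero    = ≋-trans (⊕-cong (proj₂ (proj₂ at-d)) ≋-refl) (CommutativeRing.-‿inverseʳ (ℚ[a][x] d) _)
  above (suc k) = vanishing-lifts D (k ℕ.+ d) (degree-D (suc (k ℕ.+ d))) (ℕ.m≤n+m d k) (above k)
  below : ∀ k n → n ℕ.+ k ≡ d → at D n ≋ con 𝔸.0#
  below zero    n e rewrite ≡.trans (≡.sym (ℕ.+-identityʳ n)) e = above 0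
  below (suc k) n e = ≋-trans (≋-sym (Λ.stable D n))
    (substitute-cong (insertAt var (fromℕ n) (con (a (+ suc n)))) (below k (suc n) (≡.trans (≡.sym (ℕ.+-suc n k)) e)))
  vanish : ∀ n → at D n ≋ con 𝔸.0#
  vanish n with ℕ.≤-total d n
  ... | inj₁ d≤n = ≡.subst (λ n → at D n ≋ con 𝔸.0#) (ℕ.m∸n+n≡m d≤n) (above (n ∸ d))
  ... | inj₂ n≤d = below (d ∸ n) n (ℕ.m+[n∸m]≡n n≤d)

-- Values at the points a_μ

open RingOperations ℚ[a]-ring using (sum; product; _^_; det)
module Det = Determinant ℚ[a]-ring
open SemiringSum 𝔸.semiring using (∑-comm; *-distribˡ-sum; *-distribʳ-sum; sum-remove)
open Det using (∑-cong; sum-zero)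
open IntegerSolver ℚ[a]-ring
open import Relation.Binary.Reasoning.Setoid 𝔸.setoid

sum-single : ∀ {n} (t : Fin n → ℚ[a]) i → (∀ j → j ≢ i → t j ≋ 𝔸.0#) → sum t ≋ t i
sum-single {suc n} t i z = ≋-trans (sum-remove {i = i} t)
  (≋-trans (𝔸.+-congˡ (sum-zero (removeAt t i) λ j → z (punchIn i j) (Fin.punchInᵢ≢i i j)))
    (𝔸.+-identityʳ _))

∑-sub : ∀ {n} (t u : Fin n → ℚ[a]) → sum t ⊕ ⊝ sum u ≋ sum (λ i → t i ⊕ ⊝ u i)
∑-sub {zero}  t u = 𝔸.-‿inverseʳ _
∑-sub {suc n} t u = ≋-trans
  (solve 4 (λ t ts u us → (t :+ ts) :- (u :+ us) := (t :- u) :+ (ts :- us)) ≋-refl (t Fin.zero) _ (u Fin.zero) _)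
  (𝔸.+-congˡ (∑-sub (t ∘ Fin.suc) (u ∘ Fin.suc)))

product-zero : ∀ {n} (t : Fin n → ℚ[a]) i → t i ≋ 𝔸.0# → product t ≋ 𝔸.0#
product-zero t Fin.zero    e = ≋-trans (𝔸.*-congʳ e) (𝔸.zeroˡ _)
product-zero t (Fin.suc i) e = ≋-trans (𝔸.*-congˡ (product-zero (t ∘ Fin.suc) i e)) (𝔸.zeroʳ _)

index : Partition → ℕ → ℤ
index μ i = suc i ⊖ part μ i

-- The point a_μ = (a_{1 − μ₁}, a_{2 − μ₂}, …).
point : Partition → ℕ → ℚ[a]
point μ i = a (index μ i)

evaluateAt : ∀ n → Partition → Hom (ℚ[a][x] n) ℚ[a]-ring
evaluateAt n μ = evaluateHom (id-hom ℚ[a]-ring) (point μ ∘ toℕ)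

value : Λ → Partition → ℚ[a]
value P μ = Hom.⟦_⟧ (evaluateAt (ℓength μ) μ) (at P (ℓength μ))

-- Beyond the length of μ the next coordinate of a_μ is aₙ₊₁, which is what stability substitutes
-- for the last variable.
evaluateAt-stable : ∀ P μ {n} → ℓength μ ≤ n →
  Hom.⟦_⟧ (evaluateAt (suc n) μ) (at P (suc n)) ≋ Hom.⟦_⟧ (evaluateAt n μ) (at P n)
evaluateAt-stable P μ {n} ℓ≤n = ≋-trans
  (homs-agree (evaluateAt (suc n) μ) (evaluateAt n μ ∘ʰ substituteHom last) (λ _ → ≋-refl) on-var (at P (suc n)))
  (Hom.⟦⟧-cong (evaluateAt n μ) (Λ.stable P n))
  where
  last : Fin (suc n) → Polyₓ n
  last = insertAt var (fromℕ n) (con (a (+ suc n)))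
  on-var : ∀ i → point μ (toℕ i) ≋ Hom.⟦_⟧ (evaluateAt n μ) (last i)
  on-var i with view i
  ... | ‵fromℕ = 𝔸.reflexive (≡.trans
    (≡.trans (≡.cong (point μ) (toℕ-fromℕ n)) (≡.cong (λ p → a (suc n ⊖ p)) (part-≥ℓ μ ℓ≤n)))
    (≡.sym (≡.cong (Hom.⟦_⟧ (evaluateAt n μ)) (insertAt-lookup var (fromℕ n) (con (a (+ suc n)))))))
  ... | ‵inject₁ j = 𝔸.reflexive (≡.trans (≡.cong (point μ) (toℕ-inject₁ j))
    (≡.sym (≡.cong (Hom.⟦_⟧ (evaluateAt n μ)) (insertAt-inject₁ var (con (a (+ suc n))) j))))

value-at : ∀ P μ {n} → ℓength μ ≤ n → value P μ ≋ Hom.⟦_⟧ (evaluateAt n μ) (at P n)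
value-at P μ {n} ℓ≤n = ≡.subst (λ n → value P μ ≋ Hom.⟦_⟧ (evaluateAt n μ) (at P n)) (ℕ.m∸n+n≡m ℓ≤n) (lemma (n ∸ ℓength μ))
  where
  lemma : ∀ d → value P μ ≋ Hom.⟦_⟧ (evaluateAt (d ℕ.+ ℓength μ) μ) (at P (d ℕ.+ ℓength μ))
  lemma zero    = ≋-refl
  lemma (suc d) = ≋-trans (lemma d) (≋-sym (evaluateAt-stable P μ (ℕ.m≤n+m _ d)))

valueHom : Partition → Hom Λ-ring ℚ[a]-ring
valueHom μ = record
  { ⟦_⟧ = λ P → value P μ
  ; ⟦⟧-cong = λ e → Hom.⟦⟧-cong (evaluateAt (ℓength μ) μ) (e (ℓength μ))
  ; +-homo = λ _ _ → ≋-refl ; *-homo = λ _ _ → ≋-refl ; 1-homo = ≋-refl }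

at-a′Hom : Hom ℚ[a]-ring ℚ[a]-ring
at-a′Hom = substituteHom a′

-- Power sums at a_μ and conjugation

value-powerSum : ∀ k μ {n} → ℓength μ ≤ n →
  value (doublePowerSum k) μ ≋ sum λ (i : Fin n) → point μ (toℕ i) ^ k ⊕ ⊝ (a (+ suc (toℕ i)) ^ k)
value-powerSum k μ {n} ℓ≤n = ≋-trans (value-at (doublePowerSum k) μ ℓ≤n)
  (≋-trans (E.sum-homo {n} term) (∑-cong (E.⟦_⟧ ∘ term) _ λ i →
    ⊕-cong (E.^-homo (var i) k) (⊝-cong (E.^-homo (con (a (+ suc (toℕ i)))) k))))
  where
  module E = Hom (evaluateAt n μ)
  open RingOperations (ℚ[a][x] n) using () renaming (_^_ to _^ₓ_)
  term : Fin n → Polyₓ n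
  term i = var i ^ₓ k ⊕ ⊝ (con (a (+ suc (toℕ i))) ^ₓ k)

private
  telescope : ∀ (g : ℕ → ℚ[a]) m r → r ≤ m →
    (sum λ (j : Fin m) → if does (toℕ j ℕ.<? r) then g (suc (toℕ j)) ⊕ ⊝ g (toℕ j) else 𝔸.0#) ≋ g r ⊕ ⊝ g 0
  telescope g zero    zero    _         = 𝔸.sym (𝔸.-‿inverseʳ _)
  telescope g (suc m) zero    _         = ≋-trans (sum-zero {suc m} _ λ _ → ≋-refl) (𝔸.sym (𝔸.-‿inverseʳ _))
  telescope g (suc m) (suc r) (s≤s r≤m) = ≋-trans (𝔸.+-congˡ (telescope (g ∘ suc) m r r≤m))
    (solve 3 (λ x y z → (y :- x) :+ (z :- y) := z :- x) ≋-refl (g 0) (g 1) (g (suc r)))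

  -- Each row of the power sum at a_μ telescopes into one term per box, which depends only on the
  -- content i - j. On the diagram, conjugation is the exchange of i and j.
  boxTerm : ℕ → Partition → ℕ → ℕ → ℚ[a]
  boxTerm k μ i j = if does (j ℕ.<? part μ i) then a (suc i ⊖ suc j) ^ k ⊕ ⊝ (a (suc i ⊖ j) ^ k) else 𝔸.0#

  value-powerSum-boxes : ∀ k μ {n m} → ℓength μ ≤ n → part μ 0 ≤ m →
    value (doublePowerSum k) μ ≋ sum λ (i : Fin n) → sum λ (j : Fin m) → boxTerm k μ (toℕ i) (toℕ j)
  value-powerSum-boxes k μ {n} {m} ℓ≤n p≤m = ≋-trans (value-powerSum k μ ℓ≤n) (∑-cong {n} _ _ λ i →
    ≋-sym (telescope (λ l → a (suc (toℕ i) ⊖ l) ^ k) m (part μ (toℕ i))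
      (ℕ.≤-trans (part-antitone μ {0} {toℕ i} z≤n) p≤m)))

  reflect-index : ∀ i j → ℤ.- (i ⊖ j) ℤ.+ + 1 ≡ suc j ⊖ i
  reflect-index i j = ≡.trans (≡.cong (ℤ._+ + 1) (≡.sym (ℤ.⊖-swap j i)))
    (≡.trans (ℤ.distribˡ-⊖-+-pos 1 j i) (≡.cong (_⊖ i) (ℕ.+-comm j 1)))

  ⊝-^ : ∀ p k → (⊝ p) ^ suc k ≋ ⊝ ((⊝ 𝔸.1#) ^ k ⊛ p ^ suc k)
  ⊝-^ p zero = ≋-trans (≋-sym (RingProperties.-‿distribˡ-* 𝔸.ring p 𝔸.1#)) (⊝-cong (≋-sym (𝔸.*-identityˡ _)))
  ⊝-^ p (suc k) = ≋-trans (𝔸.*-congˡ (⊝-^ p k)) (≋-trans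
    (solve 3 (λ p s q → (:- p) :* :- (s :* q) := :- (:- s :* (p :* q))) ≋-refl p ((⊝ 𝔸.1#) ^ k) (p ^ suc k))
    (⊝-cong (𝔸.*-congʳ (≋-sym (≋-trans (≋-sym (RingProperties.-‿distribˡ-* 𝔸.ring _ _)) (⊝-cong (𝔸.*-identityˡ _)))))))

sign : ℕ → ℚ[a]
sign k = (⊝ 𝔸.1#) ^ k

private
  -- Substituting a′ reflects an index m to 1 - m, which takes the two indices at box (i, j) to
  -- those at box (j, i) in the opposite order. The exchange absorbs one of the k + 1 minus signs.
  boxTerm-ᵗ : ∀ k μ i j → at-a′ (boxTerm (suc k) (μ ᵗ) i j) ≋ sign k ⊛ boxTerm (suc k) μ j i
  boxTerm-ᵗ k μ i j with j ℕ.<? part (μ ᵗ) i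
  ... | no ≮ rewrite dec-false (j ℕ.<? part (μ ᵗ) i) ≮
                   | dec-false (i ℕ.<? part μ j) (λ b → ≮ (box-ᵗ μ b)) = ≋-sym (𝔸.zeroʳ _)
  ... | yes b rewrite dec-true (j ℕ.<? part (μ ᵗ) i) b
                    | dec-true (i ℕ.<? part μ j) (box-ᵗ⁻¹ μ b) = begin
    at-a′ (a (suc i ⊖ suc j) ^ suc k) ⊕ ⊝ at-a′ (a (suc i ⊖ j) ^ suc k)
      ≈⟨ ⊕-cong (T.^-homo (a (suc i ⊖ suc j)) (suc k)) (⊝-cong (T.^-homo (a (suc i ⊖ j)) (suc k))) ⟩
    (a′ (suc i ⊖ suc j)) ^ suc k ⊕ ⊝ (a′ (suc i ⊖ j) ^ suc k)
      ≡⟨ ≡.cong₂ (λ x y → (⊝ a x) ^ suc k ⊕ ⊝ ((⊝ a y) ^ suc k))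
           (≡.trans (reflect-index (suc i) (suc j)) (ℤ.[1+m]⊖[1+n]≡m⊖n (suc j) i)) (reflect-index (suc i) j) ⟩
    (⊝ a (suc j ⊖ i)) ^ suc k ⊕ ⊝ ((⊝ a (suc j ⊖ suc i)) ^ suc k)
      ≈⟨ ⊕-cong (⊝-^ _ k) (⊝-cong (⊝-^ _ k)) ⟩
    ⊝ (sign k ⊛ a (suc j ⊖ i) ^ suc k) ⊕ ⊝ ⊝ (sign k ⊛ a (suc j ⊖ suc i) ^ suc k)
      ≈⟨ solve 3 (λ s x y → :- (s :* x) :- :- (s :* y) := s :* (y :- x)) ≋-refl (sign k) _ _ ⟩
    sign k ⊛ (a (suc j ⊖ suc i) ^ suc k ⊕ ⊝ (a (suc j ⊖ i) ^ suc k)) ∎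
    where module T = Hom at-a′Hom

value-powerSum-ᵗ : ∀ k μ → at-a′ (value (doublePowerSum (suc k)) (μ ᵗ)) ≋ sign k ⊛ value (doublePowerSum (suc k)) μ
value-powerSum-ᵗ k μ = begin
  at-a′ (value (doublePowerSum (suc k)) (μ ᵗ))
    ≈⟨ T.⟦⟧-cong (value-powerSum-boxes (suc k) (μ ᵗ) (ℕ.m≤m⊔n (ℓength (μ ᵗ)) (part μ 0)) (ℕ.m≤n⊔m (ℓength μ) (part (μ ᵗ) 0))) ⟩
  at-a′ (sum λ (i : Fin m) → sum λ (j : Fin n) → boxTerm (suc k) (μ ᵗ) (toℕ i) (toℕ j))
    ≈⟨ ≋-trans (T.sum-homo {m} (λ i → sum λ (j : Fin n) → boxTerm (suc k) (μ ᵗ) (toℕ i) (toℕ j)))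
         (∑-cong {m} _ _ λ i → ≋-trans (T.sum-homo {n} (λ j → boxTerm (suc k) (μ ᵗ) (toℕ i) (toℕ j)))
           (∑-cong {n} _ _ λ j → boxTerm-ᵗ k μ (toℕ i) (toℕ j))) ⟩
  (sum λ (i : Fin m) → sum λ (j : Fin n) → sign k ⊛ boxTerm (suc k) μ (toℕ j) (toℕ i))
    ≈⟨ ∑-comm {m} {n} (λ i j → sign k ⊛ boxTerm (suc k) μ (toℕ j) (toℕ i)) ⟩
  (sum λ (j : Fin n) → sum λ (i : Fin m) → sign k ⊛ boxTerm (suc k) μ (toℕ j) (toℕ i))
    ≈⟨ ≋-trans (*-distribˡ-sum {n} (sign k) (λ j → sum λ (i : Fin m) → boxTerm (suc k) μ (toℕ j) (toℕ i)))
         (∑-cong {n} _ _ λ j → *-distribˡ-sum {m} (sign k) (λ i → boxTerm (suc k) μ (toℕ j) (toℕ i))) ⟨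
  sign k ⊛ (sum λ (j : Fin n) → sum λ (i : Fin m) → boxTerm (suc k) μ (toℕ j) (toℕ i))
    ≈⟨ 𝔸.*-congˡ (value-powerSum-boxes (suc k) μ (ℕ.m≤m⊔n (ℓength μ) (part (μ ᵗ) 0)) (ℕ.m≤n⊔m (ℓength (μ ᵗ)) (part μ 0))) ⟨
  sign k ⊛ value (doublePowerSum (suc k)) μ ∎
  where
  module T = Hom at-a′Hom
  -- Each side bounds a length as well as a first part, so one rectangle serves both diagrams.
  n = ℓength μ ℕ.⊔ part (μ ᵗ) 0
  m = ℓength (μ ᵗ) ℕ.⊔ part μ 0

weight : Partition → ℚ[a]
weight μ = value (doublePowerSum 1) μ

weight-ᵗ : ∀ μ → at-a′ (weight (μ ᵗ)) ≋ weight μ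
weight-ᵗ μ = ≋-trans (value-powerSum-ᵗ 0 μ) (𝔸.*-identityˡ _)

weight-difference : ∀ μ κ {n} → ℓength μ ≤ n → ℓength κ ≤ n →
  weight μ ⊕ ⊝ weight κ ≋ sum λ (i : Fin n) → point μ (toℕ i) ⊕ ⊝ point κ (toℕ i)
weight-difference μ κ {n} ℓμ ℓκ = ≋-trans
  (⊕-cong (value-powerSum 1 μ {n} ℓμ) (⊝-cong (value-powerSum 1 κ {n} ℓκ)))
  (≋-trans (∑-sub {n} _ _) (∑-cong {n} _ _ λ i → ≋-trans
    (solve 4 (λ x y z o → (x :* o :- z :* o) :- (y :* o :- z :* o) := (x :- y) :* o) ≋-refl
      (point μ (toℕ i)) (point κ (toℕ i)) (a (+ suc (toℕ i))) 𝔸.1#)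
    (𝔸.*-identityʳ _)))

⊖-mono-< : ∀ {i j p q} → i < j → q ≤ p → suc i ⊖ p ℤ.< suc j ⊖ q
⊖-mono-< {i} {j} {p} {q} i<j q≤p = ℤ.<-≤-trans (ℤ.⊖-monoˡ-< p (s≤s i<j)) (ℤ.⊖-monoʳ-≥-≤ (suc j) q≤p)

index-mono-< : ∀ μ {i j} → i < j → index μ i ℤ.< index μ j
index-mono-< μ i<j = ⊖-mono-< i<j (part-antitone μ (ℕ.<⇒≤ i<j))

var-difference-regular : ∀ {p q : ℤ} → q ≢ p → Regular ℚ[a]-ring (a p ⊕ ⊝ a q)
var-difference-regular {p} {q} q≢p = DividedDifference.var-free-regular ℤ._≟_ p (a q) q≢p

-- If i is the first row in which μ and κ differ, then a_{i − μᵢ} occurs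
-- exactly once in the difference of the weights.
weight-difference-regular : ∀ μ κ → κ ⊆ₚ μ → κ ≢ μ → Regular ℚ[a]-ring (weight μ ⊕ ⊝ weight κ)
weight-difference-regular μ κ κ⊆μ κ≢μ with difference κ μ
... | inj₁ κ≡μ = contradiction κ≡μ κ≢μ
... | inj₂ (i₀ , below , ≢i₀) = regular-≈ ℚ[a]-ring (≋-sym split) (Dm.var-free-regular free-r)
  where
  N = i₀ ℕ.⊔ (ℓength μ ℕ.⊔ ℓength κ)
  i = Fin.fromℕ< (s≤s (ℕ.m≤m⊔n i₀ (ℓength μ ℕ.⊔ ℓength κ)))
  toℕi : toℕ i ≡ i₀
  toℕi = Fin.toℕ-fromℕ< _
  m = index μ i₀
  t : Fin (suc N) → ℚ[a]
  t j = point μ (toℕ j) ⊕ ⊝ point κ (toℕ j)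
  rest = sum (removeAt t i)
  r = point κ i₀ ⊕ ⊝ rest
  module Dm = DividedDifference {R = ℚ-ring} ℤ._≟_ m r
  split : weight μ ⊕ ⊝ weight κ ≋ a m ⊕ ⊝ r
  split = begin
    weight μ ⊕ ⊝ weight κ
      ≈⟨ weight-difference μ κ {suc N}
           (ℕ.m≤n⇒m≤1+n (ℕ.≤-trans (ℕ.m≤m⊔n (ℓength μ) (ℓength κ)) (ℕ.m≤n⊔m i₀ _)))
           (ℕ.m≤n⇒m≤1+n (ℕ.≤-trans (ℕ.m≤n⊔m (ℓength μ) (ℓength κ)) (ℕ.m≤n⊔m i₀ _))) ⟩
    sum t
      ≈⟨ sum-remove {i = i} t ⟩
    (point μ (toℕ i) ⊕ ⊝ point κ (toℕ i)) ⊕ rest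
      ≡⟨ ≡.cong (λ l → (point μ l ⊕ ⊝ point κ l) ⊕ rest) toℕi ⟩
    (a m ⊕ ⊝ point κ i₀) ⊕ rest
      ≈⟨ solve 3 (λ x y z → (x :- y) :+ z := x :- (y :- z)) ≋-refl (a m) (point κ i₀) rest ⟩
    a m ⊕ ⊝ r ∎
  free-sum : ∀ {n} (u : Fin n → ℚ[a]) → (∀ j → Dm.Free (u j)) → Dm.Free (sum u)
  free-sum {zero}  u f = _
  free-sum {suc n} u f = f Fin.zero , free-sum (u ∘ Fin.suc) (f ∘ Fin.suc)
  free-t : ∀ l → l ≢ i₀ → index μ l ≢ m × index κ l ≢ m
  free-t l l≢i₀ with ℕ.<-cmp l i₀
  ... | tri≈ _ l≡i₀ _ = contradiction l≡i₀ l≢i₀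
  ... | tri< l<i₀ _ _ = μ≢ , ≡.subst (λ p → suc l ⊖ p ≢ m) (≡.sym (below l l<i₀)) μ≢
    where
    μ≢ : index μ l ≢ m
    μ≢ e = ℤ.<-irrefl e (index-mono-< μ l<i₀)
  ... | tri> _ _ i₀<l = (λ e → ℤ.<-irrefl (≡.sym e) (index-mono-< μ i₀<l))
    , (λ e → ℤ.<-irrefl (≡.sym e) (⊖-mono-< i₀<l (ℕ.≤-trans (κ⊆μ l) (part-antitone μ (ℕ.<⇒≤ i₀<l)))))
  free-r : Dm.Free r
  free-r = (λ e → ℤ.<-irrefl (≡.sym e) (ℤ.⊖-monoʳ->-< (suc i₀) (ℕ.≤∧≢⇒< (κ⊆μ i₀) ≢i₀)))
    , free-sum (removeAt t i) λ j →
        free-t (toℕ (punchIn i j)) (λ e → Fin.punchInᵢ≢i i j (Fin.toℕ-injective (≡.trans e (≡.sym toℕi))))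

-- Alternants at the points a_μ

private
  complement : ∀ {n i} p → i < n → n ⊖ (p ℕ.+ (n ∸ suc i)) ≡ suc i ⊖ p
  complement {n} {i} p i<n = ≡.trans
    (≡.cong₂ _⊖_ (≡.sym (ℕ.m∸n+n≡m i<n)) (ℕ.+-comm p (n ∸ suc i)))
    (ℤ.+-cancelˡ-⊖ (n ∸ suc i) (suc i) p)

module AtLevel (n : ℕ) where

  open Det.Factorial (λ m → a (n ⊖ m)) public

  exponent : Partition → Fin n → ℕ
  exponent κ j = part κ (toℕ j) ℕ.+ (n ∸ suc (toℕ j))

  pointₙ : Partition → Fin n → ℚ[a]
  pointₙ μ i = point μ (toℕ i)

  alternantAt : Partition → Partition → ℚ[a]
  alternantAt κ μ = det n (powers (pointₙ μ) (exponent κ))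

  vandermondeAt : Partition → ℚ[a]
  vandermondeAt μ = product λ (i : Fin n) → product λ (j : Fin n) →
    if does (i Fin.<? j) then pointₙ μ i ⊕ ⊝ pointₙ μ j else 𝔸.1#

  alternant-at : ∀ κ μ → Hom.⟦_⟧ (evaluateAt n μ) (alternant n κ) ≋ alternantAt κ μ
  alternant-at κ μ = ≋-trans
    (E.det-homo n λ i j → shiftedPower n i (exponent κ j))
    (Det.det-cong n λ i j → E.product-homo {exponent κ j} λ m → var i ⊕ ⊝ con (a (n ⊖ toℕ m)))
    where module E = Hom (evaluateAt n μ)

  vandermonde-at : ∀ μ → Hom.⟦_⟧ (evaluateAt n μ) (vandermonde n) ≋ vandermondeAt μ
  vandermonde-at μ = ≋-trans (E.product-homo {n} λ i → Rₓ.product λ j → factor i j)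
    (Det.Π.sum-cong-≋ {n} λ i → ≋-trans (E.product-homo {n} (factor i)) (Det.Π.sum-cong-≋ {n} (on-factor i)))
    where
    module E = Hom (evaluateAt n μ)
    module Rₓ = RingOperations (ℚ[a][x] n)
    factor : Fin n → Fin n → Polyₓ n
    factor i j = if does (i Fin.<? j) then var i ⊕ ⊝ var j else CommutativeRing.1# (ℚ[a][x] n)
    on-factor : ∀ i j → E.⟦ factor i j ⟧ ≋
      (if does (i Fin.<? j) then pointₙ μ i ⊕ ⊝ pointₙ μ j else 𝔸.1#)
    on-factor i j with does (i Fin.<? j)
    ... | true  = ≋-refl
    ... | false = ≋-refl

  -- The coordinates of a_μ are distinct indeterminates, because their indices increase strictly.
  vandermondeAt-regular : ∀ μ → Regular ℚ[a]-ring (vandermondeAt μ)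
  vandermondeAt-regular μ = regular-product ℚ[a]-ring {n} _ λ i → regular-product ℚ[a]-ring {n} _ λ j → factor i j
    where
    factor : ∀ i j → Regular ℚ[a]-ring (if does (i Fin.<? j) then pointₙ μ i ⊕ ⊝ pointₙ μ j else 𝔸.1#)
    factor i j with toℕ i ℕ.<? toℕ j
    ... | yes i<j rewrite dec-true (i Fin.<? j) i<j = var-difference-regular λ e →
            ℤ.<-irrefl (≡.sym e) (index-mono-< μ i<j)
    ... | no i≮j rewrite dec-false (i Fin.<? j) i≮j = regular-1 ℚ[a]-ring

  -- Raising the exponent of column j adds the factor x - b with b the j-th coordinate of a_κ. Hence
  -- the scalar in `pieri` is the difference of the weights of μ and κ.
  b-exponent : ∀ κ j → a (n ⊖ exponent κ j) ≡ pointₙ κ j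
  b-exponent κ j = ≡.cong a (complement (part κ (toℕ j)) (Fin.toℕ<n j))

  module _ {P} κ μ (schur : IsDoubleSchur κ P) (ℓκ : ℓength κ ≤ n) (ℓμ : ℓength μ ≤ n) where

    schur-at : value P μ ⊛ vandermondeAt μ ≋ alternantAt κ μ
    schur-at = begin
      value P μ ⊛ vandermondeAt μ
        ≈⟨ ⊛-cong (value-at P μ ℓμ) (≋-sym (vandermonde-at μ)) ⟩
      E.⟦ at P n ⟧ ⊛ E.⟦ vandermonde n ⟧
        ≈⟨ E.⟦⟧-cong (IsDoubleSchur.quotient schur n ℓκ) ⟩
      E.⟦ alternant n κ ⟧
        ≈⟨ alternant-at κ μ ⟩
      alternantAt κ μ ∎
      where module E = Hom (evaluateAt n μ)

schur-∅ : ∀ {P} → IsDoubleSchur ∅ P → ∀ μ → value P μ ≋ 𝔸.1#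
schur-∅ {P} schur μ = cancel ℚ[a]-ring (vandermondeAt-regular μ) (begin
  vandermondeAt μ ⊛ value P μ  ≈⟨ ⊛-comm _ _ ⟩
  value P μ ⊛ vandermondeAt μ  ≈⟨ schur-at ∅ μ schur z≤n ℕ.≤-refl ⟩
  alternantAt ∅ μ              ≈⟨ vandermonde-det n (pointₙ μ) ⟩
  vandermondeAt μ              ≈⟨ 𝔸.*-identityʳ _ ⟨
  vandermondeAt μ ⊛ 𝔸.1#       ∎)
  where
  n = ℓength μ
  open AtLevel n

-- If row k of κ is longer than row k of μ, the alternant at a_μ has a zero
-- block formed by the rows from k on and the columns up to k.
schur-vanishes : ∀ {P} κ μ → IsDoubleSchur κ P → ¬ κ ⊆ₚ μ → value P μ ≋ 𝔸.0#
schur-vanishes {P} κ μ schur κ⊈μ with κ ⊆ₚ? μ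
... | inj₁ κ⊆μ = contradiction κ⊆μ κ⊈μ
... | inj₂ (k , μₖ<κₖ) = vandermondeAt-regular μ (value P μ) (≋-trans (⊛-comm _ _) (≋-trans
    (schur-at κ μ schur (ℕ.m≤m⊔n _ _) (ℕ.m≤n⊔m (ℓength κ) _))
    (Det.det-zeroBlock n (powers (pointₙ μ) (exponent κ)) k (suc k) ℕ.≤-refl k<n zeros)))
  where
  n = ℓength κ ℕ.⊔ ℓength μ
  open AtLevel n
  k<n : k < n
  k<n = ℕ.<-≤-trans (ℕ.≰⇒> λ ℓ≤k → ℕ.<⇒≱ μₖ<κₖ (≡.subst (_≤ part μ k) (≡.sym (part-≥ℓ κ ℓ≤k)) z≤n)) (ℕ.m≤m⊔n _ (ℓength μ))
  zeros : ∀ i j → k ≤ toℕ i → toℕ j < suc k → powers (pointₙ μ) (exponent κ) i j ≋ 𝔸.0#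
  -- The vanishing factor is the one with m = μᵢ + n - i - 1, i counted from 0, for which a (n ⊖ m)
  -- is the coordinate of a_μ in row i. It is present because μᵢ ≤ μₖ < κₖ ≤ κⱼ and j ≤ i.
  zeros i j k≤i (s≤s j≤k) = product-zero {exponent κ j} (λ m → pointₙ μ i ⊕ ⊝ a (n ⊖ toℕ m)) (Fin.fromℕ< m<)
    (≋-trans (⊕-cong ≋-refl (⊝-cong (𝔸.reflexive (≡.cong a
      (≡.trans (≡.cong (n ⊖_) (Fin.toℕ-fromℕ< m<)) (complement (part μ (toℕ i)) (Fin.toℕ<n i)))))))
      (𝔸.-‿inverseʳ _))
    where
    m< : part μ (toℕ i) ℕ.+ (n ∸ suc (toℕ i)) < exponent κ j
    m< = ℕ.+-mono-<-≤
      (ℕ.≤-<-trans (part-antitone μ k≤i) (ℕ.<-≤-trans μₖ<κₖ (part-antitone κ j≤k)))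
      (ℕ.∸-monoʳ-≤ n (s≤s (ℕ.≤-trans j≤k k≤i)))

-- Summing over all positions of a square, with 0 where no box can be added, makes conjugation an
-- exchange of two sums.
cornerTerm : (Partition → ℚ[a]) → Partition → ℕ → ℕ → ℚ[a]
cornerTerm f κ i j with corner? κ i j
... | yes corner = f (addBox κ corner)
... | no  _      = 𝔸.0#

cornerTerm-yes : ∀ f κ {i j} (corner : Corner κ i j) → cornerTerm f κ i j ≡ f (addBox κ corner)
cornerTerm-yes f κ {i} {j} corner with corner? κ i j
... | yes corner′ = ≡.cong f (addBox-cong {κ} {κ} corner′ corner ≡.refl)
... | no ¬corner  = contradiction corner ¬corner

cornerTerm-no : ∀ f κ {i j} → ¬ Corner κ i j → cornerTerm f κ i j ≡ 𝔸.0#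
cornerTerm-no f κ {i} {j} ¬corner with corner? κ i j
... | yes corner = contradiction corner ¬corner
... | no  _      = ≡.refl

-- What determines the values at a_μ up to the normalisation at ∅. The recursion is asked for all
-- large n, so that two solutions with different bounds can be compared at a common n.
record Solution (μ : Partition) (f : Partition → ℚ[a]) : Set where
  field
    vanishes  : ∀ κ → ¬ κ ⊆ₚ μ → f κ ≋ 𝔸.0#
    bound     : Partition → ℕ
    recursion : ∀ κ {n} → bound κ ≤ n → (weight μ ⊕ ⊝ weight κ) ⊛ f κ ≋
      sum λ (i : Fin n) → sum λ (j : Fin n) → cornerTerm f κ (toℕ i) (toℕ j)

module _ {s : Partition → Λ} (schur : ∀ κ → IsDoubleSchur κ (s κ)) (μ : Partition) where

  private
    f : Partition → ℚ[a]
    f κ = value (s κ) μ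

    -- Besides bounding both lengths, n exceeds the first part, so a box added to one of the first n
    -- rows lies in one of the first n columns.
    bound : Partition → ℕ
    bound κ = (ℓength κ ℕ.⊔ ℓength μ) ℕ.⊔ suc (part κ 0)

    module _ (κ : Partition) {n : ℕ} (bound≤n : bound κ ≤ n) where
      open AtLevel n

      ℓκ : ℓength κ ≤ n
      ℓκ = ℕ.m⊔n≤o⇒m≤o _ (ℓength μ) (ℕ.m⊔n≤o⇒m≤o _ (suc (part κ 0)) bound≤n)

      ℓμ : ℓength μ ≤ n
      ℓμ = ℕ.m⊔n≤o⇒n≤o (ℓength κ) _ (ℕ.m⊔n≤o⇒m≤o _ (suc (part κ 0)) bound≤n)

      κ<n : ∀ i → part κ i < n
      κ<n i = ℕ.≤-<-trans (part-antitone κ {0} {i} z≤n) (ℕ.m⊔n≤o⇒n≤o (ℓength κ ℕ.⊔ ℓength μ) _ bound≤n)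

      rowSum : Fin n → ℚ[a]
      rowSum i = sum λ (j : Fin n) → cornerTerm f κ (toℕ i) (toℕ j)

      lengthen-corner : ∀ i → (corner : Corner κ (toℕ i) (part κ (toℕ i))) →
        det n (powers (pointₙ μ) (bump (exponent κ) i)) ≋ rowSum i ⊛ vandermondeAt μ
      lengthen-corner i corner = begin
        det n (powers (pointₙ μ) (bump (exponent κ) i))
          ≈⟨ Det.det-cong n (λ k j → 𝔸.reflexive (≡.cong (λ r → power r (pointₙ μ k)) (exponents j))) ⟩
        alternantAt (addBox κ corner) μ
          ≈⟨ schur-at (addBox κ corner) μ (schur _) (ℓength-addBox κ corner ℓκ (Fin.toℕ<n i)) ℓμ ⟨
        f (addBox κ corner) ⊛ vandermondeAt μ
          ≈⟨ 𝔸.*-congʳ (≋-trans (sum-single {n} _ column others)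
               (𝔸.reflexive (≡.trans (≡.cong (cornerTerm f κ (toℕ i)) to-column) (cornerTerm-yes f κ corner)))) ⟨
        rowSum i ⊛ vandermondeAt μ ∎
        where
        column : Fin n
        column = Fin.fromℕ< (κ<n (toℕ i))
        to-column : toℕ column ≡ part κ (toℕ i)
        to-column = Fin.toℕ-fromℕ< (κ<n (toℕ i))
        others : ∀ j → j ≢ column → cornerTerm f κ (toℕ i) (toℕ j) ≋ 𝔸.0#
        others j j≢ = 𝔸.reflexive (cornerTerm-no f κ λ c → j≢ (Fin.toℕ-injective (≡.trans (≡.sym (proj₁ c)) (≡.sym to-column))))
        exponents : ∀ j → bump (exponent κ) i j ≡ exponent (addBox κ corner) j
        exponents j with j Fin.≟ i
        ... | yes ≡.refl = ≡.cong (ℕ._+ (n ∸ suc (toℕ j))) (≡.sym (part-addBox-≡ κ corner))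
        ... | no j≢i = ≡.cong (ℕ._+ (n ∸ suc (toℕ j))) (≡.sym (part-addBox-≢ κ corner (j≢i ∘ Fin.toℕ-injective)))

    -- Row i is as long as the row above it, so raising its exponent repeats the exponent of the
    -- column to the left; on the other side, no box can be added in row i.
    lengthen-blocked : ∀ κ n (bound≤n : bound κ ≤ n) (i : Fin n) k → toℕ i ≡ suc k → part κ k ≡ part κ (toℕ i) →
      det n (AtLevel.powers n (AtLevel.pointₙ n μ) (AtLevel.bump n (AtLevel.exponent n κ) i)) ≋
      rowSum κ bound≤n i ⊛ AtLevel.vandermondeAt n μ
    lengthen-blocked κ (suc n) bound≤n (Fin.suc i) k ≡.refl κₖ≡ = ≋-trans
      (Det.det-adjacent n (powers (pointₙ μ) (bump (exponent κ) (Fin.suc i))) i equal)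
      (≋-sym (≋-trans (𝔸.*-congʳ (sum-zero {suc n} (λ j → cornerTerm f κ (suc (toℕ i)) (toℕ j)) λ j → 𝔸.reflexive (cornerTerm-no f κ λ c →
        ℕ.<-irrefl (≡.trans (≡.sym (proj₁ c)) (≡.sym κₖ≡))
          (box-ᵗ⁻¹ κ (≡.subst (toℕ i <_) (≡.sym (proj₂ c)) (ℕ.n<1+n _))))))
        (𝔸.zeroˡ _)))
      where
      open AtLevel (suc n)
      exponents : bump (exponent κ) (Fin.suc i) (inject₁ i) ≡ bump (exponent κ) (Fin.suc i) (Fin.suc i)
      exponents rewrite dec-false (inject₁ i Fin.≟ Fin.suc i) (λ e → ℕ.1+n≢n (≡.trans (≡.sym (≡.cong toℕ e)) (toℕ-inject₁ i)))
                      | dec-true (Fin.suc i Fin.≟ Fin.suc i) ≡.refl | toℕ-inject₁ i | κₖ≡ =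
        ≡.trans (≡.cong (part κ (suc (toℕ i)) ℕ.+_) (ℕ.+-∸-assoc 1 (Fin.toℕ<n i))) (ℕ.+-suc _ _)
      equal : ∀ l → powers (pointₙ μ) (bump (exponent κ) (Fin.suc i)) l (inject₁ i) ≋
                    powers (pointₙ μ) (bump (exponent κ) (Fin.suc i)) l (Fin.suc i)
      equal l = 𝔸.reflexive (≡.cong (λ r → power r (pointₙ μ l)) exponents)

    lengthen : ∀ κ n (bound≤n : bound κ ≤ n) (i : Fin n) →
      det n (AtLevel.powers n (AtLevel.pointₙ n μ) (AtLevel.bump n (AtLevel.exponent n κ) i)) ≋
      rowSum κ bound≤n i ⊛ AtLevel.vandermondeAt n μ
    lengthen κ n bound≤n i with row-corner κ (toℕ i)
    ... | inj₁ corner = lengthen-corner κ bound≤n i corner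
    ... | inj₂ (k , i≡ , κₖ≡) = lengthen-blocked κ n bound≤n i k i≡ κₖ≡

  -- This is `pieri` at the point a_μ, with the Vandermonde product cancelled and the blocked rows
  -- contributing 0.
  schur-recursion : ∀ κ {n} → bound κ ≤ n → (weight μ ⊕ ⊝ weight κ) ⊛ f κ ≋
    sum λ (i : Fin n) → sum λ (j : Fin n) → cornerTerm f κ (toℕ i) (toℕ j)
  schur-recursion κ {n} bound≤n = cancel ℚ[a]-ring (vandermondeAt-regular μ) (begin
    vandermondeAt μ ⊛ ((weight μ ⊕ ⊝ weight κ) ⊛ f κ)
      ≈⟨ solve 3 (λ v w f → v :* (w :* f) := w :* (f :* v)) ≋-refl (vandermondeAt μ) (weight μ ⊕ ⊝ weight κ) (f κ) ⟩
    (weight μ ⊕ ⊝ weight κ) ⊛ (f κ ⊛ vandermondeAt μ)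
      ≈⟨ ⊛-cong weights (schur-at κ μ (schur κ) (ℓκ κ bound≤n) (ℓμ κ bound≤n)) ⟩
    (sum (pointₙ μ) ⊕ ⊝ sum (λ j → a (n ⊖ exponent κ j))) ⊛ alternantAt κ μ
      ≈⟨ pieri n (pointₙ μ) (exponent κ) ⟩
    sum (λ i → det n (powers (pointₙ μ) (bump (exponent κ) i)))
      ≈⟨ ∑-cong {n} _ _ (lengthen κ n bound≤n) ⟩
    sum (λ i → rowSum κ bound≤n i ⊛ vandermondeAt μ)
      ≈⟨ *-distribʳ-sum {n} (vandermondeAt μ) (rowSum κ bound≤n) ⟨
    sum (rowSum κ bound≤n) ⊛ vandermondeAt μ
      ≈⟨ ⊛-comm _ _ ⟩
    vandermondeAt μ ⊛ sum (rowSum κ bound≤n) ∎)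
    where
    open AtLevel n
    weights : weight μ ⊕ ⊝ weight κ ≋ sum (pointₙ μ) ⊕ ⊝ sum (λ j → a (n ⊖ exponent κ j))
    weights = ≋-trans (weight-difference μ κ (ℓμ κ bound≤n) (ℓκ κ bound≤n))
      (≋-trans (≋-sym (∑-sub (pointₙ μ) (pointₙ κ)))
        (𝔸.+-congˡ (⊝-cong (∑-cong {n} _ _ λ j → 𝔸.reflexive (≡.sym (b-exponent κ j))))))

  schur-solution : Solution μ f
  schur-solution = record
    { vanishes = λ κ → schur-vanishes κ μ (schur κ) ; bound = bound ; recursion = schur-recursion }

-- As the differences of weights are regular, the recursion expresses the
-- values at all κ ⊆ μ, up to regular denominators, by the value at μ, and
-- the latter by the value at ∅.
module TwoSolutions {μ : Partition} {f g : Partition → ℚ[a]} (F : Solution μ f) (G : Solution μ g) where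

  private
    module F = Solution F
    module G = Solution G

    -- Says x / f μ = y / g μ = num / den without fractions. A single fraction can serve both sides
    -- because the two recursions have the same coefficients.
    record Ratio (x y : ℚ[a]) : Set where
      field
        den num     : ℚ[a]
        den-regular : Regular ℚ[a]-ring den
        ratioˡ      : den ⊛ x ≋ num ⊛ f μ
        ratioʳ      : den ⊛ y ≋ num ⊛ g μ

    ratio-0 : ∀ {x y} → x ≋ 𝔸.0# → y ≋ 𝔸.0# → Ratio x y
    ratio-0 x≋0 y≋0 = record
      { den = 𝔸.1# ; num = 𝔸.0# ; den-regular = regular-1 ℚ[a]-ring
      ; ratioˡ = ≋-trans (𝔸.*-congˡ x≋0) (≋-trans (𝔸.zeroʳ _) (𝔸.sym (𝔸.zeroˡ _)))
      ; ratioʳ = ≋-trans (𝔸.*-congˡ y≋0) (≋-trans (𝔸.zeroʳ _) (𝔸.sym (𝔸.zeroˡ _))) }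

    ratio-+ : ∀ {x x′ y y′} → Ratio x y → Ratio x′ y′ → Ratio (x ⊕ x′) (y ⊕ y′)
    ratio-+ r r′ = record
      { den = r.den ⊛ r′.den ; num = r.num ⊛ r′.den ⊕ r′.num ⊛ r.den
      ; den-regular = regular-* ℚ[a]-ring r.den-regular r′.den-regular
      ; ratioˡ = add r.ratioˡ r′.ratioˡ ; ratioʳ = add r.ratioʳ r′.ratioʳ }
      where
      module r = Ratio r
      module r′ = Ratio r′
      add : ∀ {x x′ z} → r.den ⊛ x ≋ r.num ⊛ z → r′.den ⊛ x′ ≋ r′.num ⊛ z →
        (r.den ⊛ r′.den) ⊛ (x ⊕ x′) ≋ (r.num ⊛ r′.den ⊕ r′.num ⊛ r.den) ⊛ z
      add {x} {x′} {z} e e′ = ≋-trans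
        (solve 4 (λ d d′ x x′ → (d :* d′) :* (x :+ x′) := (d :* x) :* d′ :+ (d′ :* x′) :* d) ≋-refl r.den r′.den x x′)
        (≋-trans (⊕-cong (𝔸.*-congʳ e) (𝔸.*-congʳ e′))
          (solve 5 (λ d d′ m m′ z → (m :* z) :* d′ :+ (m′ :* z) :* d := (m :* d′ :+ m′ :* d) :* z) ≋-refl
            r.den r′.den r.num r′.num z))

    ratio-sum : ∀ {n} (t u : Fin n → ℚ[a]) → (∀ i → Ratio (t i) (u i)) → Ratio (sum t) (sum u)
    ratio-sum {zero}  t u r = ratio-0 ≋-refl ≋-refl
    ratio-sum {suc n} t u r = ratio-+ (r Fin.zero) (ratio-sum (t ∘ Fin.suc) (u ∘ Fin.suc) (r ∘ Fin.suc))

    ratio-divide : ∀ {w x x′ y y′} → Regular ℚ[a]-ring w → w ⊛ x ≋ x′ → w ⊛ y ≋ y′ → Ratio x′ y′ → Ratio x y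
    ratio-divide {w} ρ e e′ r = record
      { den = r.den ⊛ w ; num = r.num ; den-regular = regular-* ℚ[a]-ring r.den-regular ρ
      ; ratioˡ = ≋-trans (⊛-assoc _ _ _) (≋-trans (𝔸.*-congˡ e) r.ratioˡ)
      ; ratioʳ = ≋-trans (⊛-assoc _ _ _) (≋-trans (𝔸.*-congˡ e′) r.ratioʳ) }
      where module r = Ratio r

    ratio-self : Ratio (f μ) (g μ)
    ratio-self = record { den = 𝔸.1# ; num = 𝔸.1# ; den-regular = regular-1 ℚ[a]-ring ; ratioˡ = ≋-refl ; ratioʳ = ≋-refl }

    ratio-⊈ : ∀ {κ} → ¬ κ ⊆ₚ μ → Ratio (f κ) (g κ)
    ratio-⊈ {κ} κ⊈μ = ratio-0 (F.vanishes κ κ⊈μ) (G.vanishes κ κ⊈μ)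

    -- Induction on a bound d for the number of boxes missing from κ: the recursion passes to
    -- partitions with an additional box, and those outside μ have value 0.
    ratio-≤ : ∀ d κ → size μ ≤ size κ ℕ.+ d → κ ⊆ₚ μ → Ratio (f κ) (g κ)
    ratio-≤ d κ size≤ κ⊆μ with κ ≟ₚ μ
    ... | yes ≡.refl = ratio-self
    ratio-≤ zero κ size≤ κ⊆μ | no κ≢μ =
      contradiction (size-strict κ μ κ⊆μ κ≢μ) (ℕ.≤⇒≯ (≡.subst (size μ ≤_) (ℕ.+-identityʳ _) size≤))
    ratio-≤ (suc d) κ size≤ κ⊆μ | no κ≢μ = ratio-divide (weight-difference-regular μ κ κ⊆μ κ≢μ)
      (F.recursion κ (ℕ.m≤m⊔n _ _)) (G.recursion κ (ℕ.m≤n⊔m (F.bound κ) _))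
      (ratio-sum {n} _ _ λ i → ratio-sum {n} _ _ λ j → ratio-corner (toℕ i) (toℕ j))
      where
      n = F.bound κ ℕ.⊔ G.bound κ
      ratio-corner : ∀ i j → Ratio (cornerTerm f κ i j) (cornerTerm g κ i j)
      ratio-corner i j with corner? κ i j
      ... | no _ = ratio-0 ≋-refl ≋-refl
      ... | yes corner with addBox κ corner ⊆ₚ? μ
      ...   | inj₁ ⊆μ = ratio-≤ d (addBox κ corner) (ℕ.≤-trans size≤ (ℕ.≤-trans (ℕ.≤-reflexive (ℕ.+-suc (size κ) d))
                (ℕ.+-monoˡ-≤ d (size-addBox κ corner)))) ⊆μ
      ...   | inj₂ (k , l) = ratio-⊈ λ ⊆μ → ℕ.<⇒≱ l (⊆μ k)

    ratio : ∀ κ → Ratio (f κ) (g κ)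
    ratio κ with κ ⊆ₚ? μ
    ... | inj₁ κ⊆μ = ratio-≤ (size μ) κ (ℕ.m≤n+m _ _) κ⊆μ
    ... | inj₂ (k , l) = ratio-⊈ λ κ⊆μ → ℕ.<⇒≱ l (κ⊆μ k)

  module _ (f∅ : f ∅ ≋ 𝔸.1#) (g∅ : g ∅ ≋ 𝔸.1#) where
    private
      module r = Ratio (ratio ∅)

      num-f : r.num ⊛ f μ ≋ r.den
      num-f = ≋-trans (≋-sym r.ratioˡ) (≋-trans (𝔸.*-congˡ f∅) (𝔸.*-identityʳ _))

      num-g : r.num ⊛ g μ ≋ r.den
      num-g = ≋-trans (≋-sym r.ratioʳ) (≋-trans (𝔸.*-congˡ g∅) (𝔸.*-identityʳ _))

    -- The normalisation at ∅ turns the ratio there into num · f μ = den, so f μ and num both divide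
    -- a regular element.
    diagonal-regular : Regular ℚ[a]-ring (f μ)
    diagonal-regular = regular-factor ℚ[a]-ring (regular-≈ ℚ[a]-ring (≋-sym num-f) r.den-regular)

    private
      num-regular : Regular ℚ[a]-ring r.num
      num-regular = regular-factor ℚ[a]-ring (regular-≈ ℚ[a]-ring (≋-sym (≋-trans (⊛-comm _ _) num-f)) r.den-regular)

      diagonal : f μ ≋ g μ
      diagonal = cancel ℚ[a]-ring num-regular (≋-trans num-f (≋-sym num-g))

    agree : ∀ κ → f κ ≋ g κ
    agree κ = cancel ℚ[a]-ring q.den-regular (≋-trans q.ratioˡ (≋-trans (𝔸.*-congˡ diagonal) (≋-sym q.ratioʳ)))
      where module q = Ratio (ratio κ)

-- Conjugation symmetry of the values of double Schur functions

module _ {s : Partition → Λ} (schur : ∀ κ → IsDoubleSchur κ (s κ)) (μ : Partition) where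

  private
    f : Partition → ℚ[a]
    f κ = value (s κ) (μ ᵗ)

    g : Partition → ℚ[a]
    g κ = at-a′ (f (κ ᵗ))

    module S = Solution (schur-solution schur (μ ᵗ))
    module T = Hom at-a′Hom

    ᵗ-⊈ : ∀ κ → ¬ κ ⊆ₚ μ → ¬ κ ᵗ ⊆ₚ μ ᵗ
    ᵗ-⊈ κ κ⊈μ κᵗ⊆μᵗ = κ⊈μ (≡.subst₂ _⊆ₚ_ (ᵗ-involutive κ) (ᵗ-involutive μ) (ᵗ-mono (κ ᵗ) (μ ᵗ) κᵗ⊆μᵗ))

    cornerTerm-ᵗ : ∀ κ i j → at-a′ (cornerTerm f (κ ᵗ) i j) ≋ cornerTerm g κ j i
    cornerTerm-ᵗ κ i j with corner? κ j i
    ... | yes corner = 𝔸.reflexive (≡.cong at-a′ (≡.trans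
            (cornerTerm-yes f (κ ᵗ) (corner-ᵗ κ corner))
            (≡.cong f (≡.sym (addBox-ᵗ κ corner (corner-ᵗ κ corner))))))
    ... | no ¬corner = 𝔸.reflexive (≡.cong at-a′ (cornerTerm-no f (κ ᵗ) λ corner →
            ¬corner (≡.subst (λ κ → Corner κ j i) (ᵗ-involutive κ) (corner-ᵗ (κ ᵗ) corner))))

    -- Conjugation together with a′ fixes the weights and transposes the square of added boxes;
    -- exchanging the two sums undoes the transposition.
    recursion : ∀ κ {n} → S.bound (κ ᵗ) ≤ n → (weight μ ⊕ ⊝ weight κ) ⊛ g κ ≋
      sum λ (i : Fin n) → sum λ (j : Fin n) → cornerTerm g κ (toℕ i) (toℕ j)
    recursion κ {n} bound≤n = begin
      (weight μ ⊕ ⊝ weight κ) ⊛ g κ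
        ≈⟨ 𝔸.*-congʳ (⊕-cong (weight-ᵗ μ) (⊝-cong (weight-ᵗ κ))) ⟨
      at-a′ ((weight (μ ᵗ) ⊕ ⊝ weight (κ ᵗ)) ⊛ f (κ ᵗ))
        ≈⟨ T.⟦⟧-cong (S.recursion (κ ᵗ) bound≤n) ⟩
      at-a′ (sum λ (i : Fin n) → sum λ (j : Fin n) → cornerTerm f (κ ᵗ) (toℕ i) (toℕ j))
        ≈⟨ ≋-trans (T.sum-homo {n} (λ i → sum λ (j : Fin n) → cornerTerm f (κ ᵗ) (toℕ i) (toℕ j)))
             (∑-cong {n} _ _ λ i → ≋-trans (T.sum-homo {n} (λ j → cornerTerm f (κ ᵗ) (toℕ i) (toℕ j)))
               (∑-cong {n} _ _ λ j → cornerTerm-ᵗ κ (toℕ i) (toℕ j))) ⟩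
      (sum λ (i : Fin n) → sum λ (j : Fin n) → cornerTerm g κ (toℕ j) (toℕ i))
        ≈⟨ ∑-comm {n} {n} (λ i j → cornerTerm g κ (toℕ j) (toℕ i)) ⟩
      (sum λ (i : Fin n) → sum λ (j : Fin n) → cornerTerm g κ (toℕ i) (toℕ j)) ∎

    twisted-solution : Solution μ g
    twisted-solution = record
      { vanishes = λ κ κ⊈μ → T.⟦⟧-cong (S.vanishes (κ ᵗ) (ᵗ-⊈ κ κ⊈μ))
      ; bound = λ κ → S.bound (κ ᵗ) ; recursion = recursion }

    module Two = TwoSolutions (schur-solution schur μ) twisted-solution
    one : value (s ∅) μ ≋ 𝔸.1#
    one = schur-∅ (schur ∅) μ
    twisted-one : g ∅ ≋ 𝔸.1#
    twisted-one = T.⟦⟧-cong (schur-∅ (schur ∅) (μ ᵗ))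

  schur-ᵗ : ∀ κ → value (s κ) μ ≋ at-a′ (value (s (κ ᵗ)) (μ ᵗ))
  schur-ᵗ = Two.agree one twisted-one

  schur-diagonal-regular : Regular ℚ[a]-ring (value (s μ) μ)
  schur-diagonal-regular = Two.diagonal-regular one twisted-one

-- Recovering an element of Λ from its values

private
  rectangle : ℕ → ℕ → Partition
  rectangle m k = partition (applyUpTo (λ _ → suc k) m)
    (Linked.applyUpTo⁺₂ _ m (λ _ → ℕ.≤-refl)) (All.applyUpTo⁺₁ _ m (λ _ → s≤s z≤n))

  part-rectangle : ∀ m k {i} → i < m → part (rectangle m k) i ≡ suc k
  part-rectangle m k {i} i<m = ≡.trans (part≡nth (rectangle m k) i) (nth-constant m i<m)
    where
    nth-constant : ∀ m {i} → i < m → nth (applyUpTo (λ _ → suc k) m) i ≡ suc k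
    nth-constant (suc m) {zero}  _       = ≡.refl
    nth-constant (suc m) {suc i} (s≤s l) = nth-constant m l

  height : ℚ[a] → ℕ
  height (con _) = 0
  height (var m) = ℤ.∣ m ∣
  height (p ⊕ q) = height p ℕ.⊔ height q
  height (p ⊛ q) = height p ℕ.⊔ height q
  height (⊝ p)   = height p

  heightₓ : ∀ {n} → Polyₓ n → ℕ
  heightₓ (con r) = height r
  heightₓ (var _) = 0
  heightₓ (p ⊕ q) = heightₓ p ℕ.⊔ heightₓ q
  heightₓ (p ⊛ q) = heightₓ p ℕ.⊔ heightₓ q
  heightₓ (⊝ p)   = heightₓ p

  -- For a large rectangle μ the coordinates of a_μ are distinct and do not
  -- occur in a given polynomial, which is therefore recovered from its value
  -- at a_μ by substituting them back.
  module Recover (n N : ℕ) where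

    -- Row i, counted from 0, has length N + n + 1 and gives the index i - N - n, of absolute value
    -- greater than N for i < n.
    μ : Partition
    μ = rectangle n (N ℕ.+ n)

    module S = CommutativeRing (ℚ[a][x] n)

    back : ℤ → Polyₓ n
    back m with Fin.any? (λ (i : Fin n) → m ℤ.≟ index μ (toℕ i))
    ... | yes (i , _) = var i
    ... | no  _       = con (a m)

    backHom : Hom ℚ[a]-ring (ℚ[a][x] n)
    backHom = evaluateHom (conHom ℚ[a]-ring (Fin n) ∘ʰ conHom ℚ-ring ℤ) back

    module B = Hom backHom
    module E = Hom (evaluateAt n μ)

    back-index : ∀ i → back (index μ (toℕ i)) ≡ var i
    back-index i with Fin.any? (λ (j : Fin n) → index μ (toℕ i) ℤ.≟ index μ (toℕ j))
    ... | no ∄ = contradiction (i , ≡.refl) ∄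
    ... | yes (j , e) with ℕ.<-cmp (toℕ i) (toℕ j)
    ...   | tri< i<j _ _ = contradiction (index-mono-< μ i<j) (ℤ.<-irrefl e)
    ...   | tri≈ _ i≡j _ = ≡.cong var (≡.sym (Fin.toℕ-injective i≡j))
    ...   | tri> _ _ j<i = contradiction (index-mono-< μ j<i) (ℤ.<-irrefl (≡.sym e))

    index-large : ∀ (i : Fin n) → N < ℤ.∣ index μ (toℕ i) ∣
    index-large i rewrite part-rectangle n (N ℕ.+ n) (Fin.toℕ<n i)
                        | ℤ.∣⊖∣-≤ {suc (toℕ i)} {suc (N ℕ.+ n)} (s≤s (ℕ.≤-trans (ℕ.<⇒≤ (Fin.toℕ<n i)) (ℕ.m≤n+m n N))) =
      ℕ.m+n≤o⇒m≤o∸n (suc N) (≡.subst (_≤ N ℕ.+ n) (ℕ.+-suc N (toℕ i)) (ℕ.+-monoʳ-≤ N (Fin.toℕ<n i)))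

    back-small : ∀ m → ℤ.∣ m ∣ ≤ N → back m ≡ con (a m)
    back-small m m≤N with Fin.any? (λ (i : Fin n) → m ℤ.≟ index μ (toℕ i))
    ... | no  _            = ≡.refl
    ... | yes (i , ≡.refl) = contradiction m≤N (ℕ.<⇒≱ (index-large i))

    back-coefficient : ∀ r → height r ≤ N → B.⟦ r ⟧ ≋ con r
    back-coefficient (con _) _ = ≋-refl
    back-coefficient (var m) l = S.reflexive (back-small m l)
    back-coefficient (p ⊕ q) l = ≋-trans (⊕-cong (back-coefficient p (ℕ.m⊔n≤o⇒m≤o _ _ l))
      (back-coefficient q (ℕ.m⊔n≤o⇒n≤o (height p) _ l))) (≋-sym (con-+ p q))
    back-coefficient (p ⊛ q) l = ≋-trans (⊛-cong (back-coefficient p (ℕ.m⊔n≤o⇒m≤o _ _ l))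
      (back-coefficient q (ℕ.m⊔n≤o⇒n≤o (height p) _ l))) (≋-sym (con-* p q))
    back-coefficient (⊝ p)   l = ≋-trans (⊝-cong (back-coefficient p l)) (≋-sym (Hom.-‿homo (conHom ℚ[a]-ring (Fin n)) p))

    recover : ∀ p → heightₓ p ≤ N → B.⟦ E.⟦ p ⟧ ⟧ ≋ p
    recover (con r) l = back-coefficient r l
    recover (var i) l = S.reflexive (back-index i)
    recover (p ⊕ q) l = ⊕-cong (recover p (ℕ.m⊔n≤o⇒m≤o _ _ l)) (recover q (ℕ.m⊔n≤o⇒n≤o (heightₓ p) _ l))
    recover (p ⊛ q) l = ⊛-cong (recover p (ℕ.m⊔n≤o⇒m≤o _ _ l)) (recover q (ℕ.m⊔n≤o⇒n≤o (heightₓ p) _ l))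
    recover (⊝ p)   l = ⊝-cong (recover p l)

value-injective : ∀ P Q → (∀ μ → value P μ ≋ value Q μ) → P ≈Λ Q
value-injective P Q h n = ≋-trans (≋-sym (recover (at P n) (ℕ.m≤m⊔n _ _)))
  (≋-trans (B.⟦⟧-cong (≋-trans (≋-sym (value-at P μ ℓ≤n)) (≋-trans (h μ) (value-at Q μ ℓ≤n))))
    (recover (at Q n) (ℕ.m≤n⊔m (heightₓ (at P n)) _)))
  where
  open Recover n (heightₓ (at P n) ℕ.⊔ heightₓ (at Q n))
  ℓ≤n : ℓength μ ≤ n
  ℓ≤n = ℕ.≤-reflexive (length-applyUpTo _ n)

-- The coproduct and the dual Littlewood–Richardson polynomials

listSum : {X : Set} → List X → (X → ℚ[a]) → ℚ[a]
listSum M g = List.foldr (λ x t → g x ⊕ t) 𝔸.0# M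

module _ {X : Set} where

  listSum-map : ∀ {Y : Set} (f : Y → X) M g → listSum (List.map f M) g ≋ listSum M (g ∘ f)
  listSum-map f []      g = ≋-refl
  listSum-map f (x ∷ M) g = ⊕-cong ≋-refl (listSum-map f M g)

  listSum-sub : ∀ (M : List X) g h → listSum M (λ x → g x ⊕ ⊝ h x) ≋ listSum M g ⊕ ⊝ listSum M h
  listSum-sub []      g h = 𝔸.sym (𝔸.-‿inverseʳ _)
  listSum-sub (x ∷ M) g h = ≋-trans (⊕-cong ≋-refl (listSum-sub M g h))
    (solve 4 (λ a b c d → (a :- b) :+ (c :- d) := (a :+ c) :- (b :+ d)) ≋-refl (g x) (h x) _ _)

  listSum-zero : ∀ (M : List X) g → (∀ x → x ∈ M → g x ≋ 𝔸.0#) → listSum M g ≋ 𝔸.0#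
  listSum-zero []      g z = ≋-refl
  listSum-zero (x ∷ M) g z = ≋-trans (⊕-cong (z x (here ≡.refl)) (listSum-zero M g (λ y → z y ∘ there))) (⊕-identityˡ _)

  private
    listSum-shift : ∀ (x : X) xs ys g → listSum (xs ++ x ∷ ys) g ≋ g x ⊕ listSum (xs ++ ys) g
    listSum-shift x []       ys g = ≋-refl
    listSum-shift x (z ∷ xs) ys g = ≋-trans (⊕-cong ≋-refl (listSum-shift x xs ys g))
      (solve 3 (λ a b c → a :+ (b :+ c) := b :+ (a :+ c)) ≋-refl (g z) (g x) _)

  -- An expansion may come with any duplicate-free list covering its support. Two expansions are
  -- compared on a common larger list, where the extra terms are 0.
  listSum-extend : ∀ {L M : List X} (g : X → ℚ[a]) → Unique L → Unique M → (∀ {x} → x ∈ L → x ∈ M) →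
    (∀ x → x ∈ M → x ∉ L → g x ≋ 𝔸.0#) → listSum L g ≋ listSum M g
  listSum-extend {[]} {M} g _ _ _ z = ≋-sym (listSum-zero M g λ x x∈M → z x x∈M λ ())
  listSum-extend {x ∷ L} g (x∉L ∷ L!) M! L⊆M z with ∈-∃++ (L⊆M (here ≡.refl))
  ... | xs , ys , ≡.refl
    with x∉ ∷ rest! ← Permutationₛ.Unique-resp-↭ (≡-setoid X) (↭⇒↭ₛ (shift x xs ys)) M! =
    ≋-trans (⊕-cong ≋-refl (listSum-extend g L! rest! L⊆rest outside)) (≋-sym (listSum-shift x xs ys g))
    where
    L⊆rest : ∀ {y} → y ∈ L → y ∈ xs ++ ys
    L⊆rest y∈L with ∈-resp-↭ (shift x xs ys) (L⊆M (there y∈L))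
    ... | here ≡.refl = contradiction ≡.refl (All.lookup x∉L y∈L)
    ... | there y∈    = y∈
    outside : ∀ y → y ∈ xs ++ ys → y ∉ L → g y ≋ 𝔸.0#
    outside y y∈ y∉L = z y (∈-resp-↭ (↭-sym (shift x xs ys)) (there y∈))
      λ { (here ≡.refl) → All.lookup x∉ y∈ ≡.refl ; (there y∈L) → y∉L y∈L }

open Tensor Λ-algebra Λ-algebra using (Carrierᵀ; 0ᵀ; _+ᵀ_; -ᵀ_; _*ᵀ_; mulPure; _≈ᵀ_)
module Tᵀ = Tensor Λ-algebra Λ-algebra

module _ (α β : Partition) where

  private
    -- Evaluates the first factor at a_α and the second at a_β. It is compatible with the balancing
    -- relation because both evaluations fix Q[a].
    tensorValue : Carrierᵀ → ℚ[a]
    tensorValue 0ᵀ       = 𝔸.0#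
    tensorValue (P ⊗ Q)  = value P α ⊛ value Q β
    tensorValue (t +ᵀ u) = tensorValue t ⊕ tensorValue u
    tensorValue (-ᵀ t)   = ⊝ tensorValue t

    tensorValue-cong : ∀ {t u} → t ≈ᵀ u → tensorValue t ≋ tensorValue u
    tensorValue-cong Tᵀ.≈-refl = ≋-refl
    tensorValue-cong (Tᵀ.≈-sym e) = ≋-sym (tensorValue-cong e)
    tensorValue-cong (Tᵀ.≈-trans e f) = ≋-trans (tensorValue-cong e) (tensorValue-cong f)
    tensorValue-cong (Tᵀ.+-cong e f) = ⊕-cong (tensorValue-cong e) (tensorValue-cong f)
    tensorValue-cong (Tᵀ.-‿cong e) = ⊝-cong (tensorValue-cong e)
    tensorValue-cong (Tᵀ.+-assoc _ _ _) = ⊕-assoc _ _ _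
    tensorValue-cong (Tᵀ.+-comm _ _) = ⊕-comm _ _
    tensorValue-cong (Tᵀ.+-identityˡ _) = ⊕-identityˡ _
    tensorValue-cong (Tᵀ.-‿inverseˡ _) = ⊕-inverseˡ _
    tensorValue-cong (Tᵀ.⊗-cong {p} {p′} {q} {q′} e f) =
      ⊛-cong (Hom.⟦⟧-cong (valueHom α) {p} {p′} e) (Hom.⟦⟧-cong (valueHom β) {q} {q′} f)
    tensorValue-cong (Tᵀ.⊗-distribˡ p q q′) = ⊛-distribˡ _ _ _
    tensorValue-cong (Tᵀ.⊗-distribʳ p p′ q) = 𝔸.distribʳ _ _ _
    tensorValue-cong (Tᵀ.⊗-balanced r p q) =
      solve 3 (λ r p q → (r :* p) :* q := p :* (r :* q)) ≋-refl r (value p α) (value q β)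

    mulPure-homo : ∀ P Q t → tensorValue (mulPure P Q t) ≋ (value P α ⊛ value Q β) ⊛ tensorValue t
    mulPure-homo P Q 0ᵀ       = 𝔸.sym (𝔸.zeroʳ _)
    mulPure-homo P Q (R ⊗ S)  = solve 4 (λ p q r s → (p :* r) :* (q :* s) := (p :* q) :* (r :* s)) ≋-refl
      (value P α) (value Q β) (value R α) (value S β)
    mulPure-homo P Q (t +ᵀ u) = ≋-trans (⊕-cong (mulPure-homo P Q t) (mulPure-homo P Q u)) (≋-sym (⊛-distribˡ _ _ _))
    mulPure-homo P Q (-ᵀ t)   = ≋-trans (⊝-cong (mulPure-homo P Q t)) (RingProperties.-‿distribʳ-* 𝔸.ring _ _)

    *ᵀ-homo : ∀ t u → tensorValue (t *ᵀ u) ≋ tensorValue t ⊛ tensorValue u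
    *ᵀ-homo 0ᵀ        u = 𝔸.sym (𝔸.zeroˡ _)
    *ᵀ-homo (P ⊗ Q)   u = mulPure-homo P Q u
    *ᵀ-homo (t +ᵀ t′) u = ≋-trans (⊕-cong (*ᵀ-homo t u) (*ᵀ-homo t′ u)) (≋-sym (𝔸.distribʳ _ _ _))
    *ᵀ-homo (-ᵀ t)    u = ≋-trans (⊝-cong (*ᵀ-homo t u)) (RingProperties.-‿distribˡ-* 𝔸.ring _ _)

  tensorValueHom : Hom Λ⊗Λ.commutativeRing ℚ[a]-ring
  tensorValueHom = record
    { ⟦_⟧ = tensorValue ; ⟦⟧-cong = tensorValue-cong
    ; +-homo = λ _ _ → ≋-refl ; *-homo = *ᵀ-homo ; 1-homo = 𝔸.*-identityˡ _ }

module _ {Δ : Λ → Λ⊗Λ.Carrier} (comultiplication : IsComultiplication Δ) where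

  private
    module Δ = IsAlgebraHomomorphism (IsComultiplication.isAlgebraHomomorphism comultiplication)
    module Δᴿ = RingMorphisms.IsRingHomomorphism Δ.isRingHomomorphism

    ΔHom : Hom Λ-ring Λ⊗Λ.commutativeRing
    ΔHom = record
      { ⟦_⟧ = Δ ; ⟦⟧-cong = λ {P} {Q} → Δᴿ.⟦⟧-cong {P} {Q}
      ; +-homo = Δᴿ.+-homo ; *-homo = Δᴿ.*-homo ; 1-homo = Δᴿ.1#-homo }

  coproductHom : Partition → Partition → Hom Λ-ring ℚ[a]-ring
  coproductHom α β = tensorValueHom α β ∘ʰ ΔHom

  coproductValue : Partition → Partition → Λ → ℚ[a]
  coproductValue α β = Hom.⟦_⟧ (coproductHom α β)

  coproductValue-const : ∀ α β r → coproductValue α β (constΛ r) ≋ r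
  coproductValue-const α β r = begin
    coproductValue α β (constΛ r)          ≈⟨ C.⟦⟧-cong {constΛ r} {constΛ r *Λ 1Λ} (λ n → ≋-sym (CommutativeRing.*-identityʳ (ℚ[a][x] n) (con r))) ⟩
    coproductValue α β (constΛ r *Λ 1Λ)    ≈⟨ V.⟦⟧-cong (Δ.linear r 1Λ) ⟩
    V.⟦ r Λ⊗Λ.· Δ 1Λ ⟧                     ≈⟨ V.*-homo (Λ⊗Λ.ι r) (Δ 1Λ) ⟩
    (r ⊛ 𝔸.1#) ⊛ coproductValue α β 1Λ     ≈⟨ ⊛-cong (𝔸.*-identityʳ r) C.1-homo ⟩
    r ⊛ 𝔸.1#                               ≈⟨ 𝔸.*-identityʳ r ⟩
    r ∎
    where
    module V = Hom (tensorValueHom α β)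
    module C = Hom (coproductHom α β)

  coproductValue-power : ∀ α β k → let p = doublePowerSum (suc k) in
    coproductValue α β p ≋ value p α ⊕ value p β
  coproductValue-power α β k = ≋-trans
    (Hom.⟦⟧-cong (tensorValueHom α β) (IsComultiplication.powerSum-primitive comultiplication (suc k) (s≤s z≤n)))
    (⊕-cong (𝔸.*-identityʳ _) (𝔸.*-identityˡ _))

  -- P′ is the image of P under pₖ(x‖a) ↦ (−1)ᵏ⁻¹ pₖ(x‖a), aᵢ ↦ (a′)ᵢ.
  record Twisted (P P′ : Λ) : Set where
    field
      on-points    : ∀ μ → at-a′ (value P μ) ≋ value P′ (μ ᵗ)
      on-coproduct : ∀ α β → at-a′ (coproductValue α β P) ≋ coproductValue (α ᵗ) (β ᵗ) P′

  -- Sums and products are carried along by the homomorphisms involved. At a power sum the sign is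
  -- the same at both points, so it factors out of the primitive coproduct.
  twist : ∀ {d P} → Generated d P → ∃[ P′ ] Twisted P P′
  twist (constant r) = constΛ (at-a′ r) , record
    { on-points = λ μ → ≋-refl
    ; on-coproduct = λ α β → ≋-trans (Hom.⟦⟧-cong at-a′Hom (coproductValue-const α β r))
        (≋-sym (coproductValue-const (α ᵗ) (β ᵗ) (at-a′ r))) }
  twist (generator k) = constΛ (sign k) *Λ p , record
    { on-points = on-points
    ; on-coproduct = λ α β → begin
        at-a′ (coproductValue α β p)
          ≈⟨ Hom.⟦⟧-cong at-a′Hom (coproductValue-power α β k) ⟩
        at-a′ (value p α) ⊕ at-a′ (value p β)
          ≈⟨ ⊕-cong (on-points α) (on-points β) ⟩
        sign k ⊛ value p (α ᵗ) ⊕ sign k ⊛ value p (β ᵗ)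
          ≈⟨ ⊛-distribˡ _ _ _ ⟨
        sign k ⊛ (value p (α ᵗ) ⊕ value p (β ᵗ))
          ≈⟨ ⊛-cong (coproductValue-const (α ᵗ) (β ᵗ) (sign k)) (coproductValue-power (α ᵗ) (β ᵗ) k) ⟨
        coproductValue (α ᵗ) (β ᵗ) (constΛ (sign k)) ⊛ coproductValue (α ᵗ) (β ᵗ) p
          ≈⟨ Hom.*-homo (coproductHom (α ᵗ) (β ᵗ)) (constΛ (sign k)) p ⟨
        coproductValue (α ᵗ) (β ᵗ) (constΛ (sign k) *Λ p) ∎ }
    where
    p = doublePowerSum (suc k)
    on-points : ∀ μ → at-a′ (value p μ) ≋ sign k ⊛ value p (μ ᵗ)
    on-points μ = ≡.subst (λ κ → at-a′ (value p κ) ≋ sign k ⊛ value p (μ ᵗ)) (ᵗ-involutive μ) (value-powerSum-ᵗ k (μ ᵗ))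
  twist (_⟨+⟩_ {P = P} {Q} g h) with twist g | twist h
  ... | P′ , t | Q′ , u = P′ +Λ Q′ , record
    { on-points = λ μ → ⊕-cong (t.on-points μ) (u.on-points μ)
    ; on-coproduct = λ α β → ≋-trans (Hom.⟦⟧-cong at-a′Hom (Hom.+-homo (coproductHom α β) P Q))
        (≋-trans (⊕-cong (t.on-coproduct α β) (u.on-coproduct α β))
          (≋-sym (Hom.+-homo (coproductHom (α ᵗ) (β ᵗ)) P′ Q′))) }
    where module t = Twisted t
          module u = Twisted u
  twist (_⟨*⟩_ {P = P} {Q} g h) with twist g | twist h
  ... | P′ , t | Q′ , u = P′ *Λ Q′ , record
    { on-points = λ μ → ⊛-cong (t.on-points μ) (u.on-points μ)
    ; on-coproduct = λ α β → ≋-trans (Hom.⟦⟧-cong at-a′Hom (Hom.*-homo (coproductHom α β) P Q))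
        (≋-trans (⊛-cong (t.on-coproduct α β) (u.on-coproduct α β))
          (≋-sym (Hom.*-homo (coproductHom (α ᵗ) (β ᵗ)) P′ Q′))) }
    where module t = Twisted t
          module u = Twisted u
  twist (weaken _ g) = twist g

  module _ {s : Partition → Λ} (schur : ∀ κ → IsDoubleSchur κ (s κ)) where

    -- By `schur-ᵗ` the twist of s_ν has the values of s_ν′ at all points, hence equals it; the
    -- compatibility of the twist with Δ then applies to s_ν′.
    coproduct-ᵗ : ∀ ν α β → at-a′ (coproductValue α β (s ν)) ≋ coproductValue (α ᵗ) (β ᵗ) (s (ν ᵗ))
    coproduct-ᵗ ν α β with generated (s ν)
    ... | d , Q , g , Q≈s with twist g
    ...   | P′ , t = ≋-trans
      (Hom.⟦⟧-cong at-a′Hom (Hom.⟦⟧-cong (coproductHom α β) {s ν} {Q} (λ n → ≋-sym (Q≈s n))))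
      (≋-trans (t.on-coproduct α β) (Hom.⟦⟧-cong (coproductHom (α ᵗ) (β ᵗ)) {P′} {s (ν ᵗ)} (value-injective P′ (s (ν ᵗ)) agree)))
      where
      module t = Twisted t
      agree : ∀ μ → value P′ μ ≋ value (s (ν ᵗ)) μ
      agree μ = begin
        value P′ μ
          ≡⟨ ≡.cong (value P′) (ᵗ-involutive μ) ⟨
        value P′ (μ ᵗ ᵗ)
          ≈⟨ t.on-points (μ ᵗ) ⟨
        at-a′ (value Q (μ ᵗ))
          ≈⟨ Hom.⟦⟧-cong (at-a′Hom ∘ʰ valueHom (μ ᵗ)) {Q} {s ν} Q≈s ⟩
        at-a′ (value (s ν) (μ ᵗ))
          ≡⟨ ≡.cong (λ κ → at-a′ (value (s κ) (μ ᵗ))) (ᵗ-involutive ν) ⟨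
        at-a′ (value (s (ν ᵗ ᵗ)) (μ ᵗ))
          ≈⟨ schur-ᵗ schur μ (ν ᵗ) ⟨
        value (s (ν ᵗ)) μ ∎

-- Uniqueness of the coefficients

module _ {s : Partition → Λ} (schur : ∀ κ → IsDoubleSchur κ (s κ)) where

  private
    Pair : Set
    Pair = Partition × Partition

    _≟_ : ∀ (x y : Pair) → Dec (x ≡ y)
    _≟_ = ≡-dec _≟ₚ_ _≟ₚ_

  open DecMembership _≟_ using (_∈?_)

  pairValue : Pair → Pair → ℚ[a]
  pairValue (κ , μ) (α , β) = value (s κ) α ⊛ value (s μ) β

  private
    sizes : Pair → ℕ
    sizes (κ , μ) = size κ ℕ.+ size μ

    pairValue-regular : ∀ x → Regular ℚ[a]-ring (pairValue x x)
    pairValue-regular (α , β) = regular-* ℚ[a]-ring (schur-diagonal-regular schur α) (schur-diagonal-regular schur β)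

    -- A pair of values can be nonzero only if both partitions are included, and an inclusion that
    -- is proper in one of them lowers the total size.
    smaller-or-vanishes : ∀ x y → x ≢ y → sizes x < sizes y ⊎ pairValue x y ≋ 𝔸.0#
    smaller-or-vanishes (κ , μ) (α , β) x≢y with κ ⊆ₚ? α | μ ⊆ₚ? β
    ... | inj₂ (k , l) | _ = inj₂ (≋-trans (𝔸.*-congʳ (schur-vanishes κ α (schur κ) λ ⊆ → ℕ.<⇒≱ l (⊆ k))) (𝔸.zeroˡ _))
    ... | inj₁ _ | inj₂ (k , l) = inj₂ (≋-trans (𝔸.*-congˡ (schur-vanishes μ β (schur μ) λ ⊆ → ℕ.<⇒≱ l (⊆ k))) (𝔸.zeroʳ _))
    ... | inj₁ κ⊆α | inj₁ μ⊆β with κ ≟ₚ α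
    ...   | no κ≢α = inj₁ (ℕ.+-mono-<-≤ (size-strict κ α κ⊆α κ≢α) (size-mono μ β μ⊆β))
    ...   | yes ≡.refl = inj₁ (ℕ.+-mono-≤-< (size-mono κ α κ⊆α) (size-strict μ β μ⊆β λ { ≡.refl → x≢y ≡.refl }))

  -- The products s_κ(x‖a) ⊗ s_μ(x‖a) are linearly independent already as
  -- functions on pairs of points, by triangularity.
  module _ {c d : Pair → ℚ[a]} {L M} (L! : Unique L) (M! : Unique M)
    (c-support : ∀ x → x ∉ L → c x ≋ 𝔸.0#) (d-support : ∀ x → x ∉ M → d x ≋ 𝔸.0#)
    (equal : ∀ y → listSum L (λ x → c x ⊛ pairValue x y) ≋ listSum M (λ x → d x ⊛ pairValue x y)) where

    private
      U = deduplicate _≟_ (L ++ M)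

      U! : Unique U
      U! = deduplicate-! _≟_ (L ++ M)

      difference-sum : ∀ y → listSum U (λ x → c x ⊛ pairValue x y ⊕ ⊝ (d x ⊛ pairValue x y)) ≋ 𝔸.0#
      difference-sum y = begin
        listSum U (λ x → cy x ⊕ ⊝ dy x)
          ≈⟨ listSum-sub U cy dy ⟩
        listSum U cy ⊕ ⊝ listSum U dy
          ≈⟨ ⊕-cong
               (listSum-extend cy L! U! (λ x∈L → ∈-deduplicate⁺ _≟_ (∈-++⁺ˡ x∈L)) λ x _ x∉L → ≋-trans (𝔸.*-congʳ (c-support x x∉L)) (𝔸.zeroˡ _))
               (⊝-cong (listSum-extend dy M! U! (λ x∈M → ∈-deduplicate⁺ _≟_ (∈-++⁺ʳ L x∈M)) λ x _ x∉M → ≋-trans (𝔸.*-congʳ (d-support x x∉M)) (𝔸.zeroˡ _))) ⟨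
        listSum L cy ⊕ ⊝ listSum M dy
          ≈⟨ ⊕-cong (equal y) ≋-refl ⟩
        listSum M dy ⊕ ⊝ listSum M dy
          ≈⟨ 𝔸.-‿inverseʳ _ ⟩
        𝔸.0# ∎
        where
        cy dy : Pair → ℚ[a]
        cy x = c x ⊛ pairValue x y
        dy x = d x ⊛ pairValue x y

      -- At the pair y the difference of the two expansions keeps only the term of y: smaller
      -- indices agree by induction, and the others vanish at y. The remaining factor
      -- `pairValue y y` is regular.
      agree-below : ∀ k y → sizes y < k → c y ≋ d y
      agree-below (suc k) y (s≤s size≤) with y ∈? U
      ... | no y∉U = ≋-trans (c-support y λ y∈L → y∉U (∈-deduplicate⁺ _≟_ (∈-++⁺ˡ y∈L)))
                       (≋-sym (d-support y λ y∈M → y∉U (∈-deduplicate⁺ _≟_ (∈-++⁺ʳ L y∈M))))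
      ... | yes y∈U = cancel ℚ[a]-ring (pairValue-regular y) (begin
        S ⊛ c y
          -- The added `con (+ 0)` is the empty tail of `listSum (y ∷ [])`.
          ≈⟨ solve 3 (λ s c d → s :* c := ((c :* s :- d :* s) :+ con (+ 0)) :+ s :* d) ≋-refl S (c y) (d y) ⟩
        listSum (y ∷ []) e ⊕ S ⊛ d y
          ≈⟨ ⊕-cong (≋-trans (listSum-extend e ([] ∷ []) U! (λ { (here ≡.refl) → y∈U }) others) (difference-sum y)) ≋-refl ⟩
        𝔸.0# ⊕ S ⊛ d y
          ≈⟨ ⊕-identityˡ _ ⟩
        S ⊛ d y ∎)
        where
        S = pairValue y y
        e : Pair → ℚ[a]
        e x = c x ⊛ pairValue x y ⊕ ⊝ (d x ⊛ pairValue x y)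
        others : ∀ x → x ∈ U → x ∉ y ∷ [] → e x ≋ 𝔸.0#
        others x _ x∉ with smaller-or-vanishes x y (x∉ ∘ here)
        ... | inj₁ size< = ≋-trans (⊕-cong (𝔸.*-congʳ (agree-below k x (ℕ.<-≤-trans size< size≤))) ≋-refl) (𝔸.-‿inverseʳ _)
        ... | inj₂ z = ≋-trans (⊕-cong (𝔸.*-congˡ z) (⊝-cong (𝔸.*-congˡ z)))
                (solve 3 (λ c d z → c :* con (+ 0) :- d :* con (+ 0) := con (+ 0)) ≋-refl (c x) (d x) 𝔸.0#)

    coefficients-agree : ∀ y → c y ≋ d y
    coefficients-agree y = agree-below (suc (sizes y)) y ℕ.≤-refl

corollary4p2 : (s : Partition → Λ) → (∀ κ → IsDoubleSchur κ (s κ)) →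
    (Δ : Λ → Λ⊗Λ.Carrier) → IsComultiplication Δ →
    (ĉ : Partition → Partition → Partition → ℚ[a]) → IsDualLR s Δ ĉ →
    ∀ κ μ ν → ĉ κ μ ν ≋ at-a′ (ĉ (κ ᵗ) (μ ᵗ) (ν ᵗ))
corollary4p2 s schur Δ comultiplication ĉ dualLR κ μ ν =
  coefficients-agree schur L! (Unique.map⁺ ᵗ²-injective M!) lhs-support rhs-support equal (κ , μ)
  where
  Pair = Partition × Partition
  module T = Hom at-a′Hom
  L = proj₁ (dualLR ν)
  L! = proj₁ (proj₂ (dualLR ν))
  M = proj₁ (dualLR (ν ᵗ))
  M! = proj₁ (proj₂ (dualLR (ν ᵗ)))
  _ᵗ² : Pair → Pair
  (κ , μ) ᵗ² = κ ᵗ , μ ᵗ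
  ᵗ²-involutive : ∀ x → (x ᵗ²) ᵗ² ≡ x
  ᵗ²-involutive (κ , μ) = ≡.cong₂ _,_ (ᵗ-involutive κ) (ᵗ-involutive μ)
  ᵗ²-injective : ∀ {x y} → x ᵗ² ≡ y ᵗ² → x ≡ y
  ᵗ²-injective {x} {y} e = ≡.trans (≡.sym (ᵗ²-involutive x)) (≡.trans (≡.cong _ᵗ² e) (ᵗ²-involutive y))
  lhs rhs : Pair → ℚ[a]
  lhs (κ , μ) = ĉ κ μ ν
  rhs (κ , μ) = at-a′ (ĉ (κ ᵗ) (μ ᵗ) (ν ᵗ))
  lhs-support : ∀ x → x ∉ L → lhs x ≋ 𝔸.0#
  lhs-support (κ , μ) = proj₁ (proj₂ (proj₂ (dualLR ν))) κ μ
  rhs-support : ∀ x → x ∉ List.map _ᵗ² M → rhs x ≋ 𝔸.0#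
  rhs-support x@(κ , μ) x∉ = T.⟦⟧-cong (proj₁ (proj₂ (proj₂ (dualLR (ν ᵗ)))) (κ ᵗ) (μ ᵗ) λ x∈ →
    x∉ (≡.subst (_∈ List.map _ᵗ² M) (ᵗ²-involutive x) (∈-map⁺ _ᵗ² x∈)))
  expand : ∀ ν α β → coproductValue comultiplication α β (s ν) ≋
    listSum (proj₁ (dualLR ν)) λ { (κ , μ) → ĉ κ μ ν ⊛ pairValue schur (κ , μ) (α , β) }
  expand ν α β = ≋-trans (Hom.⟦⟧-cong (tensorValueHom α β) (proj₂ (proj₂ (proj₂ (dualLR ν))))) (lemma (proj₁ (dualLR ν)))
    where
    lemma : ∀ L → Hom.⟦_⟧ (tensorValueHom α β) (∑⊗ L (λ κ μ → ĉ κ μ ν Λ⊗Λ.· (s κ ⊗ s μ))) ≋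
      listSum L λ { (κ , μ) → ĉ κ μ ν ⊛ pairValue schur (κ , μ) (α , β) }
    lemma []            = ≋-refl
    lemma ((κ , μ) ∷ L) = ⊕-cong
      (≋-trans (⊛-assoc _ _ _) (𝔸.*-congˡ (𝔸.*-congˡ (𝔸.*-identityˡ _))))
      (lemma L)
  -- Both sides are the value of Δ(s_ν) at (a_α, a_β). The left expands it directly; the right
  -- expands Δ(s_ν′) at the conjugate points and substitutes a′, which moves the index list to its
  -- conjugate.
  equal : ∀ y → listSum L (λ x → lhs x ⊛ pairValue schur x y) ≋ listSum (List.map _ᵗ² M) (λ x → rhs x ⊛ pairValue schur x y)
  equal (α , β) = begin
    listSum L (λ x → lhs x ⊛ pairValue schur x (α , β))
      ≈⟨ expand ν α β ⟨
    coproductValue comultiplication α β (s ν)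
      -- Conjugating everything twice brings the value into the form of the right side of
      -- `coproduct-ᵗ`.
      ≡⟨ ≡.cong₂ (λ f ν → f (s ν)) (≡.cong₂ (coproductValue comultiplication) (ᵗ-involutive α) (ᵗ-involutive β)) (ᵗ-involutive ν) ⟨
    coproductValue comultiplication (α ᵗ ᵗ) (β ᵗ ᵗ) (s (ν ᵗ ᵗ))
      ≈⟨ coproduct-ᵗ comultiplication schur (ν ᵗ) (α ᵗ) (β ᵗ) ⟨
    at-a′ (coproductValue comultiplication (α ᵗ) (β ᵗ) (s (ν ᵗ)))
      ≈⟨ T.⟦⟧-cong (expand (ν ᵗ) (α ᵗ) (β ᵗ)) ⟩
    at-a′ (listSum M λ { (κ , μ) → ĉ κ μ (ν ᵗ) ⊛ pairValue schur (κ , μ) (α ᵗ , β ᵗ) })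
      ≈⟨ twisted M ⟩
    listSum M (λ x → rhs (x ᵗ²) ⊛ pairValue schur (x ᵗ²) (α , β))
      ≈⟨ listSum-map _ᵗ² M (λ x → rhs x ⊛ pairValue schur x (α , β)) ⟨
    listSum (List.map _ᵗ² M) (λ x → rhs x ⊛ pairValue schur x (α , β)) ∎
    where
    schur-twisted : ∀ κ α → at-a′ (value (s κ) (α ᵗ)) ≋ value (s (κ ᵗ)) α
    schur-twisted κ α = ≋-sym (≋-trans (schur-ᵗ schur α (κ ᵗ))
      (𝔸.reflexive (≡.cong (λ κ → at-a′ (value (s κ) (α ᵗ))) (ᵗ-involutive κ))))
    twisted : ∀ M → at-a′ (listSum M λ { (κ , μ) → ĉ κ μ (ν ᵗ) ⊛ pairValue schur (κ , μ) (α ᵗ , β ᵗ) }) ≋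
      listSum M (λ x → rhs (x ᵗ²) ⊛ pairValue schur (x ᵗ²) (α , β))
    twisted [] = ≋-refl
    twisted ((κ , μ) ∷ M) = ⊕-cong
      (⊛-cong (𝔸.reflexive (≡.cong₂ (λ κ μ → at-a′ (ĉ κ μ (ν ᵗ))) (≡.sym (ᵗ-involutive κ)) (≡.sym (ᵗ-involutive μ))))
        (⊛-cong (schur-twisted κ α) (schur-twisted μ β)))
      (twisted M)
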